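{- For the game GoldenNugget the following hold. (i) If $h\in B$, then $\mathrm{rcf}(h)=\{1\mid 0\}$. (ii) If $h\in\widehat{AB_0}$, then $\mathrm{rcf}(h)=1$. (iii) If $h\in\mathcal{Q}\setminus\{0\}$, then $\mathrm{val}(h)$ is a number and $\mathrm{val}(h)\in[1/2,1)$. Furthermore, for all $n\ge 0$, $\mathrm{val}(F_{2n+3}-2)=s(n)$ and $\mathrm{val}(F_{2n+4}-2)=q(n)$. (iv) If $n\ge 1$ is an integer and $h\in G(n)$ (where $G(n)\subset AB_0$), then $\mathrm{rcf}(h)=\{1\mid s(n)\}$.
   Context: Number theory notation. Let $\phi=\frac{1+\sqrt5}{2}$, and for integers $n\ge 0$ let $A(n)=\lfloor n\phi\rfloor$, $B(n)=\lfloor n\phi^2\rfloor$; juxtaposition is composition ($AB(n)=A(B(n))$, $B^2(n)=B(B(n))$). $B=\{B(n): n\ge 1\}$; $AB_0=\{AB(n): n\ge 0\}$; $\widehat{AB_0}=\{AB(n)+1: n\ge 0\}$; $\widehat{B^2}=\{B^2(n)+1: n\ge 1\}$. Fibonacci numbers: $F_0=0$, $F_1=F_2=1$, $F_n=F_{n-1}+F_{n-2}$. $\mathcal{Q}=\widehat{B^2}\cup\{F_{2n+3}-2: n\ge 0\}$. For $i,n\ge 0$, $G_i(n)=\lfloor i\phi\rfloor F_{2n+2}+iF_{2n+1}+F_{2n+3}-2$, and for $n\ge 1$, $G(n)=\{G_i(n): i>0\}$. For $n\ge 0$, $s(n)=\frac23\cdot\frac{4^n-1}{4^n}$ and $q(n)=\frac23\cdot\frac{4^n+\frac12}{4^n}$.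 Game theory. Games are finite normal-play partizan games $G=\{G^{\mathcal L}\mid G^{\mathcal R}\}$ (sets of Left and Right options; a player unable to move loses), with the usual disjunctive sum, negative, and partial order: $G\ge H$ iff Left wins $G-H$ when Right moves first; $G=H$ iff $G\ge H$ and $H\ge G$. Dyadic rationals are identified with games in the usual way ($0=\{\,\mid\,\}$, $1=\{0\mid\,\}$, $\frac12=\{0\mid 1\}$, etc.); a game is a number if it equals a dyadic rational. The canonical form of a game is the unique equal game none of whose sub-positions has dominated or reversible options. Stops: if $G$ is a number, $L(G)=R(G)=G$; otherwise $L(G)=\max R(G^L)$ and $R(G)=\min L(G^R)$ over options. $G$ is hot if $L(G)>R(G)$. $G\ge_I H$ means $G-H\ge -x$ for every positive number $x$; $G=_I H$ ($G$, $H$ infinitesimally close) means $-x<G-H<x$ for every positive number $x$. A Left option $G^{L_1}$ is Inf-dominated by another Left option $G^{L_2}$ if $G^{L_2}\ge_I G^{L_1}$; a Right option $G^{R_1}$ is Inf-dominated by another Right option $G^{R_2}$ if $G^{R_1}\ge_I G^{R_2}$. A Left option $G^{L_1}$ is Inf-reversible if $G\ge_I G^{L_1R_1}$ for some Right option $G^{L_1R_1}$ of $G^{L_1}$; a Right option $G^{R_1}$ is Inf-reversible if $G^{R_1L_1}\ge_I G$ for some Left option $G^{R_1L_1}$ of $G^{R_1}$. A game $K$ is in reduced canonical form if every sub-position $H$ of $K$ (including $K$) either is a number in canonical form, or is hot with no Inf-dominated or Inf-reversible options. For every $G$ there is a unique $K$ in reduced canonical form with $G=_I K$ (a known theorem);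 it is denoted $\mathrm{rcf}(G)$. GoldenNugget: a position is a heap of $h\ge 0$ counters; Left's options are the heaps $h-a$ with $a\in\{A(i): i\ge 1\}$, $a\le h$, and Right's options are the heaps $h-b$ with $b\in\{B(i): i\ge 1\}$, $b\le h$. $\mathrm{val}(h)$ is the (canonical form) value of the heap of size $h$ and $\mathrm{rcf}(h)$ is its reduced canonical form. -}

module Defs where

open import Data.Nat.Base as ℕ using (ℕ; zero; suc; z≤n; s≤s)
import Data.Nat.Properties as ℕ
import Data.Nat.DivMod as ℕ
open import Data.Nat.Induction using (<-rec; <-wellFounded)
open import Data.Integer.Base as ℤ using (ℤ; +_; -[1+_])
open import Data.Rational.Base as ℚ using (ℚ; 0ℚ; 1ℚ; ½)
open import Data.Fin.Base using (Fin; toℕ)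
open import Data.Fin.Properties using (toℕ<n)
open import Data.List.Base using (List; []; _∷_; _++_; map; filter; allFin)
open import Data.List.Properties using (map-cong)
open import Data.List.Membership.Propositional using (_∈_)
open import Data.List.Relation.Unary.All using (All)
open import Data.List.Relation.Unary.Any using (Any)
open import Data.Product.Base using (∃; ∃-syntax; ∃₂; _×_; _,_; proj₁; proj₂)
open import Data.Sum.Base using (_⊎_)
open import Relation.Nullary using (¬_; Dec; yes; no)
open import Relation.Nullary.Decidable using (map′)
open import Relation.Unary using (Pred; Decidable)
open import Relation.Binary.PropositionalEquality using (_≡_; _≢_; refl; cong; cong₂; subst)
open import Induction.WellFounded using (module FixPoint)
open import Level using (0ℓ)

------------------------------------------------------------------------
-- Wythoff sequences

-- The largest r ≤ b with r² ≤ n.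
isqrt≤ : ℕ → ℕ → ℕ
isqrt≤ zero    n = 0
isqrt≤ (suc b) n with suc b ℕ.* suc b ℕ.≤? n
... | yes _ = suc b
... | no  _ = isqrt≤ b n

-- ⌊√n⌋; see isqrt-lower and isqrt-upper.
isqrt : ℕ → ℕ
isqrt n = isqrt≤ n n

-- n φ = (n + √(5n²)) / 2 and n φ² = (3n + √(5n²)) / 2, and for integers
-- k and real x one has ⌊(k + x) / 2⌋ = ⌊(k + ⌊x⌋) / 2⌋.
A : ℕ → ℕ
A n = (n ℕ.+ isqrt (5 ℕ.* (n ℕ.* n))) ℕ./ 2

B : ℕ → ℕ
B n = (3 ℕ.* n ℕ.+ isqrt (5 ℕ.* (n ℕ.* n))) ℕ./ 2

isqrt≤-lower : ∀ b n → isqrt≤ b n ℕ.* isqrt≤ b n ℕ.≤ n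
isqrt≤-lower zero    n = z≤n
isqrt≤-lower (suc b) n with suc b ℕ.* suc b ℕ.≤? n
... | yes p = p
... | no  _ = isqrt≤-lower b n

isqrt≤-upper : ∀ b n → n ℕ.< suc b ℕ.* suc b → n ℕ.< suc (isqrt≤ b n) ℕ.* suc (isqrt≤ b n)
isqrt≤-upper zero    n n<b² = n<b²
isqrt≤-upper (suc b) n n<b² with suc b ℕ.* suc b ℕ.≤? n
... | yes _ = n<b²
... | no ¬p = isqrt≤-upper b n (ℕ.≰⇒> ¬p)

isqrt-lower : ∀ n → isqrt n ℕ.* isqrt n ℕ.≤ n
isqrt-lower n = isqrt≤-lower n n

isqrt-upper : ∀ n → n ℕ.< suc (isqrt n) ℕ.* suc (isqrt n)
isqrt-upper n = isqrt≤-upper n n (ℕ.m≤m+n (suc n) (n ℕ.* suc n))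

n≤isqrt5n² : ∀ n → n ℕ.≤ isqrt (5 ℕ.* (n ℕ.* n))
n≤isqrt5n² n = ℕ.≮⇒≥ λ r<n → ℕ.<⇒≱ (isqrt-upper (5 ℕ.* (n ℕ.* n)))
  (ℕ.≤-trans (ℕ.*-mono-≤ r<n r<n) (ℕ.m≤m+n (n ℕ.* n) (4 ℕ.* (n ℕ.* n))))

half-≥ : ∀ n {m} → n ℕ.* 2 ℕ.≤ m → n ℕ.≤ m ℕ./ 2
half-≥ n {m} le = subst (ℕ._≤ m ℕ./ 2) (ℕ.m*n/n≡m n 2) (ℕ./-monoˡ-≤ 2 le)

n≤A : ∀ n → n ℕ.≤ A n
n≤A n = half-≥ n (subst (ℕ._≤ n ℕ.+ isqrt (5 ℕ.* (n ℕ.* n)))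
  (subst (λ z → n ℕ.+ z ≡ n ℕ.* 2) (ℕ.+-identityʳ n) (ℕ.*-comm 2 n))
  (ℕ.+-monoʳ-≤ n (n≤isqrt5n² n)))

n≤B : ∀ n → n ℕ.≤ B n
n≤B n = ℕ.≤-trans (n≤A n)
  (ℕ./-monoˡ-≤ 2 (ℕ.+-monoˡ-≤ (isqrt (5 ℕ.* (n ℕ.* n))) (ℕ.m≤m+n n (2 ℕ.* n))))

------------------------------------------------------------------------
-- Sets of natural numbers, as predicates

F : ℕ → ℕ
F 0             = 0
F 1             = 1
F (suc (suc n)) = F (suc n) ℕ.+ F n

-- The values of f at positive arguments.
Range⁺ : (ℕ → ℕ) → Pred ℕ 0ℓ
Range⁺ f a = ∃[ i ] (1 ℕ.≤ i × f i ≡ a)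

InB : Pred ℕ 0ℓ
InB = Range⁺ B

InAB₀ : Pred ℕ 0ℓ
InAB₀ h = ∃[ n ] A (B n) ≡ h

InAB₀^ : Pred ℕ 0ℓ
InAB₀^ h = ∃[ n ] A (B n) ℕ.+ 1 ≡ h

InB²^ : Pred ℕ 0ℓ
InB²^ = Range⁺ (λ n → B (B n) ℕ.+ 1)

-- The truncated subtractions here and in G⟨_⟩ are exact: F (2n + 3) ≥ 2.
InQ : Pred ℕ 0ℓ
InQ h = InB²^ h ⊎ (∃[ n ] F (2 ℕ.* n ℕ.+ 3) ℕ.∸ 2 ≡ h)

G⟨_⟩ : ℕ → ℕ → ℕ
G⟨ i ⟩ n = A i ℕ.* F (2 ℕ.* n ℕ.+ 2) ℕ.+ i ℕ.* F (2 ℕ.* n ℕ.+ 1) ℕ.+ F (2 ℕ.* n ℕ.+ 3) ℕ.∸ 2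

InG : ℕ → Pred ℕ 0ℓ
InG n = Range⁺ (λ i → G⟨ i ⟩ n)

infixl 7 _/2^_

_/2^_ : ℤ → ℕ → ℚ
m /2^ k = ℚ._/_ m (2 ℕ.^ k) {{ℕ.m^n≢0 2 k}}

_/4^_ : ℚ → ℕ → ℚ
x /4^ n = x ℚ.* ℚ._/_ (+ 1) (4 ℕ.^ n) {{ℕ.m^n≢0 4 n}}

4^_ : ℕ → ℚ
4^ n = (+ (4 ℕ.^ n)) ℚ./ 1

s : ℕ → ℚ
s n = ((+ 2) ℚ./ 3) ℚ.* ((4^ n ℚ.- 1ℚ) /4^ n)

q : ℕ → ℚ
q n = ((+ 2) ℚ./ 3) ℚ.* ((4^ n ℚ.+ ½) /4^ n)

------------------------------------------------------------------------
-- Finite partizan games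

-- The lists stand for finite sets: order and repetition are irrelevant.
data Game : Set where
  ⟨_∣_⟩ : List Game → List Game → Game

left right : Game → List Game
left  ⟨ L ∣ R ⟩ = L
right ⟨ L ∣ R ⟩ = R

infix  8 -ᴳ_
infixl 6 _+ᴳ_ _-ᴳ_

-ᴳ_    : Game → Game
negAll : List Game → List Game

-ᴳ ⟨ L ∣ R ⟩ = ⟨ negAll R ∣ negAll L ⟩

negAll []       = []
negAll (G ∷ Gs) = -ᴳ G ∷ negAll Gs

_+ᴳ_ : Game → Game → Game
addˡ : List Game → Game → List Game
addʳ : Game → List Game → List Game

G@(⟨ L ∣ R ⟩) +ᴳ H@(⟨ L′ ∣ R′ ⟩) = ⟨ addˡ L H ++ addʳ G L′ ∣ addˡ R H ++ addʳ G R′ ⟩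

addˡ []       H = []
addˡ (G ∷ Gs) H = G +ᴳ H ∷ addˡ Gs H

addʳ G []       = []
addʳ G (H ∷ Hs) = G +ᴳ H ∷ addʳ G Hs

_-ᴳ_ : Game → Game → Game
G -ᴳ H = G +ᴳ (-ᴳ H)

data LeftWinsFirst  : Game → Set
data LeftWinsSecond : Game → Set

data LeftWinsFirst where
  move  : ∀ {G} → Any LeftWinsSecond (left G) → LeftWinsFirst G

data LeftWinsSecond where
  reply : ∀ {G} → All LeftWinsFirst (right G) → LeftWinsSecond G

infix 4 _≥ᴳ_ _>ᴳ_ _=ᴳ_

_≥ᴳ_ _>ᴳ_ _=ᴳ_ : Game → Game → Set
G ≥ᴳ H = LeftWinsSecond (G -ᴳ H)
G >ᴳ H = G ≥ᴳ H × ¬ (H ≥ᴳ G)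
G =ᴳ H = G ≥ᴳ H × H ≥ᴳ G

-- Sub-positions, including the game itself.
infix 4 _⊑_

data _⊑_ (H : Game) : Game → Set where
  self      : H ⊑ H
  via-left  : ∀ {G K} → K ∈ left G  → H ⊑ K → H ⊑ G
  via-right : ∀ {G K} → K ∈ right G → H ⊑ K → H ⊑ G

------------------------------------------------------------------------
-- Dyadic rationals as games

integer : ℤ → Game
integer (+ zero)       = ⟨ [] ∣ [] ⟩
integer (+ suc n)      = ⟨ integer (+ n) ∷ [] ∣ [] ⟩
integer (-[1+ zero ])  = ⟨ [] ∣ integer (+ zero) ∷ [] ⟩
integer (-[1+ suc n ]) = ⟨ [] ∣ integer -[1+ n ] ∷ [] ⟩

-- The game of m / 2ᵏ: for m = 2j + 1 it is { j / 2ᵏ⁻¹ ∣ (j + 1) / 2ᵏ⁻¹ },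
-- where /ℕ rounds towards -∞.
dyadic : ℤ → ℕ → Game
dyadic m zero = integer m
dyadic m (suc k) with m ℤ.%ℕ 2
... | zero  = dyadic (m ℤ./ℕ 2) k
... | suc _ = ⟨ dyadic (m ℤ./ℕ 2) k ∷ [] ∣ dyadic (ℤ.suc (m ℤ./ℕ 2)) k ∷ [] ⟩

0ᴳ 1ᴳ : Game
0ᴳ = integer (+ 0)
1ᴳ = integer (+ 1)

infix 4 _Denotes_ _Equals_

-- S is the game with which the dyadic rational x is identified.
_Denotes_ : Game → ℚ → Set
S Denotes x = ∃₂ λ m k → x ≡ m /2^ k × S ≡ dyadic m k

_Equals_ : Game → ℚ → Set
G Equals x = ∃[ S ] (S Denotes x × G =ᴳ S)

IsNumber : Game → Set
IsNumber G = ∃[ x ] G Equals x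

------------------------------------------------------------------------
-- Canonical forms

-- "Another option" is another game tree, possibly of equal value, hence _≢_
-- and not ¬ (_ =ᴳ _).  Listing one option set in two orders gives distinct
-- trees, which only makes Canonical and Reduced more demanding.
HasDominated : Game → Set
HasDominated G =
    (∃₂ λ G₁ G₂ → G₁ ∈ left G  × G₂ ∈ left G  × G₁ ≢ G₂ × G₂ ≥ᴳ G₁)
  ⊎ (∃₂ λ G₁ G₂ → G₁ ∈ right G × G₂ ∈ right G × G₁ ≢ G₂ × G₁ ≥ᴳ G₂)

HasReversible : Game → Set
HasReversible G =
    (∃₂ λ G₁ G₂ → G₁ ∈ left G  × G₂ ∈ right G₁ × G ≥ᴳ G₂)
  ⊎ (∃₂ λ G₁ G₂ → G₁ ∈ right G × G₂ ∈ left G₁  × G₂ ≥ᴳ G)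

Canonical : Game → Set
Canonical K = ∀ {H} → H ⊑ K → ¬ HasDominated H × ¬ HasReversible H

infix 4 _IsCanonicalFormOf_

_IsCanonicalFormOf_ : Game → Game → Set
K IsCanonicalFormOf G = K =ᴳ G × Canonical K

------------------------------------------------------------------------
-- Stops and reduced canonical forms

data LeftStop  : Game → ℚ → Set
data RightStop : Game → ℚ → Set

data LeftStop where
  number : ∀ {G x} → G Equals x → LeftStop G x
  max    : ∀ {G x} → ¬ IsNumber G →
           Any (λ H → RightStop H x) (left G) →
           All (λ H → ∃[ y ] (RightStop H y × y ℚ.≤ x)) (left G) →
           LeftStop G x

data RightStop where
  number : ∀ {G x} → G Equals x → RightStop G x
  min    : ∀ {G x} → ¬ IsNumber G →
           Any (λ H → LeftStop H x) (right G) →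
           All (λ H → ∃[ y ] (LeftStop H y × x ℚ.≤ y)) (right G) →
           RightStop G x

Hot : Game → Set
Hot G = ∃₂ λ l r → LeftStop G l × RightStop G r × l ℚ.> r

infix 4 _≥ᴵ_ _=ᴵ_

_≥ᴵ_ _=ᴵ_ : Game → Game → Set
G ≥ᴵ H = ∀ x → IsNumber x → x >ᴳ 0ᴳ → (G -ᴳ H) ≥ᴳ (-ᴳ x)
G =ᴵ H = ∀ x → IsNumber x → x >ᴳ 0ᴳ → (G -ᴳ H) >ᴳ (-ᴳ x) × x >ᴳ (G -ᴳ H)

HasInfDominated : Game → Set
HasInfDominated G =
    (∃₂ λ G₁ G₂ → G₁ ∈ left G  × G₂ ∈ left G  × G₁ ≢ G₂ × G₂ ≥ᴵ G₁)
  ⊎ (∃₂ λ G₁ G₂ → G₁ ∈ right G × G₂ ∈ right G × G₁ ≢ G₂ × G₁ ≥ᴵ G₂)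

HasInfReversible : Game → Set
HasInfReversible G =
    (∃₂ λ G₁ G₂ → G₁ ∈ left G  × G₂ ∈ right G₁ × G ≥ᴵ G₂)
  ⊎ (∃₂ λ G₁ G₂ → G₁ ∈ right G × G₂ ∈ left G₁  × G₂ ≥ᴵ G)

Reduced : Game → Set
Reduced K = ∀ {H} → H ⊑ K →
    (IsNumber H × Canonical H)
  ⊎ (Hot H × ¬ HasInfDominated H × ¬ HasInfReversible H)

infix 4 _IsRcfOf_

-- rcf(G) = K
_IsRcfOf_ : Game → Game → Set
K IsRcfOf G = G =ᴵ K × Reduced K

------------------------------------------------------------------------
-- GoldenNugget

range⁺? : ∀ f → (∀ n → n ℕ.≤ f n) → Decidable (Range⁺ f)
range⁺? f n≤f a = map′
  (λ (i , _ , p) → i , p)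
  (λ { (i , 1≤i , refl) → i , s≤s (n≤f i) , 1≤i , refl })
  (ℕ.anyUpTo? (λ i → dec i) (suc a))
  where
  dec : ∀ i → Dec (1 ℕ.≤ i × f i ≡ a)
  dec i with 1 ℕ.≤? i | f i ℕ.≟ a
  ... | yes p | yes e = yes (p , e)
  ... | no ¬p | _     = no λ x → ¬p (proj₁ x)
  ... | _     | no ¬e = no λ x → ¬e (proj₂ x)

-- A move from h is recorded as the heap k < h it leaves; h ∸ k counters
-- are removed.
leftMoves rightMoves : (h : ℕ) → List (Fin h)
leftMoves  h = filter (λ k → range⁺? A n≤A (h ℕ.∸ toℕ k)) (allFin h)
rightMoves h = filter (λ k → range⁺? B n≤B (h ℕ.∸ toℕ k)) (allFin h)

heapStep : ∀ h → (∀ {k} → k ℕ.< h → Game) → Game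
heapStep h rec = ⟨ map (λ k → rec (toℕ<n k)) (leftMoves h) ∣ map (λ k → rec (toℕ<n k)) (rightMoves h) ⟩

heap : ℕ → Game
heap = <-rec (λ _ → Game) heapStep

heap-unfold : ∀ h → heap h ≡ ⟨ map (λ k → heap (toℕ k)) (leftMoves h) ∣ map (λ k → heap (toℕ k)) (rightMoves h) ⟩
heap-unfold h = FixPoint.unfold-wfRec <-wellFounded (λ _ → Game) heapStep
  (λ x eq → cong₂ ⟨_∣_⟩ (map-cong (λ k → eq (toℕ<n k)) (leftMoves x))
                        (map-cong (λ k → eq (toℕ<n k)) (rightMoves x)))

infix 4 _IsVal_

-- val(h) = K
_IsVal_ : Game → ℕ → Set
K IsVal h = K IsCanonicalFormOf heap h

{-# OPTIONS --safe #-}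

-- Write θ(n) for the fractional part of nφ, with θ(0) = 1.  The sets B, AB₀+1,
-- B²+1 and AB₀ consist of the n with θ(n) in the consecutive intervals of
-- (0, 1] cut at φ⁻², φ⁻¹ and 4 - 2φ; Left removes a with θ(a) > φ⁻² and Right
-- removes b with θ(b) < φ⁻².  Comparing fractional parts shows which classes a
-- move can reach, and the values follow by induction on the heap.  The least
-- obvious case is B²+1: if Left and Right move from a heap of this class to
-- heaps k and l of the same class, then θ(k) > θ(l), so one of k and l is an
-- option of the other and val(k) < val(l); hence the heap is a number.
-- No smaller heap has θ closer to 4 - 2φ from above than F(2n+3) - 2, or from
-- below than F(2n+4) - 2, which yields s(n+1) = {s(n) | q(n)} and
-- q(n+1) = {s(n+1) | q(n)}.

module Submission where

open import Defs
open import Data.Nat.Base as ℕ using (ℕ; zero; suc)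
import Data.Nat.Properties as ℕ
import Data.Nat.DivMod as ℕ
import Data.Nat.Tactic.RingSolver as ℕ-Ring
open import Data.Nat.Divisibility.Core using (divides)
open import Data.Nat.Induction using (<-rec)
open import Data.Integer.Base as ℤ using (ℤ; +_; -[1+_])
import Data.Integer.Properties as ℤ
import Data.Integer.DivMod as ℤ
open import Data.Integer.Tactic.RingSolver using (solve-∀)
open import Data.Rational.Base as ℚ using (ℚ; 1ℚ; ½)
import Data.Rational.Properties as ℚ
import Data.Rational.Unnormalised.Base as ℚᵘ
import Data.Rational.Unnormalised.Properties as ℚᵘ
open import Data.Fin.Base using (Fin; toℕ; fromℕ<)
open import Data.Fin.Properties using (toℕ<n; toℕ-fromℕ<)
open import Data.List.Base using (List; []; _∷_; map; filter; allFin)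
open import Data.List.Membership.Propositional using (_∈_; find)
open import Data.List.Membership.Propositional.Properties using (∈-++⁺ˡ; ∈-++⁺ʳ; ∈-++⁻; ∈-map⁺; ∈-map⁻; ∈-filter⁺; ∈-filter⁻; ∈-allFin)
open import Data.List.Relation.Unary.Any as Any using (Any; here; there)
open import Data.List.Relation.Unary.All as All using (All; []; _∷_)
open import Data.Product.Base using (∃-syntax; ∃₂; _×_; _,_; proj₁; proj₂)
open import Data.Sum using (_⊎_; inj₁; inj₂; swap; from-inj₁; from-inj₂)
open import Data.Empty using (⊥; ⊥-elim)
open import Relation.Nullary using (¬_; Dec; yes; no)
open import Relation.Nullary.Decidable using (True; toWitness)
open import Relation.Binary.PropositionalEquality using (_≡_; _≢_; refl; sym; trans; cong; cong₂; subst; subst₂; module ≡-Reasoning)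
open import Algebra.Properties.AbelianGroup ℤ.+-0-abelianGroup using (∙-cancelˡ)

-- Comparison of games by play

-- The cut point 4 - 2φ is the fractional part of -2φ, so θ(h) is close to it when (h + 2)φ is close
-- to an integer. The best approximations from the two sides are the Fibonacci numbers of odd and of
-- even index; hence the heaps F(2n+3) - 2 and F(2n+4) - 2.
--
-- The obstacle is that most heaps are hot and their exact values are not determined. A comparison
-- with a number, however, takes only one good option: from a hot heap Left can reach a heap that is
-- at least 1 up to infinitesimals, and Right one of value 0 or s(m). For hot heaps the induction
-- therefore carries such options instead of a value. To know which s(m) is available, AB₀ has to be
-- resolved further: each of its heaps is F(2m+3) - 2 or belongs to some G(m) with m ≥ 1, by a
-- descent under multiplication by φ².
--
-- Comparisons with φ take place in ℤ[φ], where signs are defined through Fibonacci numbers, so that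
-- everything stays in integers.

game-induction : (P : Game → Set) →
  (∀ G → (∀ {L} → L ∈ left G → P L) → (∀ {R} → R ∈ right G → P R) → P G) → ∀ G → P G
game-induction P step = go
  where
  go  : ∀ G → P G
  goᴸ : ∀ Gs {H} → H ∈ Gs → P H
  go ⟨ L ∣ R ⟩ = step ⟨ L ∣ R ⟩ (goᴸ L) (goᴸ R)
  goᴸ (G ∷ Gs) (here refl) = go G
  goᴸ (G ∷ Gs) (there H∈)  = goᴸ Gs H∈

infix 4 _≽_ _⊳_ _≈_

-- G ⊳ H says that Left, moving first, wins G - H.
data _≽_ : Game → Game → Set
data _⊳_ : Game → Game → Set

data _≽_ where
  second : ∀ {G H} → (∀ {R} → R ∈ right G → R ⊳ H) → (∀ {L} → L ∈ left H → G ⊳ L) → G ≽ H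

data _⊳_ where
  byLeft  : ∀ {G H L} → L ∈ left G → L ≽ H → G ⊳ H
  byRight : ∀ {G H R} → R ∈ right H → G ≽ R → G ⊳ H

_≈_ : Game → Game → Set
G ≈ H = G ≽ H × H ≽ G

≽-trans   : ∀ {G H K} → G ≽ H → H ≽ K → G ≽ K
≽-⊳-trans : ∀ {G H K} → G ≽ H → H ⊳ K → G ⊳ K
⊳-≽-trans : ∀ {G H K} → G ⊳ H → H ≽ K → G ⊳ K
≽-trans p@(second f _) q@(second _ g) = second (λ R∈ → ⊳-≽-trans (f R∈) q) (λ L∈ → ≽-⊳-trans p (g L∈))
≽-⊳-trans (second _ g) (byLeft L∈ q)  = ⊳-≽-trans (g L∈) q
≽-⊳-trans p            (byRight R∈ q) = byRight R∈ (≽-trans p q)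
⊳-≽-trans (byLeft L∈ p)  q            = byLeft L∈ (≽-trans p q)
⊳-≽-trans (byRight R∈ p) (second f _) = ≽-⊳-trans p (f R∈)

≽-refl : ∀ G → G ≽ G
≽-refl = game-induction (λ G → G ≽ G) λ G ihᴸ ihᴿ →
  second (λ R∈ → byRight R∈ (ihᴿ R∈)) (λ L∈ → byLeft L∈ (ihᴸ L∈))

≈-refl : ∀ G → G ≈ G
≈-refl G = ≽-refl G , ≽-refl G

≽⇒⋪ : ∀ {G H} → G ≽ H → ¬ (H ⊳ G)
≽⇒⋪ (second _ g) (byLeft L∈ p)  = ≽⇒⋪ p (g L∈)
≽⇒⋪ (second f _) (byRight R∈ p) = ≽⇒⋪ p (f R∈)

⊳-left : ∀ {G L} → L ∈ left G → G ⊳ L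
⊳-left {L = L} L∈ = byLeft L∈ (≽-refl L)

right-⊳ : ∀ {G R} → R ∈ right G → R ⊳ G
right-⊳ {R = R} R∈ = byRight R∈ (≽-refl R)

all⊎any : ∀ {P Q : Game → Set} Gs → (∀ {G} → G ∈ Gs → P G ⊎ Q G) →
          (∀ {G} → G ∈ Gs → P G) ⊎ (∃[ G ] (G ∈ Gs × Q G))
all⊎any []       _ = inj₁ λ ()
all⊎any (G ∷ Gs) d with d (here refl) | all⊎any Gs (λ G∈ → d (there G∈))
... | inj₂ q | _                   = inj₂ (G , here refl , q)
... | _      | inj₂ (H , H∈ , q)   = inj₂ (H , there H∈ , q)
... | inj₁ p | inj₁ ps             = inj₁ λ { (here refl) → p ; (there G∈) → ps G∈ }

-- Both orders of the pair are treated at once, because a move turns the question about (G, H) into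
-- the one with the roles exchanged. The proof computes, so inequalities between closed games can be
-- settled by evaluating it.
determined : ∀ G H → (G ≽ H ⊎ H ⊳ G) × (H ≽ G ⊎ G ⊳ H)
determined = game-induction _ λ G ihᴸ ihᴿ → game-induction _ λ H jhᴸ jhᴿ →
  decide₁ G H (λ R∈ → proj₂ (ihᴿ R∈ H)) (λ L∈ → proj₂ (jhᴸ L∈)) ,
  decide₁ H G (λ R∈ → proj₁ (jhᴿ R∈)) (λ L∈ → proj₁ (ihᴸ L∈ H))
  where
  decide₁ : ∀ G H → (∀ {R} → R ∈ right G → H ≽ R ⊎ R ⊳ H) →
            (∀ {L} → L ∈ left H → L ≽ G ⊎ G ⊳ L) → G ≽ H ⊎ H ⊳ G
  decide₁ G H r l with all⊎any (right G) (λ R∈ → swap (r R∈))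
                     | all⊎any (left H)  (λ L∈ → swap (l L∈))
  ... | inj₂ (_ , R∈ , p) | _                 = inj₂ (byRight R∈ p)
  ... | _                 | inj₂ (_ , L∈ , p) = inj₂ (byLeft L∈ p)
  ... | inj₁ f            | inj₁ g            = inj₁ (second f g)

≽⊎⊲ : ∀ G H → G ≽ H ⊎ H ⊳ G
≽⊎⊲ G H = proj₁ (determined G H)

-- Options of sums and negatives, and agreement with the order defined by G - H

∈-addˡ⁺ : ∀ {G Gs H} → G ∈ Gs → G +ᴳ H ∈ addˡ Gs H
∈-addˡ⁺ (here refl) = here refl
∈-addˡ⁺ (there G∈)  = there (∈-addˡ⁺ G∈)

∈-addʳ⁺ : ∀ {G H Hs} → H ∈ Hs → G +ᴳ H ∈ addʳ G Hs
∈-addʳ⁺ (here refl) = here refl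
∈-addʳ⁺ (there H∈)  = there (∈-addʳ⁺ H∈)

∈-addˡ⁻ : ∀ {X H} Gs → X ∈ addˡ Gs H → ∃[ G ] (G ∈ Gs × X ≡ G +ᴳ H)
∈-addˡ⁻ (G ∷ Gs) (here refl) = G , here refl , refl
∈-addˡ⁻ (G ∷ Gs) (there X∈) with ∈-addˡ⁻ Gs X∈
... | K , K∈ , e = K , there K∈ , e

∈-addʳ⁻ : ∀ {X G} Hs → X ∈ addʳ G Hs → ∃[ H ] (H ∈ Hs × X ≡ G +ᴳ H)
∈-addʳ⁻ (H ∷ Hs) (here refl) = H , here refl , refl
∈-addʳ⁻ (H ∷ Hs) (there X∈) with ∈-addʳ⁻ Hs X∈
... | K , K∈ , e = K , there K∈ , e

∈-negAll⁺ : ∀ {G Gs} → G ∈ Gs → -ᴳ G ∈ negAll Gs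
∈-negAll⁺ (here refl) = here refl
∈-negAll⁺ (there G∈)  = there (∈-negAll⁺ G∈)

∈-negAll⁻ : ∀ {X} Gs → X ∈ negAll Gs → ∃[ G ] (G ∈ Gs × X ≡ -ᴳ G)
∈-negAll⁻ (G ∷ Gs) (here refl) = G , here refl , refl
∈-negAll⁻ (G ∷ Gs) (there X∈) with ∈-negAll⁻ Gs X∈
... | K , K∈ , e = K , there K∈ , e

left-+⁺ˡ : ∀ G H {L} → L ∈ left G → L +ᴳ H ∈ left (G +ᴳ H)
left-+⁺ˡ ⟨ _ ∣ _ ⟩ ⟨ _ ∣ _ ⟩ L∈ = ∈-++⁺ˡ (∈-addˡ⁺ L∈)

left-+⁺ʳ : ∀ G H {L} → L ∈ left H → G +ᴳ L ∈ left (G +ᴳ H)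
left-+⁺ʳ ⟨ L ∣ _ ⟩ H@(⟨ _ ∣ _ ⟩) L∈ = ∈-++⁺ʳ (addˡ L H) (∈-addʳ⁺ L∈)

right-+⁺ˡ : ∀ G H {R} → R ∈ right G → R +ᴳ H ∈ right (G +ᴳ H)
right-+⁺ˡ ⟨ _ ∣ _ ⟩ ⟨ _ ∣ _ ⟩ R∈ = ∈-++⁺ˡ (∈-addˡ⁺ R∈)

right-+⁺ʳ : ∀ G H {R} → R ∈ right H → G +ᴳ R ∈ right (G +ᴳ H)
right-+⁺ʳ ⟨ _ ∣ R ⟩ H@(⟨ _ ∣ _ ⟩) R∈ = ∈-++⁺ʳ (addˡ R H) (∈-addʳ⁺ R∈)

left-+-cases : ∀ G H {X} → X ∈ left (G +ᴳ H) →
               (∃[ L ] (L ∈ left G × X ≡ L +ᴳ H)) ⊎ (∃[ L ] (L ∈ left H × X ≡ G +ᴳ L))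
left-+-cases ⟨ L ∣ _ ⟩ H@(⟨ L′ ∣ _ ⟩) X∈ with ∈-++⁻ (addˡ L H) X∈
... | inj₁ X∈ = inj₁ (∈-addˡ⁻ L X∈)
... | inj₂ X∈ = inj₂ (∈-addʳ⁻ L′ X∈)

left-+⁻ : ∀ {P : Game → Set} G H → (∀ {L} → L ∈ left G → P (L +ᴳ H)) → (∀ {L} → L ∈ left H → P (G +ᴳ L)) →
          ∀ {X} → X ∈ left (G +ᴳ H) → P X
left-+⁻ G H f g X∈ with left-+-cases G H X∈
... | inj₁ (_ , L∈ , refl) = f L∈
... | inj₂ (_ , L∈ , refl) = g L∈

right-+⁻ : ∀ {P : Game → Set} G H → (∀ {R} → R ∈ right G → P (R +ᴳ H)) → (∀ {R} → R ∈ right H → P (G +ᴳ R)) →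
           ∀ {X} → X ∈ right (G +ᴳ H) → P X
right-+⁻ ⟨ _ ∣ R ⟩ H@(⟨ _ ∣ R′ ⟩) f g X∈ with ∈-++⁻ (addˡ R H) X∈
... | inj₁ X∈ with _ , K∈ , refl ← ∈-addˡ⁻ R X∈  = f K∈
... | inj₂ X∈ with _ , K∈ , refl ← ∈-addʳ⁻ R′ X∈ = g K∈

left-neg⁺ : ∀ G {R} → R ∈ right G → -ᴳ R ∈ left (-ᴳ G)
left-neg⁺ ⟨ _ ∣ _ ⟩ = ∈-negAll⁺

right-neg⁺ : ∀ G {L} → L ∈ left G → -ᴳ L ∈ right (-ᴳ G)
right-neg⁺ ⟨ _ ∣ _ ⟩ = ∈-negAll⁺

left-neg⁻ : ∀ {P : Game → Set} G → (∀ {R} → R ∈ right G → P (-ᴳ R)) → ∀ {X} → X ∈ left (-ᴳ G) → P X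
left-neg⁻ ⟨ _ ∣ R ⟩ f X∈ with _ , K∈ , refl ← ∈-negAll⁻ R X∈ = f K∈

right-neg⁻ : ∀ {P : Game → Set} G → (∀ {L} → L ∈ left G → P (-ᴳ L)) → ∀ {X} → X ∈ right (-ᴳ G) → P X
right-neg⁻ ⟨ L ∣ _ ⟩ f X∈ with _ , K∈ , refl ← ∈-negAll⁻ L X∈ = f K∈

neg-mono-≽ : ∀ {G H} → G ≽ H → -ᴳ H ≽ -ᴳ G
neg-mono-⊳ : ∀ {G H} → G ⊳ H → -ᴳ H ⊳ -ᴳ G
neg-mono-≽ {G} {H} (second f g) = second (right-neg⁻ H (λ L∈ → neg-mono-⊳ (g L∈))) (left-neg⁻ G (λ R∈ → neg-mono-⊳ (f R∈)))
neg-mono-⊳ {G} {H} (byLeft L∈ p)  = byRight (right-neg⁺ G L∈) (neg-mono-≽ p)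
neg-mono-⊳ {G} {H} (byRight R∈ p) = byLeft (left-neg⁺ H R∈) (neg-mono-≽ p)

≽⇒≥ᴳ : ∀ {G H} → G ≽ H → G ≥ᴳ H
⊳⇒LeftWinsFirst : ∀ {G H} → G ⊳ H → LeftWinsFirst (G -ᴳ H)
≽⇒≥ᴳ {G} {H} (second f g) = reply (All.tabulate (right-+⁻ G (-ᴳ H) (λ R∈ → ⊳⇒LeftWinsFirst (f R∈))
  (right-neg⁻ {P = λ X → LeftWinsFirst (G +ᴳ X)} H (λ L∈ → ⊳⇒LeftWinsFirst (g L∈)))))
⊳⇒LeftWinsFirst {G} {H} (byLeft L∈ p)  = move (Any.map (λ { refl → ≽⇒≥ᴳ p }) (left-+⁺ˡ G (-ᴳ H) L∈))
⊳⇒LeftWinsFirst {G} {H} (byRight R∈ p) = move (Any.map (λ { refl → ≽⇒≥ᴳ p }) (left-+⁺ʳ G (-ᴳ H) (left-neg⁺ H R∈)))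

-- The converse of `≽⇒≥ᴳ`. Options of G - H are again differences only after an analysis of the sum,
-- so the induction runs over both games and not over the winning derivation.
≥ᴳ⇔≽ : ∀ G H → (G ≥ᴳ H → G ≽ H) × (LeftWinsFirst (G -ᴳ H) → G ⊳ H)
≥ᴳ⇔≽ = game-induction _ λ G ihᴸ ihᴿ → game-induction _ λ H jhᴸ jhᴿ →
  (λ { (reply w) → second (λ R∈ → proj₂ (ihᴿ R∈ H) (All.lookup w (right-+⁺ˡ G (-ᴳ H) R∈)))
                          (λ L∈ → proj₂ (jhᴸ L∈) (All.lookup w (right-+⁺ʳ G (-ᴳ H) (right-neg⁺ H L∈)))) }) ,
  (λ { (move w) → case-move G H (λ L∈ → proj₁ (ihᴸ L∈ H)) (λ R∈ → proj₁ (jhᴿ R∈)) w })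
  where
  case-move : ∀ G H → (∀ {L} → L ∈ left G → L ≥ᴳ H → L ≽ H) → (∀ {R} → R ∈ right H → G ≥ᴳ R → G ≽ R) →
              Any LeftWinsSecond (left (G -ᴳ H)) → G ⊳ H
  case-move G H f g w = left-+⁻ {P = λ X → LeftWinsSecond X → G ⊳ H} G (-ᴳ H)
    (λ L∈ v → byLeft L∈ (f L∈ v))
    (left-neg⁻ {P = λ X → LeftWinsSecond (G +ᴳ X) → G ⊳ H} H (λ R∈ v → byRight R∈ (g R∈ v)))
    (proj₁ (proj₂ found)) (proj₂ (proj₂ found))
    where
    found : ∃[ X ] (X ∈ left (G -ᴳ H) × LeftWinsSecond X)
    found = find w

≥ᴳ⇒≽ : ∀ {G H} → G ≥ᴳ H → G ≽ H
≥ᴳ⇒≽ {G} {H} = proj₁ (≥ᴳ⇔≽ G H)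

≈⇒=ᴳ : ∀ {G H} → G ≈ H → G =ᴳ H
≈⇒=ᴳ (p , q) = ≽⇒≥ᴳ p , ≽⇒≥ᴳ q

=ᴳ⇒≈ : ∀ {G H} → G =ᴳ H → G ≈ H
=ᴳ⇒≈ (p , q) = ≥ᴳ⇒≽ p , ≥ᴳ⇒≽ q

-- Left follows the strategy for `G` and `H`, and copies a move in one `K` into the other: induction
-- on `K` outside, on the strategy inside.
+-monoˡ-≽ : ∀ K {G H} → G ≽ H → G +ᴳ K ≽ H +ᴳ K
+-monoˡ-≽ = game-induction _ λ K ihᴸ ihᴿ → mono≽ K ihᴸ ihᴿ
  where
  module _ K (ihᴸ : ∀ {L} → L ∈ left K → ∀ {G H} → G ≽ H → G +ᴳ L ≽ H +ᴳ L)
             (ihᴿ : ∀ {R} → R ∈ right K → ∀ {G H} → G ≽ H → G +ᴳ R ≽ H +ᴳ R) where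
    mono≽ : ∀ {G H} → G ≽ H → G +ᴳ K ≽ H +ᴳ K
    mono⊳ : ∀ {G H} → G ⊳ H → G +ᴳ K ⊳ H +ᴳ K
    mono≽ {G} {H} p@(second f g) = second
      (right-+⁻ G K (λ R∈ → mono⊳ (f R∈)) (λ R∈ → byRight (right-+⁺ʳ H K R∈) (ihᴿ R∈ p)))
      (left-+⁻ H K (λ L∈ → mono⊳ (g L∈)) (λ L∈ → byLeft (left-+⁺ʳ G K L∈) (ihᴸ L∈ p)))
    mono⊳ {G} {H} (byLeft L∈ p)  = byLeft (left-+⁺ˡ G K L∈) (mono≽ p)
    mono⊳ {G} {H} (byRight R∈ p) = byRight (right-+⁺ˡ H K R∈) (mono≽ p)

+-monoˡ-⊳ : ∀ K {G H} → G ⊳ H → G +ᴳ K ⊳ H +ᴳ K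
+-monoˡ-⊳ K {G} {H} (byLeft L∈ p)  = byLeft (left-+⁺ˡ G K L∈) (+-monoˡ-≽ K p)
+-monoˡ-⊳ K {G} {H} (byRight R∈ p) = byRight (right-+⁺ˡ H K R∈) (+-monoˡ-≽ K p)

+-comm-≽ : ∀ G H → G +ᴳ H ≽ H +ᴳ G
+-comm-≽ = game-induction _ λ G ihᴸ ihᴿ → game-induction _ λ H jhᴸ jhᴿ → second
  (right-+⁻ {P = _⊳ H +ᴳ G} G H (λ R∈ → byRight (right-+⁺ʳ H G R∈) (ihᴿ R∈ H)) (λ R∈ → byRight (right-+⁺ˡ H G R∈) (jhᴿ R∈)))
  (left-+⁻ {P = G +ᴳ H ⊳_} H G (λ L∈ → byLeft (left-+⁺ʳ G H L∈) (jhᴸ L∈)) (λ L∈ → byLeft (left-+⁺ˡ G H L∈) (ihᴸ L∈ H)))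

+-mono-≽ : ∀ {G G′ H H′} → G ≽ G′ → H ≽ H′ → G +ᴳ H ≽ G′ +ᴳ H′
+-mono-≽ {G} {G′} {H} {H′} p q = ≽-trans (+-monoˡ-≽ H p)
  (≽-trans (+-comm-≽ G′ H) (≽-trans (+-monoˡ-≽ G′ q) (+-comm-≽ H′ G′)))

+-monoʳ-⊳ : ∀ K {G H} → G ⊳ H → K +ᴳ G ⊳ K +ᴳ H
+-monoʳ-⊳ K {G} {H} p = ⊳-≽-trans (≽-⊳-trans (+-comm-≽ K G) (+-monoˡ-⊳ K p)) (+-comm-≽ H K)

-- The available moves in A + B - C do not depend on how its terms are arranged, so the strategy is
-- copied move by move. This and `+-≽⇒≽-sub` carry terms across an inequality.
+-≽⇒≽-neg : ∀ {A B C} → A +ᴳ B ≽ C → A -ᴳ C ≽ -ᴳ B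
+-⊳⇒⊳-neg : ∀ {A B C} → A +ᴳ B ⊳ C → A -ᴳ C ⊳ -ᴳ B
+-≽⇒≽-neg {A} {B} {C} (second f g) = second
  (right-+⁻ A (-ᴳ C) (λ R∈ → +-⊳⇒⊳-neg (f (right-+⁺ˡ A B R∈)))
    (right-neg⁻ {P = λ X → A +ᴳ X ⊳ -ᴳ B} C (λ L∈ → +-⊳⇒⊳-neg (g L∈))))
  (left-neg⁻ B (λ R∈ → +-⊳⇒⊳-neg (f (right-+⁺ʳ A B R∈))))
+-⊳⇒⊳-neg {A} {B} {C} (byLeft L∈ p) with left-+-cases A B L∈
... | inj₁ (_ , L∈ , refl) = byLeft (left-+⁺ˡ A (-ᴳ C) L∈) (+-≽⇒≽-neg p)
... | inj₂ (_ , L∈ , refl) = byRight (right-neg⁺ B L∈) (+-≽⇒≽-neg p)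
+-⊳⇒⊳-neg {A} {B} {C} (byRight R∈ p) = byLeft (left-+⁺ʳ A (-ᴳ C) (left-neg⁺ C R∈)) (+-≽⇒≽-neg p)

+-≽⇒≽-sub : ∀ {A B C} → A +ᴳ B ≽ C → B ≽ C -ᴳ A
+-⊳⇒⊳-sub : ∀ {A B C} → A +ᴳ B ⊳ C → B ⊳ C -ᴳ A
+-≽⇒≽-sub {A} {B} {C} (second f g) = second
  (λ R∈ → +-⊳⇒⊳-sub (f (right-+⁺ʳ A B R∈)))
  (left-+⁻ C (-ᴳ A) (λ L∈ → +-⊳⇒⊳-sub (g L∈))
    (left-neg⁻ {P = λ X → B ⊳ C +ᴳ X} A (λ R∈ → +-⊳⇒⊳-sub (f (right-+⁺ˡ A B R∈)))))
+-⊳⇒⊳-sub {A} {B} {C} (byLeft L∈ p) with left-+-cases A B L∈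
... | inj₁ (_ , L∈ , refl) = byRight (right-+⁺ʳ C (-ᴳ A) (right-neg⁺ A L∈)) (+-≽⇒≽-sub p)
... | inj₂ (_ , L∈ , refl) = byLeft L∈ (+-≽⇒≽-sub p)
+-⊳⇒⊳-sub {A} {B} {C} (byRight R∈ p) = byRight (right-+⁺ˡ C (-ᴳ A) R∈) (+-≽⇒≽-sub p)

-- Dyadic rationals as games

double : ℤ → ℤ
double j = j ℤ.+ j

remainder-unique : ∀ {r r′ q q′} → r ℕ.< 2 → r′ ℕ.< 2 →
  + r ℤ.+ q ℤ.* + 2 ≡ + r′ ℤ.+ q′ ℤ.* + 2 → r ≡ r′ × q ≡ q′
remainder-unique {0} {0} {q} {q′} _ _ e =
  refl , ℤ.*-cancelʳ-≡ q q′ (+ 2) (∙-cancelˡ (+ 0) _ _ e)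
remainder-unique {1} {1} {q} {q′} _ _ e =
  refl , ℤ.*-cancelʳ-≡ q q′ (+ 2) (∙-cancelˡ (+ 1) _ _ e)
remainder-unique {0} {1} {q} {q′} _ _ e = ⊥-elim (odd≢even q q′ e)
  where
  odd≢even : ∀ q q′ → + 0 ℤ.+ q ℤ.* + 2 ≢ + 1 ℤ.+ q′ ℤ.* + 2
  odd≢even q q′ e with ℤ.∣ q ℤ.- q′ ∣ | trans (sym (ℤ.abs-* (q ℤ.- q′) (+ 2))) (cong ℤ.∣_∣ (trans (lemma₁ q q′)
      (trans (cong (λ z → z ℤ.- q′ ℤ.* + 2) e) (lemma₂ q′))))
    where
    lemma₁ : ∀ q q′ → (q ℤ.- q′) ℤ.* + 2 ≡ + 0 ℤ.+ q ℤ.* + 2 ℤ.- q′ ℤ.* + 2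
    lemma₁ = solve-∀
    lemma₂ : ∀ q′ → + 1 ℤ.+ q′ ℤ.* + 2 ℤ.- q′ ℤ.* + 2 ≡ + 1
    lemma₂ = solve-∀
  ... | zero | ()
  ... | suc zero | ()
  ... | suc (suc _) | ()
remainder-unique {1} {0} {q} {q′} p p′ e with () ← proj₁ (remainder-unique {0} {1} {q′} {q} p′ p (sym e))
remainder-unique {suc (suc _)} (ℕ.s≤s (ℕ.s≤s ()))
remainder-unique {_} {suc (suc _)} _ (ℕ.s≤s (ℕ.s≤s ()))

divMod-unique : ∀ m r q → r ℕ.< 2 → m ≡ + r ℤ.+ q ℤ.* + 2 → m ℤ.%ℕ 2 ≡ r × m ℤ./ℕ 2 ≡ q
divMod-unique m r q r<2 e = remainder-unique (ℤ.n%ℕd<d m 2) r<2 (trans (sym (ℤ.a≡a%ℕn+[a/ℕn]*n m 2)) e)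

-- `dyadic` branches on a remainder that is stuck for a variable numerator; this equation and
-- `dyadic-odd` take the place of its unfolding.
dyadic-double : ∀ j k → dyadic (double j) (suc k) ≡ dyadic j k
dyadic-double j k with double j ℤ.%ℕ 2 | divMod-unique (double j) 0 j (ℕ.s≤s ℕ.z≤n) (lemma j)
  where
  lemma : ∀ j → j ℤ.+ j ≡ + 0 ℤ.+ j ℤ.* + 2
  lemma = solve-∀
... | zero | _ , e = cong (λ q → dyadic q k) e

dyadic-odd : ∀ j k → dyadic (ℤ.suc (double j)) (suc k) ≡ ⟨ dyadic j k ∷ [] ∣ dyadic (ℤ.suc j) k ∷ [] ⟩
dyadic-odd j k with ℤ.suc (double j) ℤ.%ℕ 2 | divMod-unique (ℤ.suc (double j)) 1 j (ℕ.s≤s (ℕ.s≤s ℕ.z≤n)) (lemma j)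
  where
  lemma : ∀ j → + 1 ℤ.+ (j ℤ.+ j) ≡ + 1 ℤ.+ j ℤ.* + 2
  lemma = solve-∀
... | suc _ | _ , e = cong (λ q → ⟨ dyadic q k ∷ [] ∣ dyadic (ℤ.suc q) k ∷ [] ⟩) e

data Parity : ℤ → Set where
  even : ∀ j → Parity (double j)
  odd  : ∀ j → Parity (ℤ.suc (double j))

parity : ∀ m → Parity m
parity m with m ℤ.%ℕ 2 | ℤ.n%ℕd<d m 2 | ℤ.a≡a%ℕn+[a/ℕn]*n m 2
... | 0 | _ | e = subst Parity (sym (trans e (lemma (m ℤ./ℕ 2)))) (even (m ℤ./ℕ 2))
  where
  lemma : ∀ q → + 0 ℤ.+ q ℤ.* + 2 ≡ q ℤ.+ q
  lemma = solve-∀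
... | 1 | _ | e = subst Parity (sym (trans e (lemma (m ℤ./ℕ 2)))) (odd (m ℤ./ℕ 2))
  where
  lemma : ∀ q → + 1 ℤ.+ q ℤ.* + 2 ≡ + 1 ℤ.+ (q ℤ.+ q)
  lemma = solve-∀
... | suc (suc _) | ℕ.s≤s (ℕ.s≤s ()) | _

suc-suc-double : ∀ j → ℤ.suc (ℤ.suc (double j)) ≡ double (ℤ.suc j)
suc-suc-double = lemma
  where
  lemma : ∀ j → + 1 ℤ.+ (+ 1 ℤ.+ (j ℤ.+ j)) ≡ (+ 1 ℤ.+ j) ℤ.+ (+ 1 ℤ.+ j)
  lemma = solve-∀

pred-double : ∀ j → ℤ.pred (double j) ≡ ℤ.suc (double (ℤ.pred j))
pred-double = lemma
  where
  lemma : ∀ j → -[1+ 0 ] ℤ.+ (j ℤ.+ j) ≡ + 1 ℤ.+ ((-[1+ 0 ] ℤ.+ j) ℤ.+ (-[1+ 0 ] ℤ.+ j))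
  lemma = solve-∀

-- The four facts depend on each other across levels, hence one induction on `k`. The bounds on
-- options keep a full grid step 1/2ᵏ in reserve, which the passage to the finer grid uses up.
record DyadicOrder (k : ℕ) : Set where
  field
    suc-⊳   : ∀ m → dyadic (ℤ.suc m) k ⊳ dyadic m k
    suc-≽   : ∀ m → dyadic (ℤ.suc m) k ≽ dyadic m k
    left-≼  : ∀ m {L} → L ∈ left (dyadic m k) → dyadic (ℤ.pred m) k ≽ L
    right-≽ : ∀ m {R} → R ∈ right (dyadic m k) → R ≽ dyadic (ℤ.suc m) k

  ≽-left : ∀ m {L} → L ∈ left (dyadic m k) → dyadic m k ≽ L
  ≽-left m L∈ = ≽-trans (subst (λ z → dyadic z k ≽ dyadic (ℤ.pred m) k) (ℤ.suc-pred m) (suc-≽ (ℤ.pred m))) (left-≼ m L∈)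

  right-≽′ : ∀ m {R} → R ∈ right (dyadic m k) → R ≽ dyadic m k
  right-≽′ m R∈ = ≽-trans (right-≽ m R∈) (suc-≽ m)

dyadicOrder : ∀ k → DyadicOrder k
dyadicOrder zero = record { suc-⊳ = s⊳ ; suc-≽ = s≽ ; left-≼ = l ; right-≽ = r }
  where
  s⊳ : ∀ m → integer (ℤ.suc m) ⊳ integer m
  s⊳ (+ n)          = ⊳-left (here refl)
  s⊳ -[1+ zero ]    = right-⊳ (here refl)
  s⊳ -[1+ suc n ]   = right-⊳ (here refl)
  s≽⁺ : ∀ n → integer (+ suc n) ≽ integer (+ n)
  s≽⁺ zero    = second (λ ()) (λ ())
  s≽⁺ (suc n) = second (λ ()) λ { (here refl) → byLeft (here refl) (s≽⁺ n) }
  s≽⁻ : ∀ n → integer -[1+ n ] ≽ integer -[1+ suc n ]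
  s≽⁻ zero    = second (λ { (here refl) → byRight (here refl) (second (λ ()) (λ ())) }) (λ ())
  s≽⁻ (suc n) = second (λ { (here refl) → byRight (here refl) (s≽⁻ n) }) (λ ())
  s≽ : ∀ m → integer (ℤ.suc m) ≽ integer m
  s≽ (+ n)        = s≽⁺ n
  s≽ -[1+ zero ]  = second (λ ()) (λ ())
  s≽ -[1+ suc n ] = s≽⁻ n
  l : ∀ m {L} → L ∈ left (integer m) → integer (ℤ.pred m) ≽ L
  l (+ suc n)        (here refl) = ≽-refl _
  l -[1+ zero ]      ()
  l -[1+ suc n ]     ()
  r : ∀ m {R} → R ∈ right (integer m) → R ≽ integer (ℤ.suc m)
  r (+ zero)     ()
  r (+ suc n)    ()
  r -[1+ zero ]  (here refl) = ≽-refl _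
  r -[1+ suc n ] (here refl) = ≽-refl _
dyadicOrder (suc k) = record { suc-⊳ = s⊳ ; suc-≽ = s≽ ; left-≼ = l ; right-≽ = r }
  where
  open DyadicOrder (dyadicOrder k)
  module _ (j : ℤ) where
    a b : Game
    a = dyadic j k
    b = dyadic (ℤ.suc j) k
    o : Game
    o = ⟨ a ∷ [] ∣ b ∷ [] ⟩
    o≽a : o ≽ a
    o≽a = second (λ { (here refl) → suc-⊳ j }) (λ L∈ → byLeft (here refl) (≽-left j L∈))
    b≽o : b ≽ o
    b≽o = second (λ R∈ → byRight (here refl) (right-≽′ (ℤ.suc j) R∈)) (λ { (here refl) → suc-⊳ j })
  s⊳ : ∀ m → dyadic (ℤ.suc m) (suc k) ⊳ dyadic m (suc k)
  s⊳ m with parity m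
  ... | even j rewrite dyadic-odd j k | dyadic-double j k = byLeft (here refl) (≽-refl (a j))
  ... | odd j rewrite suc-suc-double j | dyadic-odd j k | dyadic-double (ℤ.suc j) k = byRight (here refl) (≽-refl (b j))
  s≽ : ∀ m → dyadic (ℤ.suc m) (suc k) ≽ dyadic m (suc k)
  s≽ m with parity m
  ... | even j rewrite dyadic-odd j k | dyadic-double j k = o≽a j
  ... | odd j rewrite suc-suc-double j | dyadic-odd j k | dyadic-double (ℤ.suc j) k = b≽o j
  l : ∀ m {L} → L ∈ left (dyadic m (suc k)) → dyadic (ℤ.pred m) (suc k) ≽ L
  l m L∈ with parity m
  ... | even j rewrite pred-double j | dyadic-odd (ℤ.pred j) k | dyadic-double j k = ≽-trans (o≽a (ℤ.pred j)) (left-≼ j L∈)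
  l m L∈ | odd j rewrite dyadic-odd j k | ℤ.pred-suc (double j) | dyadic-double j k with here refl ← L∈ = ≽-refl _
  r : ∀ m {R} → R ∈ right (dyadic m (suc k)) → R ≽ dyadic (ℤ.suc m) (suc k)
  r m R∈ with parity m
  ... | even j rewrite dyadic-odd j k | dyadic-double j k = ≽-trans (right-≽ j R∈) (b≽o j)
  r m R∈ | odd j rewrite suc-suc-double j | dyadic-odd j k | dyadic-double (ℤ.suc j) k with here refl ← R∈ = ≽-refl _

module _ (k : ℕ) where
  open DyadicOrder (dyadicOrder k) public

dyadic-mono-≽ : ∀ k {m n} → n ℤ.≤ m → dyadic m k ≽ dyadic n k
dyadic-mono-≽ k {m} {n} n≤m with m ℤ.- n | ℤ.i≤j⇒0≤j-i n≤m | lemma m n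
  where
  lemma : ∀ m n → m ≡ (m ℤ.- n) ℤ.+ n
  lemma = solve-∀
... | + d | _ | refl = climb d
  where
  climb : ∀ d → dyadic (+ d ℤ.+ n) k ≽ dyadic n k
  climb zero    rewrite ℤ.+-identityˡ n = ≽-refl _
  climb (suc d) rewrite ℤ.suc-+ d n = ≽-trans (suc-≽ k (+ d ℤ.+ n)) (climb d)

dyadic-mono-⊳ : ∀ k {m n} → n ℤ.< m → dyadic m k ⊳ dyadic n k
dyadic-mono-⊳ k {m} {n} n<m = ≽-⊳-trans (dyadic-mono-≽ k (ℤ.i<j⇒suc[i]≤j n<m)) (suc-⊳ k n)

dyadic-cancel-≽ : ∀ k {m n} → dyadic m k ≽ dyadic n k → n ℤ.≤ m
dyadic-cancel-≽ k p = ℤ.≮⇒≥ (λ m<n → ≽⇒⋪ p (dyadic-mono-⊳ k m<n))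

dyadic-cancel-⊳ : ∀ k {m n} → dyadic m k ⊳ dyadic n k → n ℤ.< m
dyadic-cancel-⊳ k p = ℤ.≰⇒> (λ m≤n → ≽⇒⋪ (dyadic-mono-≽ k m≤n) p)

infixl 8 _·2^_

_·2^_ : ℤ → ℕ → ℤ
m ·2^ zero  = m
m ·2^ suc i = double (m ·2^ i)

dyadic-lift : ∀ i m k → dyadic (m ·2^ i) (i ℕ.+ k) ≡ dyadic m k
dyadic-lift zero    m k = refl
dyadic-lift (suc i) m k = trans (dyadic-double (m ·2^ i) (i ℕ.+ k)) (dyadic-lift i m k)

IsDyadic : Game → Set
IsDyadic S = ∃₂ λ m k → S ≡ dyadic m k

common-level : ∀ {S T} → IsDyadic S → IsDyadic T → ∃[ k ] ∃₂ λ m n → S ≡ dyadic m k × T ≡ dyadic n k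
common-level (m , k , refl) (n , l , refl) = l ℕ.+ k , m ·2^ l , n ·2^ k ,
  sym (dyadic-lift l m k) , trans (sym (dyadic-lift k n l)) (cong (dyadic (n ·2^ k)) (ℕ.+-comm k l))

dyadic-⊳⇒≽ : ∀ {S T} → IsDyadic S → IsDyadic T → S ⊳ T → S ≽ T
dyadic-⊳⇒≽ s t p with k , m , n , refl , refl ← common-level s t = dyadic-mono-≽ k (ℤ.<⇒≤ (dyadic-cancel-⊳ k p))

dyadic-dense : ∀ {S T} → IsDyadic S → IsDyadic T → S ⊳ T → ∃[ U ] (IsDyadic U × S ⊳ U × U ⊳ T)
dyadic-dense s t p with k , m , n , refl , refl ← common-level s t =
  dyadic mid (suc k) , (mid , suc k , refl) ,
  ≽-⊳-trans (dyadic-mono-≽ k (ℤ.i<j⇒suc[i]≤j (dyadic-cancel-⊳ k p)))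
    (subst (dyadic (ℤ.suc n) k ⊳_) (sym (dyadic-odd n k)) (right-⊳ (here refl))) ,
  subst (_⊳ dyadic n k) (sym (dyadic-odd n k)) (⊳-left (here refl))
  where
  mid : ℤ
  -- The midpoint of n/2ᵏ and (n+1)/2ᵏ, one level finer.
  mid = ℤ.suc (double n)

0ᴳ-identityʳ-≽ : ∀ G → G +ᴳ 0ᴳ ≽ G
0ᴳ-identityʳ-≽ = game-induction _ λ G ihᴸ ihᴿ → second
  (right-+⁻ {P = _⊳ G} G 0ᴳ (λ R∈ → byRight R∈ (ihᴿ R∈)) (λ ()))
  (λ L∈ → byLeft (left-+⁺ˡ G 0ᴳ L∈) (ihᴸ L∈))

ε : ℕ → Game
ε = dyadic (+ 1)

dyadic-0 : ∀ k → dyadic (+ 0) k ≡ 0ᴳ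
dyadic-0 zero    = refl
dyadic-0 (suc k) = trans (dyadic-double (+ 0) k) (dyadic-0 k)

0∈left-ε : ∀ k → 0ᴳ ∈ left (ε k)
0∈left-ε zero    = here refl
0∈left-ε (suc k) = here (sym (dyadic-0 k))

ε-right-≽ : ∀ k {R} → R ∈ right (ε k) → R ≽ ε k
ε-right-≽ k = right-≽′ k (+ 1)

ε≽0 : ∀ k → ε k ≽ 0ᴳ
ε≽0 k = subst (ε k ≽_) (dyadic-0 k) (suc-≽ k (+ 0))

ε-suc-⊳ : ∀ k → ε k ⊳ ε (suc k)
ε-suc-⊳ k = right-⊳ (here refl)

+-ε-≽ : ∀ {G} k → G +ᴳ ε k ≽ G
+-ε-≽ {G} k = ≽-trans (+-mono-≽ (≽-refl G) (ε≽0 k)) (0ᴳ-identityʳ-≽ G)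

+-ε-⊳ : ∀ {G H} k → G ≽ H → G +ᴳ ε k ⊳ H
+-ε-⊳ {G} k p = byLeft (left-+⁺ʳ G (ε k) (0∈left-ε k)) (≽-trans (0ᴳ-identityʳ-≽ G) p)

-- Addition of a single grid step is the form of dyadic addition on which the comparisons up to
-- infinitesimals rest. When Right replaces 1/2ᵏ⁺¹ by 1/2ᵏ, the claim at the coarser level answers.
dyadic-+-ε : ∀ k m → dyadic m k +ᴳ ε k ≽ dyadic (ℤ.suc m) k
dyadic-+-ε zero m = second
  (right-+⁻ {P = _⊳ integer (ℤ.suc m)} (integer m) (ε 0)
    (λ R∈ → +-ε-⊳ 0 (right-≽ 0 m R∈)) (λ ()))
  (λ L∈ → +-ε-⊳ 0 (subst (λ z → integer z ≽ _) (ℤ.pred-suc m) (left-≼ 0 (ℤ.suc m) L∈)))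
dyadic-+-ε (suc k) m with parity m
... | even j rewrite dyadic-odd j k | dyadic-double j k = second
  (right-+⁻ {P = _⊳ O} (dyadic j k) (ε (suc k))
    (λ R∈ → +-ε-⊳ (suc k) (≽-trans (right-≽ k j R∈) (subst (dyadic (ℤ.suc j) k ≽_) (dyadic-odd j k)
      (subst (_≽ dyadic (ℤ.suc (double j)) (suc k)) (dyadic-double (ℤ.suc j) k)
        (subst (λ z → dyadic z (suc k) ≽ dyadic (ℤ.suc (double j)) (suc k)) (suc-suc-double j) (suc-≽ (suc k) (ℤ.suc (double j))))))))
    ε-move)
  (λ { (here refl) → +-ε-⊳ (suc k) (≽-refl _) })
  where
  O = ⟨ dyadic j k ∷ [] ∣ dyadic (ℤ.suc j) k ∷ [] ⟩
  ε-move : ∀ {R} → R ∈ right (ε (suc k)) → dyadic j k +ᴳ R ⊳ O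
  ε-move (here refl) = byRight (here refl) (dyadic-+-ε k j)
... | odd j rewrite suc-suc-double j | dyadic-odd j k | dyadic-double (ℤ.suc j) k = second
  (right-+⁻ {P = _⊳ dyadic (ℤ.suc j) k} O (ε (suc k))
    (λ { (here refl) → +-ε-⊳ (suc k) (≽-refl _) })
    ε-move)
  (λ L∈ → byLeft (left-+⁺ˡ O (ε (suc k)) (here refl))
    (≽-trans (+-ε-≽ (suc k)) (subst (λ z → dyadic z k ≽ _) (ℤ.pred-suc j) (left-≼ k (ℤ.suc j) L∈))))
  where
  O = ⟨ dyadic j k ∷ [] ∣ dyadic (ℤ.suc j) k ∷ [] ⟩
  ε-move : ∀ {R} → R ∈ right (ε (suc k)) → O +ᴳ R ⊳ dyadic (ℤ.suc j) k
  ε-move (here refl) =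
    byLeft (left-+⁺ˡ O (ε k) (here refl)) (dyadic-+-ε k j)

-- Infinitesimal closeness, reduced canonical forms and the simplest number

infix 4 _⊵_ _⊴_

-- For a dyadic T, G ⊵ T and G ⊴ T are the inequalities up to infinitesimals.
_⊵_ _⊴_ : Game → Game → Set
G ⊵ T = ∀ {U} → IsDyadic U → T ⊳ U → G ≽ U
G ⊴ T = ∀ {U} → IsDyadic U → U ⊳ T → U ≽ G

≽⇒⊵ : ∀ {G T} → IsDyadic T → G ≽ T → G ⊵ T
≽⇒⊵ t p u q = ≽-trans p (dyadic-⊳⇒≽ t u q)

isDyadic-1 : IsDyadic 1ᴳ
isDyadic-1 = + 1 , 0 , refl

isDyadic-0 : IsDyadic 0ᴳ
isDyadic-0 = + 0 , 0 , refl

isDyadic-ε : ∀ j → IsDyadic (ε j)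
isDyadic-ε j = + 1 , j , refl

ε⊳0 : ∀ j → ε j ⊳ 0ᴳ
ε⊳0 j = ⊳-left (0∈left-ε j)

pos⇒≽ε : ∀ k m → dyadic m k ⊳ 0ᴳ → dyadic m k ≽ ε k
pos⇒≽ε k m p = dyadic-mono-≽ k (ℤ.i<j⇒suc[i]≤j (dyadic-cancel-⊳ k (subst (dyadic m k ⊳_) (sym (dyadic-0 k)) p)))

-- On a grid that contains both `T` and `ε j`, the game `G` is at least `T` less one grid step, and
-- `ε j` makes up for that step.
⊵⇒+ε≽ : ∀ {G T} → IsDyadic T → G ⊵ T → ∀ j → G +ᴳ ε j ≽ T
⊵⇒+ε≽ {G} t p j with common-level t (isDyadic-ε j)
... | k , n , e , refl , e≡ = ≽-trans (+-mono-≽ (p (ℤ.pred n , k , refl) pred-⊳) small)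
    (subst (λ z → dyadic (ℤ.pred n) k +ᴳ ε k ≽ dyadic z k) (ℤ.suc-pred n) (dyadic-+-ε k (ℤ.pred n)))
  where
  pred-⊳ : dyadic n k ⊳ dyadic (ℤ.pred n) k
  pred-⊳ = subst (λ z → dyadic z k ⊳ dyadic (ℤ.pred n) k) (ℤ.suc-pred n) (suc-⊳ k (ℤ.pred n))
  small : ε j ≽ ε k
  small = subst (_≽ ε k) (sym e≡) (pos⇒≽ε k e (subst (_⊳ 0ᴳ) e≡ (ε⊳0 j)))

⊴⇒+ε≽ : ∀ {G T} → IsDyadic T → G ⊴ T → ∀ j → T +ᴳ ε j ≽ G
⊴⇒+ε≽ {G} t p j with common-level t (isDyadic-ε j)
... | k , n , e , refl , e≡ = ≽-trans (+-mono-≽ (≽-refl (dyadic n k)) small)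
    (≽-trans (dyadic-+-ε k n) (p (ℤ.suc n , k , refl) (suc-⊳ k n)))
  where
  small : ε j ≽ ε k
  small = subst (_≽ ε k) (sym e≡) (pos⇒≽ε k e (subst (_⊳ 0ᴳ) e≡ (ε⊳0 j)))

dyadic⇒number : ∀ m k → dyadic m k Equals m /2^ k
dyadic⇒number m k = dyadic m k , (m , k , refl , refl) , ≈⇒=ᴳ (≈-refl _)

isDyadic⇒IsNumber : ∀ {S} → IsDyadic S → IsNumber S
isDyadic⇒IsNumber (m , k , refl) = m /2^ k , dyadic⇒number m k

-- For ε < x both inequalities -x < G - K < x follow from K ≤ G + ε and G ≤ K + ε.
+ε-≽⇒=ᴵ : ∀ {G K} → (∀ j → G +ᴳ ε j ≽ K) → (∀ j → K +ᴳ ε j ≽ G) → G =ᴵ K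
+ε-≽⇒=ᴵ {G} {K} lower upper X (x , S , (m , k , _ , refl) , X=S) (X≥0 , 0≱X) =
  (≽⇒≥ᴳ (≽-trans below (neg-mono-≽ (proj₁ X-big))) ,
    λ -X≥ → ≽⇒⋪ (≽-trans (≥ᴳ⇒≽ -X≥) below) (neg-mono-⊳ (proj₂ X-big))) ,
  (≽⇒≥ᴳ (≽-trans (proj₁ X-big) above) ,
    λ ≥X → ≽⇒⋪ (≽-trans above (≥ᴳ⇒≽ ≥X)) (proj₂ X-big))
  where
  below : G -ᴳ K ≽ -ᴳ ε (suc k)
  below = +-≽⇒≽-neg (lower (suc k))
  above : ε (suc k) ≽ G -ᴳ K
  above = +-≽⇒≽-sub (upper (suc k))
  S⊳0 : dyadic m k ⊳ 0ᴳ
  S⊳0 with ≽⊎⊲ 0ᴳ X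
  ... | inj₁ 0≽X = ⊥-elim (0≱X (≽⇒≥ᴳ 0≽X))
  ... | inj₂ X⊳0 = ≽-⊳-trans (proj₂ (=ᴳ⇒≈ X=S)) X⊳0
  X≽ε : X ≽ ε k
  X≽ε = ≽-trans (proj₁ (=ᴳ⇒≈ X=S)) (pos⇒≽ε k m S⊳0)
  X-big : X ≽ ε (suc k) × X ⊳ ε (suc k)
  X-big = ≽-trans X≽ε (dyadic-⊳⇒≽ (isDyadic-ε k) (isDyadic-ε (suc k)) (ε-suc-⊳ k)) , ≽-⊳-trans X≽ε (ε-suc-⊳ k)

switch : Game → Game
switch T = ⟨ 1ᴳ ∷ [] ∣ T ∷ [] ⟩

-- Replace `M` by a dyadic `y` just below 1 and still at least `T`. Left answers every move of Right
-- in y + ε j by turning the switch into `T`; against the option 1 of the switch, y + ε j is large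
-- enough.
+ε≽switch : ∀ {M T} → IsDyadic T → 1ᴳ ⊳ T → M ⊵ 1ᴳ → ∀ j → M +ᴳ ε j ≽ switch T
-- The grid is chosen for 1/2ʲ⁺¹ instead of 1/2ʲ, so that the step 1/2ᵏ from `y` up to 1 is strictly
-- smaller than `ε j`.
+ε≽switch {M} {T} t 1⊳T M⊵1 j with common-level t (isDyadic-ε (suc j))
... | k , n , e , refl , e≡ = ≽-trans (+-monoˡ-≽ (ε j) (M⊵1 (ℤ.pred u , k , refl) 1⊳y)) (second
    (right-+⁻ {P = _⊳ switch T} y (ε j)
      (λ R∈ → byRight (here refl) (≽-trans (+-ε-≽ j) (≽-trans (right-≽′ k (ℤ.pred u) R∈) y≽T)))
      (λ R∈ → byRight (here refl) (≽-trans (+-mono-≽ y≽T (≽-trans (ε-right-≽ j R∈) (ε≽0 j))) (0ᴳ-identityʳ-≽ T))))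
    λ { (here refl) → y+ε⊳1 })
  where
  u : ℤ
  u = (+ 1) ·2^ k
  1≡u : 1ᴳ ≡ dyadic u k
  1≡u = trans (sym (dyadic-lift k (+ 1) 0)) (cong (dyadic u) (ℕ.+-identityʳ k))
  y : Game
  y = dyadic (ℤ.pred u) k
  y≽T : y ≽ T
  y≽T = dyadic-mono-≽ k (ℤ.i<j⇒i≤pred[j] (dyadic-cancel-⊳ k (subst (_⊳ T) 1≡u 1⊳T)))
  1⊳y : 1ᴳ ⊳ y
  1⊳y = subst (_⊳ y) (sym (trans 1≡u (cong (λ z → dyadic z k) (sym (ℤ.suc-pred u))))) (suc-⊳ k (ℤ.pred u))
  small : ε j ⊳ ε k
  small = ⊳-≽-trans (ε-suc-⊳ j) (subst (_≽ ε k) (sym e≡) (pos⇒≽ε k e (subst (_⊳ 0ᴳ) e≡ (ε⊳0 (suc j)))))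
  y+ε⊳1 : y +ᴳ ε j ⊳ 1ᴳ
  y+ε⊳1 = ⊳-≽-trans (+-monoʳ-⊳ y small) (subst (y +ᴳ ε k ≽_) (sym 1≡u)
    (subst (λ z → y +ᴳ ε k ≽ dyadic z k) (ℤ.suc-pred u) (dyadic-+-ε k (ℤ.pred u))))

-- What Left and Right need in order to play `G` against {1 | T} with an ε in hand. `lower` and
-- `upper` answer moves in the ε; a Right option of `G` is answered either by a reply inside it that
-- restores about 1, or by moving the switch to `T`.
record NearSwitch (G T : Game) : Set where
  field
    lower   : G ⊵ T
    upper   : G ⊴ 1ᴳ
    rights  : ∀ {R} → R ∈ right G → (∃[ M ] (M ∈ left R × M ⊵ 1ᴳ)) ⊎ R ⊵ T
    lefts   : ∀ {L} → L ∈ left G → L ⊴ 1ᴳ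
    toOne   : ∃[ L ] (L ∈ left G × L ⊵ 1ᴳ)
    toRight : ∃[ R ] (R ∈ right G × T ≽ R)

nearSwitch⇒=ᴵ : ∀ {G T} → IsDyadic T → 1ᴳ ⊳ T → NearSwitch G T → G =ᴵ switch T
nearSwitch⇒=ᴵ {G} {T} t 1⊳T near = +ε-≽⇒=ᴵ
  (λ j → second
    (right-+⁻ {P = _⊳ switch T} G (ε j) (reply-right j)
      (λ R∈ → byRight (here refl) (≽-trans (+-mono-≽ (≽-refl G) (ε-right-≽ j R∈)) (⊵⇒+ε≽ t lower j))))
    λ { (here refl) → byLeft (left-+⁺ˡ G (ε j) (proj₁ (proj₂ toOne))) (⊵⇒+ε≽ isDyadic-1 (proj₂ (proj₂ toOne)) j) })
  (λ j → second
    (right-+⁻ {P = _⊳ G} (switch T) (ε j)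
      (λ { (here refl) → byRight (proj₁ (proj₂ toRight)) (≽-trans (+-ε-≽ j) (proj₂ (proj₂ toRight))) })
      (λ R∈ → byLeft (left-+⁺ˡ (switch T) _ (here refl)) (≽-trans (+-mono-≽ (≽-refl 1ᴳ) (ε-right-≽ j R∈)) (⊴⇒+ε≽ isDyadic-1 upper j))))
    λ L∈ → byLeft (left-+⁺ˡ (switch T) (ε j) (here refl)) (⊴⇒+ε≽ isDyadic-1 (lefts L∈) j))
  where
  open NearSwitch near
  reply-right : ∀ j {R} → R ∈ right G → R +ᴳ ε j ⊳ switch T
  reply-right j {R} R∈ with rights R∈
  ... | inj₁ (M , M∈ , M⊵1) = byLeft (left-+⁺ˡ R (ε j) M∈) (+ε≽switch t 1⊳T M⊵1 j)
  ... | inj₂ R⊵T            = byRight (here refl) (⊵⇒+ε≽ t R⊵T j)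

-- Canonical forms of dyadics and reduced forms of switches

left-dyadic : ∀ k m {L} → L ∈ left (dyadic m k) → IsDyadic L
left-dyadic zero (+ suc n) (here refl) = + n , 0 , refl
left-dyadic zero -[1+ zero ] ()
left-dyadic zero -[1+ suc n ] ()
left-dyadic (suc k) m L∈ with parity m
... | even j rewrite dyadic-double j k = left-dyadic k j L∈
left-dyadic (suc k) m L∈ | odd j rewrite dyadic-odd j k with here refl ← L∈ = j , k , refl

right-dyadic : ∀ k m {R} → R ∈ right (dyadic m k) → IsDyadic R
right-dyadic zero (+ zero) ()
right-dyadic zero (+ suc n) ()
right-dyadic zero -[1+ zero ] (here refl) = + 0 , 0 , refl
right-dyadic zero -[1+ suc n ] (here refl) = -[1+ n ] , 0 , refl
right-dyadic (suc k) m R∈ with parity m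
... | even j rewrite dyadic-double j k = right-dyadic k j R∈
right-dyadic (suc k) m R∈ | odd j rewrite dyadic-odd j k with here refl ← R∈ = ℤ.suc j , k , refl

⊑-dyadic : ∀ {H S} → IsDyadic S → H ⊑ S → IsDyadic H
⊑-dyadic s self = s
⊑-dyadic (m , k , refl) (via-left L∈ H⊑)  = ⊑-dyadic (left-dyadic k m L∈) H⊑
⊑-dyadic (m , k , refl) (via-right R∈ H⊑) = ⊑-dyadic (right-dyadic k m R∈) H⊑

left-dyadic-unique : ∀ k m {X Y} → X ∈ left (dyadic m k) → Y ∈ left (dyadic m k) → X ≡ Y
left-dyadic-unique zero (+ suc n) (here refl) (here refl) = refl
left-dyadic-unique zero -[1+ zero ] ()
left-dyadic-unique zero -[1+ suc n ] ()
left-dyadic-unique (suc k) m X∈ Y∈ with parity m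
... | even j rewrite dyadic-double j k = left-dyadic-unique k j X∈ Y∈
left-dyadic-unique (suc k) m X∈ Y∈ | odd j rewrite dyadic-odd j k with here refl ← X∈ | here refl ← Y∈ = refl

right-dyadic-unique : ∀ k m {X Y} → X ∈ right (dyadic m k) → Y ∈ right (dyadic m k) → X ≡ Y
right-dyadic-unique zero (+ zero) ()
right-dyadic-unique zero (+ suc n) ()
right-dyadic-unique zero -[1+ zero ] (here refl) (here refl) = refl
right-dyadic-unique zero -[1+ suc n ] (here refl) (here refl) = refl
right-dyadic-unique (suc k) m X∈ Y∈ with parity m
... | even j rewrite dyadic-double j k = right-dyadic-unique k j X∈ Y∈
right-dyadic-unique (suc k) m X∈ Y∈ | odd j rewrite dyadic-odd j k with here refl ← X∈ | here refl ← Y∈ = refl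

-- If there is anything to prove, the number is {j/2ᵏ | (j+1)/2ᵏ}, and a Right option of j/2ᵏ is at
-- least (j+1)/2ᵏ. So no Left option is reversible.
right-left-⊳ : ∀ k m {L R} → L ∈ left (dyadic m k) → R ∈ right L → R ⊳ dyadic m k
right-left-⊳ zero (+ suc zero) (here refl) ()
right-left-⊳ zero (+ suc (suc n)) (here refl) ()
right-left-⊳ zero -[1+ zero ] ()
right-left-⊳ zero -[1+ suc n ] ()
right-left-⊳ (suc k) m L∈ R∈ with parity m
... | even j rewrite dyadic-double j k = right-left-⊳ k j L∈ R∈
right-left-⊳ (suc k) m L∈ R∈ | odd j rewrite dyadic-odd j k with here refl ← L∈ = byRight (here refl) (right-≽ k j R∈)

left-right-⊲ : ∀ k m {R L} → R ∈ right (dyadic m k) → L ∈ left R → dyadic m k ⊳ L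
left-right-⊲ zero (+ zero) ()
left-right-⊲ zero (+ suc n) ()
left-right-⊲ zero -[1+ zero ] (here refl) ()
left-right-⊲ zero -[1+ suc zero ] (here refl) ()
left-right-⊲ zero -[1+ suc (suc n) ] (here refl) ()
left-right-⊲ (suc k) m R∈ L∈ with parity m
... | even j rewrite dyadic-double j k = left-right-⊲ k j R∈ L∈
left-right-⊲ (suc k) m R∈ L∈ | odd j rewrite dyadic-odd j k with here refl ← R∈ =
  byLeft (here refl) (subst (λ z → dyadic z k ≽ _) (ℤ.pred-suc j) (left-≼ k (ℤ.suc j) L∈))

canonical-dyadic : ∀ {S} → IsDyadic S → Canonical S
canonical-dyadic s {H} H⊑S with ⊑-dyadic s H⊑S
... | m , k , refl =
  (λ { (inj₁ (_ , _ , X∈ , Y∈ , X≢Y , _)) → X≢Y (left-dyadic-unique k m X∈ Y∈)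
     ; (inj₂ (_ , _ , X∈ , Y∈ , X≢Y , _)) → X≢Y (right-dyadic-unique k m X∈ Y∈) }) ,
  (λ { (inj₁ (_ , _ , L∈ , R∈ , p)) → ≽⇒⋪ (≥ᴳ⇒≽ p) (right-left-⊳ k m L∈ R∈)
     ; (inj₂ (_ , _ , R∈ , L∈ , p)) → ≽⇒⋪ (≥ᴳ⇒≽ p) (left-right-⊲ k m R∈ L∈) })

switch-¬number : ∀ {T} → IsDyadic T → 1ᴳ ⊳ T → ¬ IsNumber (switch T)
switch-¬number t 1⊳T (_ , S , (m , k , _ , refl) , K=S) with =ᴳ⇒≈ K=S
... | second f _ , second _ g = ≽⇒⋪
  (≽-trans (dyadic-⊳⇒≽ t (m , k , refl) (f (here refl))) (dyadic-⊳⇒≽ (m , k , refl) isDyadic-1 (g (here refl)))) 1⊳T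

-- Each Right option `T` of a switch below is at most 3/4 = q(1). Its distance from 1 is thus at
-- least 1/4, and 1/4 serves as the positive number that refutes reversibility.
¼ ¾ : Game
¼ = dyadic (+ 1) 2
¾ = dyadic (+ 3) 2

-¼≽¾-1 : -ᴳ ¼ ≽ ¾ -ᴳ 1ᴳ
-¼≽¾-1 = from-inj₁ (≽⊎⊲ (-ᴳ ¼) (¾ -ᴳ 1ᴳ))

reduced-dyadic : ∀ {S} → IsDyadic S → Reduced S
reduced-dyadic s H⊑S = inj₁ (isDyadic⇒IsNumber (⊑-dyadic s H⊑S) , canonical-dyadic (⊑-dyadic s H⊑S))

reduced-switch : ∀ {T x} → T Denotes x → x ℚ.< 1ℚ → ¾ ≽ T → Reduced (switch T)
reduced-switch {T} {x} (m , k , refl , refl) x<1 ¾≽T = go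
  where
  t : IsDyadic T
  t = m , k , refl
  1⊳T : 1ᴳ ⊳ T
  1⊳T = ⊳-≽-trans (from-inj₂ (≽⊎⊲ ¾ 1ᴳ)) ¾≽T
  hot : Hot (switch T)
  hot = 1ℚ , x ,
    max (switch-¬number t 1⊳T) (here (number (dyadic⇒number (+ 1) 0)))
      ((1ℚ , number (dyadic⇒number (+ 1) 0) , ℚ.≤-refl) ∷ []) ,
    min (switch-¬number t 1⊳T) (here (number (dyadic⇒number m k)))
      ((x , number (dyadic⇒number m k) , ℚ.≤-refl) ∷ []) ,
    x<1
  irreversible : ∀ {L} → L ∈ left T → ¬ (L ≥ᴵ switch T)
  irreversible {L} L∈ p with ≥ᴳ⇒≽ (p ¼ (isDyadic⇒IsNumber (+ 1 , 2 , refl))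
    (≽⇒≥ᴳ (dyadic-⊳⇒≽ (isDyadic-ε 2) isDyadic-0 (ε⊳0 2)) , λ q → ≽⇒⋪ (≥ᴳ⇒≽ q) (ε⊳0 2)))
  -- Right moves the subtracted switch to -1, which leaves L - 1 ≤ 3/4 - 1 ≤ -1/4.
  ... | second f _ = ≽⇒⋪ (≽-trans -¼≽¾-1 (+-monoˡ-≽ (-ᴳ 1ᴳ) (≽-trans ¾≽T (≽-left k m L∈))))
    (f (right-+⁺ʳ L (-ᴳ switch T) (right-neg⁺ (switch T) (here refl))))
  go : Reduced (switch T)
  go self = inj₂ (hot ,
    (λ { (inj₁ (_ , _ , here refl , here refl , ≢ , _)) → ≢ refl
       ; (inj₂ (_ , _ , here refl , here refl , ≢ , _)) → ≢ refl }) ,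
    (λ { (inj₁ (_ , _ , here refl , () , _))
       ; (inj₂ (_ , _ , here refl , L∈ , p)) → irreversible L∈ p }))
  go (via-left (here refl) H⊑)  = reduced-dyadic isDyadic-1 H⊑
  go (via-right (here refl) H⊑) = reduced-dyadic t H⊑

-- The simplest number theorem

module Simplest (G : Game) where

  Fits : Game → Set
  Fits S = (∀ {L} → L ∈ left G → S ⊳ L) × (∀ {R} → R ∈ right G → R ⊳ S)

  fits-left : ∀ {S A} → Fits S → S ≽ A → Fits A ⊎ (∃[ L ] (L ∈ left G × L ≽ A))
  fits-left {S} {A} (_ , g) S≽A with all⊎any (left G) (λ {L} _ → swap (≽⊎⊲ L A))
  ... | inj₁ f = inj₁ (f , λ R∈ → ⊳-≽-trans (g R∈) S≽A)
  ... | inj₂ L = inj₂ L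

  fits-right : ∀ {S A} → Fits S → A ≽ S → Fits A ⊎ (∃[ R ] (R ∈ right G × A ≽ R))
  fits-right {S} {A} (f , _) A≽S with all⊎any (right G) (λ {R} _ → swap (≽⊎⊲ A R))
  ... | inj₁ g = inj₁ ((λ L∈ → ≽-⊳-trans A≽S (f L∈)) , g)
  ... | inj₂ R = inj₂ R

  fits⇒≈ : ∀ {S} → Fits S → (∀ {A} → A ∈ left S → ∃[ L ] (L ∈ left G × L ≽ A)) →
           (∀ {A} → A ∈ right S → ∃[ R ] (R ∈ right G × A ≽ R)) → G ≈ S
  fits⇒≈ (f , g) l r =
    second g (λ A∈ → byLeft (proj₁ (proj₂ (l A∈))) (proj₂ (proj₂ (l A∈)))) ,
    second (λ A∈ → byRight (proj₁ (proj₂ (r A∈))) (proj₂ (proj₂ (r A∈)))) f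

  Result : Set
  Result = ∃[ S ] (IsDyadic S × G ≈ S)

  simplest-nonNeg : ∀ n → Fits (integer (+ n)) → Result
  simplest-nonNeg zero    fit = 0ᴳ , isDyadic-0 , fits⇒≈ fit (λ ()) (λ ())
  simplest-nonNeg (suc n) fit with fits-left fit (suc-≽ 0 (+ n))
  ... | inj₁ fit′ = simplest-nonNeg n fit′
  ... | inj₂ w    = _ , (+ suc n , 0 , refl) , fits⇒≈ fit (λ { (here refl) → w }) (λ ())

  simplest-neg : ∀ n → Fits (integer -[1+ n ]) → Result
  simplest-neg zero fit with fits-right fit (suc-≽ 0 -[1+ 0 ])
  ... | inj₁ fit′ = simplest-nonNeg 0 fit′
  ... | inj₂ w    = _ , (-[1+ 0 ] , 0 , refl) , fits⇒≈ fit (λ ()) (λ { (here refl) → w })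
  simplest-neg (suc n) fit with fits-right fit (suc-≽ 0 -[1+ suc n ])
  ... | inj₁ fit′ = simplest-neg n fit′
  ... | inj₂ w    = _ , (-[1+ suc n ] , 0 , refl) , fits⇒≈ fit (λ ()) (λ { (here refl) → w })

  -- From any fitting dyadic the search descends to an option that still fits. When none does, each
  -- option is barred by an option of `G`, and these are the replies that `fits⇒≈` asks for.
  simplest : ∀ k m → Fits (dyadic m k) → Result
  simplest zero (+ n)    = simplest-nonNeg n
  simplest zero -[1+ n ] = simplest-neg n
  simplest (suc k) m fit with parity m
  ... | even j rewrite dyadic-double j k = simplest k j fit
  simplest (suc k) m fit | odd j
    with fits-left fit (≽-left (suc k) m left∈) | fits-right fit (right-≽′ (suc k) m right∈)
    where
    left∈ : dyadic j k ∈ left (dyadic (ℤ.suc (double j)) (suc k))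
    left∈ = subst (λ H → dyadic j k ∈ left H) (sym (dyadic-odd j k)) (here refl)
    right∈ : dyadic (ℤ.suc j) k ∈ right (dyadic (ℤ.suc (double j)) (suc k))
    right∈ = subst (λ H → dyadic (ℤ.suc j) k ∈ right H) (sym (dyadic-odd j k)) (here refl)
  ... | inj₁ fit′ | _         = simplest k j fit′
  ... | inj₂ _    | inj₁ fit′ = simplest k (ℤ.suc j) fit′
  ... | inj₂ w    | inj₂ w′   = _ , (m , suc k , refl) , fits⇒≈ fit left-w right-w
    where
    left-w : ∀ {A} → A ∈ left (dyadic (ℤ.suc (double j)) (suc k)) → ∃[ L ] (L ∈ left G × L ≽ A)
    left-w A∈ rewrite dyadic-odd j k with here refl ← A∈ = w
    right-w : ∀ {A} → A ∈ right (dyadic (ℤ.suc (double j)) (suc k)) → ∃[ R ] (R ∈ right G × A ≽ R)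
    right-w A∈ rewrite dyadic-odd j k with here refl ← A∈ = w′

-- Takes the least of the individual bounds and `r₀`. Being one of them, it inherits the property
-- `U`; `r₀` covers the empty list.
greatest-bound : ∀ {U : Game → Set} Gs {r₀} → IsDyadic r₀ → U r₀ →
  (∀ {R} → R ∈ Gs → ∃[ r ] (IsDyadic r × U r × (∀ {x} → IsDyadic x → r ⊳ x → R ⊳ x))) →
  ∃[ r ] (IsDyadic r × U r × r₀ ≽ r × (∀ {R} → R ∈ Gs → ∀ {x} → IsDyadic x → r ⊳ x → R ⊳ x))
greatest-bound [] {r₀} d u _ = r₀ , d , u , ≽-refl r₀ , λ ()
greatest-bound (G ∷ Gs) {r₀} d u b
  with greatest-bound Gs d u (λ R∈ → b (there R∈)) | b (here refl)
... | r , rd , ru , r₀≽r , rb | r′ , rd′ , ru′ , rb′ with ≽⊎⊲ r r′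
... | inj₁ r≽r′ = r′ , rd′ , ru′ , ≽-trans r₀≽r r≽r′ ,
  λ { (here refl) → rb′ ; (there R∈) xd p → rb R∈ xd (≽-⊳-trans r≽r′ p) }
... | inj₂ r′⊳r = r , rd , ru , r₀≽r ,
  λ { (here refl) xd p → rb′ xd (≽-⊳-trans (dyadic-⊳⇒≽ rd′ rd r′⊳r) p) ; (there R∈) → rb R∈ }

least-bound : ∀ {U : Game → Set} Gs {l₀} → IsDyadic l₀ → U l₀ →
  (∀ {L} → L ∈ Gs → ∃[ l ] (IsDyadic l × U l × (∀ {x} → IsDyadic x → x ⊳ l → x ⊳ L))) →
  ∃[ l ] (IsDyadic l × U l × l ≽ l₀ × (∀ {L} → L ∈ Gs → ∀ {x} → IsDyadic x → x ⊳ l → x ⊳ L))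
least-bound [] {l₀} d u _ = l₀ , d , u , ≽-refl l₀ , λ ()
least-bound (G ∷ Gs) {l₀} d u b
  with least-bound Gs d u (λ L∈ → b (there L∈)) | b (here refl)
... | l , ld , lu , l≽l₀ , lb | l′ , ld′ , lu′ , lb′ with ≽⊎⊲ l l′
... | inj₁ l≽l′ = l , ld , lu , l≽l₀ ,
  λ { (here refl) xd p → lb′ xd (⊳-≽-trans p l≽l′) ; (there L∈) → lb L∈ }
... | inj₂ l′⊳l = l′ , ld′ , lu′ , ≽-trans l′≽l l≽l₀ ,
  λ { (here refl) → lb′ ; (there L∈) xd p → lb L∈ xd (⊳-≽-trans p l′≽l) }
  where l′≽l = dyadic-⊳⇒≽ ld′ ld l′⊳l

-- The ordered ring ℤ[φ]

-- (a , b) stands for a + bφ.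
ℤ[φ] : Set
ℤ[φ] = ℤ × ℤ

infixl 6 _⊕_ _⊝_

_⊕_ _⊝_ : ℤ[φ] → ℤ[φ] → ℤ[φ]
(a , b) ⊕ (c , d) = a ℤ.+ c , b ℤ.+ d
(a , b) ⊝ (c , d) = a ℤ.- c , b ℤ.- d

φ·_ : ℤ[φ] → ℤ[φ]
φ· (a , b) = b , a ℤ.+ b

-- (a + bφ) φᵏ = u + aF(k) φ + bF(k+1) φ with u negligible, so the sign of
-- a + bφ is that of the integers aF(k) + bF(k+1) for large k.
term : ℤ[φ] → ℕ → ℤ
term (a , b) k = a ℤ.* + F k ℤ.+ b ℤ.* + F (suc k)

record Pos (x : ℤ[φ]) : Set where
  constructor eventually
  field
    from  : ℕ
    holds : ∀ k → from ℕ.≤ k → + 0 ℤ.< term x k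

record NonNeg (x : ℤ[φ]) : Set where
  constructor eventually
  field
    from  : ℕ
    holds : ∀ k → from ℕ.≤ k → + 0 ℤ.≤ term x k

pos⇒nonNeg : ∀ {x} → Pos x → NonNeg x
pos⇒nonNeg (eventually N p) = eventually N λ k N≤k → ℤ.<⇒≤ (p k N≤k)

term-⊕ : ∀ x y k → term (x ⊕ y) k ≡ term x k ℤ.+ term y k
term-⊕ (a , b) (c , d) k = lemma a b c d (+ F k) (+ F (suc k))
  where
  lemma : ∀ a b c d f g → (a ℤ.+ c) ℤ.* f ℤ.+ (b ℤ.+ d) ℤ.* g ≡ (a ℤ.* f ℤ.+ b ℤ.* g) ℤ.+ (c ℤ.* f ℤ.+ d ℤ.* g)
  lemma = solve-∀

module _ {x y : ℤ[φ]} where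

  private
    maxˡ : ∀ {N M k} → N ℕ.⊔ M ℕ.≤ k → N ℕ.≤ k
    maxˡ {N} {M} = ℕ.≤-trans (ℕ.m≤m⊔n N M)
    maxʳ : ∀ {N M k} → N ℕ.⊔ M ℕ.≤ k → M ℕ.≤ k
    maxʳ {N} {M} = ℕ.≤-trans (ℕ.m≤n⊔m N M)

  pos-⊕ : Pos x → NonNeg y → Pos (x ⊕ y)
  pos-⊕ (eventually N p) (eventually M q) = eventually (N ℕ.⊔ M) λ k le → subst (+ 0 ℤ.<_) (sym (term-⊕ x y k))
    (ℤ.+-mono-<-≤ (p k (maxˡ {N} {M} le)) (q k (maxʳ {N} {M} le)))

  nonNeg-⊕ : NonNeg x → NonNeg y → NonNeg (x ⊕ y)
  nonNeg-⊕ (eventually N p) (eventually M q) = eventually (N ℕ.⊔ M) λ k le → subst (+ 0 ℤ.≤_) (sym (term-⊕ x y k))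
    (ℤ.+-mono-≤ (p k (maxˡ {N} {M} le)) (q k (maxʳ {N} {M} le)))

⊕-pos : ∀ {x y} → NonNeg x → Pos y → Pos (x ⊕ y)
⊕-pos {a , b} {c , d} p q = subst Pos (cong₂ _,_ (ℤ.+-comm c a) (ℤ.+-comm d b)) (pos-⊕ {c , d} {a , b} q p)

-- Multiplication by φ merely shifts the index, so eventual signs are both preserved and reflected;
-- division by φ is then harmless as well.
term-φ : ∀ x k → term (φ· x) k ≡ term x (suc k)
term-φ (a , b) k = lemma a b (+ F k) (+ F (suc k))
  where
  lemma : ∀ a b f g → b ℤ.* f ℤ.+ (a ℤ.+ b) ℤ.* g ≡ a ℤ.* g ℤ.+ b ℤ.* (g ℤ.+ f)
  lemma = solve-∀

pos-φ⁺ : ∀ {x} → Pos x → Pos (φ· x)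
pos-φ⁺ {x} (eventually N p) = eventually N λ k le → subst (+ 0 ℤ.<_) (sym (term-φ x k)) (p (suc k) (ℕ.m≤n⇒m≤1+n le))

pos-φ⁻ : ∀ {x} → Pos (φ· x) → Pos x
pos-φ⁻ {x} (eventually N p) = eventually (suc N) λ { (suc k) (ℕ.s≤s le) → subst (+ 0 ℤ.<_) (term-φ x k) (p k le) }

nonNeg-φ⁺ : ∀ {x} → NonNeg x → NonNeg (φ· x)
nonNeg-φ⁺ {x} (eventually N p) = eventually N λ k le → subst (+ 0 ℤ.≤_) (sym (term-φ x k)) (p (suc k) (ℕ.m≤n⇒m≤1+n le))

nonNeg-φ⁻ : ∀ {x} → NonNeg (φ· x) → NonNeg x
nonNeg-φ⁻ {x} (eventually N p) = eventually (suc N) λ { (suc k) (ℕ.s≤s le) → subst (+ 0 ℤ.≤_) (term-φ x k) (p k le) }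

F-pos : ∀ k → 1 ℕ.≤ F (suc k)
F-pos zero          = ℕ.s≤s ℕ.z≤n
F-pos (suc k) = ℕ.≤-trans (F-pos k) (ℕ.m≤m+n _ _)

coords-nonNeg : ∀ {a b} → + 0 ℤ.≤ a → + 0 ℤ.≤ b → NonNeg (a , b)
coords-nonNeg {+ a} {+ b} _ _ = eventually 0 λ k _ → subst₂ (λ u v → + 0 ℤ.≤ u ℤ.+ v)
  (ℤ.pos-* a (F k)) (ℤ.pos-* b (F (suc k))) (ℤ.+≤+ ℕ.z≤n)

coords-pos : ∀ {a b} → + 1 ℤ.≤ a → + 0 ℤ.≤ b → Pos (a , b)
coords-pos {+ suc a} {+ b} _ _ = eventually 1 λ { (suc k) _ → subst₂ (λ u v → + 0 ℤ.< u ℤ.+ v)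
  (ℤ.pos-* (suc a) (F (suc k))) (ℤ.pos-* b (F (suc (suc k))))
  (ℤ.+<+ (ℕ.≤-trans (F-pos k) (ℕ.≤-trans (ℕ.m≤m+n _ (a ℕ.* F (suc k))) (ℕ.m≤m+n _ _)))) }
coords-pos {+ zero} (ℤ.+≤+ ())

-- The point where inequalities in ℤ[φ] become integer inequalities: carries, floors and sizes of
-- heaps are all obtained through it.
pos-integer : ∀ {a} → Pos (a , + 0) → + 1 ℤ.≤ a
pos-integer {+ suc a} _ = ℤ.+≤+ (ℕ.s≤s ℕ.z≤n)
pos-integer {+ zero} (eventually N p) with ℤ.+<+ () ← p N ℕ.≤-refl
pos-integer { -[1+ a ]} (eventually N p) = ⊥-elim (impossible (F-pos N) (p (suc N) (ℕ.n≤1+n N)))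
  where
  impossible : ∀ {f} → 1 ℕ.≤ f → ¬ (+ 0 ℤ.< -[1+ a ] ℤ.* + f ℤ.+ + 0)
  impossible {suc f} _ ()

pos⇒¬nonNeg : ∀ {a b c d} → a ℤ.+ c ≡ + 0 → b ℤ.+ d ≡ + 0 → Pos (a , b) → ¬ NonNeg (c , d)
pos⇒¬nonNeg {a} {b} {c} {d} e f p q
  with ℤ.+≤+ () ← pos-integer {+ 0} (subst Pos (cong₂ _,_ e f) (pos-⊕ {a , b} {c , d} p q))

φ^_·_ : ℕ → ℤ[φ] → ℤ[φ]
φ^ zero  · x = x
φ^ suc j · x = φ^ j · (φ· x)

-- Multiplying by a power of φ keeps the sign but evens out the coordinates: for a positive element
-- both become positive after finitely many steps, and then the sign is visible.
nonNegBy : ∀ j {x} → + 0 ℤ.≤ proj₁ (φ^ j · x) → + 0 ℤ.≤ proj₂ (φ^ j · x) → NonNeg x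
nonNegBy zero    p q = coords-nonNeg p q
nonNegBy (suc j) p q = nonNeg-φ⁻ (nonNegBy j p q)

posBy : ∀ j {x} → + 1 ℤ.≤ proj₁ (φ^ j · x) → + 0 ℤ.≤ proj₂ (φ^ j · x) → Pos x
posBy zero    p q = coords-pos p q
posBy (suc j) p q = pos-φ⁻ (posBy j p q)

-- Ties together two tests of p against nφ: the sign of the norm p² - pn - n², to which the bounds
-- on `isqrt` apply, and the sign in ℤ[φ]. As φ is irrational, equality leaves only p = n = 0.
data Comparison (p n : ℕ) : Set where
  less : p ℕ.* p ℕ.< p ℕ.* n ℕ.+ n ℕ.* n → Pos (ℤ.- + p , + n) → Comparison p n
  greater : p ℕ.* n ℕ.+ n ℕ.* n ℕ.< p ℕ.* p → Pos (+ p , ℤ.- + n) → Comparison p n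
  both0 : p ≡ 0 → n ≡ 0 → Comparison p n

less-≤ : ∀ p n → p ℕ.≤ suc n → Comparison p (suc n)
less-≤ p n p≤n = less
  (ℕ.≤-<-trans (ℕ.*-monoʳ-≤ p p≤n) (ℕ.m<m+n (p ℕ.* suc n) (ℕ.s≤s ℕ.z≤n)))
  (posBy 1 (ℤ.+≤+ (ℕ.s≤s ℕ.z≤n)) (subst (+ 0 ℤ.≤_) (ℤ.+-comm (+ suc n) (ℤ.- + p)) (ℤ.i≤j⇒0≤j-i (ℤ.+≤+ p≤n))))

greater-≥ : ∀ n r → Comparison (suc n ℕ.+ (suc n ℕ.+ r)) (suc n)
greater-≥ n r = greater
  (subst (p ℕ.* suc n ℕ.+ suc n ℕ.* suc n ℕ.<_) (sym (norm (suc n) r)) (ℕ.m<m+n _ (ℕ.s≤s ℕ.z≤n)))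
  (posBy 2 (subst (+ 1 ℤ.≤_) (lemma₁ (+ suc n) (+ r)) (ℤ.+≤+ (ℕ.s≤s ℕ.z≤n)))
           (subst (+ 0 ℤ.≤_) (lemma₂ (+ suc n) (+ r)) (ℤ.+≤+ ℕ.z≤n)))
  where
  p : ℕ
  p = suc n ℕ.+ (suc n ℕ.+ r)
  norm : ∀ n r → (n ℕ.+ (n ℕ.+ r)) ℕ.* (n ℕ.+ (n ℕ.+ r)) ≡
    ((n ℕ.+ (n ℕ.+ r)) ℕ.* n ℕ.+ n ℕ.* n) ℕ.+ (n ℕ.* n ℕ.+ (3 ℕ.* n ℕ.* r ℕ.+ r ℕ.* r))
  norm = ℕ-Ring.solve-∀
  lemma₁ : ∀ n r → n ℤ.+ r ≡ n ℤ.+ (n ℤ.+ r) ℤ.+ ℤ.- n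
  lemma₁ = solve-∀
  lemma₂ : ∀ n r → r ≡ ℤ.- n ℤ.+ (n ℤ.+ (n ℤ.+ r) ℤ.+ ℤ.- n)
  lemma₂ = solve-∀

-- Multiplication by φ² maps nφ - p to vφ - u if n = u + v and p = 2u + v,
-- and preserves the norm p² - pn - n².
compare-φ² : ∀ u v → Comparison u v → Comparison (u ℕ.+ v ℕ.+ u) (u ℕ.+ v)
compare-φ² u v (both0 refl refl) = both0 refl refl
compare-φ² u v (less norm pos) = less
  (ℕ.+-cancelʳ-< (u ℕ.* v ℕ.+ v ℕ.* v) _ _ (subst (ℕ._< rhs ℕ.+ (u ℕ.* v ℕ.+ v ℕ.* v)) (sym (identity u v)) (ℕ.+-monoʳ-< rhs norm)))
  (pos-φ⁻ (pos-φ⁻ (subst Pos (cong₂ _,_ (lemma₁ (+ u) (+ v)) (lemma₂ (+ u) (+ v))) pos)))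
  where
  rhs = (u ℕ.+ v ℕ.+ u) ℕ.* (u ℕ.+ v) ℕ.+ (u ℕ.+ v) ℕ.* (u ℕ.+ v)
  identity : ∀ u v → (u ℕ.+ v ℕ.+ u) ℕ.* (u ℕ.+ v ℕ.+ u) ℕ.+ (u ℕ.* v ℕ.+ v ℕ.* v) ≡
    ((u ℕ.+ v ℕ.+ u) ℕ.* (u ℕ.+ v) ℕ.+ (u ℕ.+ v) ℕ.* (u ℕ.+ v)) ℕ.+ u ℕ.* u
  identity = ℕ-Ring.solve-∀
  lemma₁ : ∀ u v → ℤ.- u ≡ ℤ.- (u ℤ.+ v ℤ.+ u) ℤ.+ (u ℤ.+ v)
  lemma₁ = solve-∀
  lemma₂ : ∀ u v → v ≡ (u ℤ.+ v) ℤ.+ (ℤ.- (u ℤ.+ v ℤ.+ u) ℤ.+ (u ℤ.+ v))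
  lemma₂ = solve-∀
compare-φ² u v (greater norm pos) = greater
  (ℕ.+-cancelʳ-< (u ℕ.* v ℕ.+ v ℕ.* v) _ _ (subst (rhs ℕ.+ (u ℕ.* v ℕ.+ v ℕ.* v) ℕ.<_) (sym (identity u v)) (ℕ.+-monoʳ-< rhs norm)))
  (pos-φ⁻ (pos-φ⁻ (subst Pos (cong₂ _,_ (lemma₁ (+ u) (+ v)) (lemma₂ (+ u) (+ v))) pos)))
  where
  rhs = (u ℕ.+ v ℕ.+ u) ℕ.* (u ℕ.+ v) ℕ.+ (u ℕ.+ v) ℕ.* (u ℕ.+ v)
  identity : ∀ u v → (u ℕ.+ v ℕ.+ u) ℕ.* (u ℕ.+ v ℕ.+ u) ℕ.+ (u ℕ.* v ℕ.+ v ℕ.* v) ≡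
    ((u ℕ.+ v ℕ.+ u) ℕ.* (u ℕ.+ v) ℕ.+ (u ℕ.+ v) ℕ.* (u ℕ.+ v)) ℕ.+ u ℕ.* u
  identity = ℕ-Ring.solve-∀
  lemma₁ : ∀ u v → u ≡ (u ℤ.+ v ℤ.+ u) ℤ.+ ℤ.- (u ℤ.+ v)
  lemma₁ = solve-∀
  lemma₂ : ∀ u v → ℤ.- v ≡ ℤ.- (u ℤ.+ v) ℤ.+ ((u ℤ.+ v ℤ.+ u) ℤ.+ ℤ.- (u ℤ.+ v))
  lemma₂ = solve-∀

-- Outside n < p < 2n the answer is immediate. Inside, u = p - n and v = n - u give a pair with v <
-- n to which `compare-φ²` applies, a form of Euclid's algorithm; `bound` makes the descent
-- structural.
compare-bounded : ∀ bound p n → n ℕ.≤ bound → Comparison p n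
compare-bounded bound zero    zero _ = both0 refl refl
compare-bounded bound (suc p) zero _ = greater
  (ℕ.≤-trans (ℕ.s≤s (ℕ.≤-reflexive (trans (ℕ.+-identityʳ (p ℕ.* 0)) (ℕ.*-zeroʳ p)))) (ℕ.s≤s ℕ.z≤n))
  (coords-pos (ℤ.+≤+ (ℕ.s≤s ℕ.z≤n)) ℤ.≤-refl)
compare-bounded (suc bound) p (suc n) (ℕ.s≤s n≤) with p ℕ.≤? suc n
... | yes p≤n = less-≤ p n p≤n
... | no  p≰n with ℕ.m≤n⇒∃[o]m+o≡n (ℕ.≰⇒> p≰n)
... | u , refl with suc n ℕ.≤? suc u
... | yes n≤u with r , e ← ℕ.m≤n⇒∃[o]m+o≡n n≤u =
  subst (λ p → Comparison p (suc n)) (trans (cong (suc n ℕ.+_) e) (ℕ.+-suc (suc n) u)) (greater-≥ n r)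
... | no n≰u with v , e ← ℕ.m≤n⇒∃[o]m+o≡n (ℕ.≰⇒≥ n≰u) =
  subst₂ Comparison (trans (cong (ℕ._+ suc u) e) (ℕ.+-suc (suc n) u)) e
    (compare-φ² (suc u) v (compare-bounded bound (suc u) v (ℕ.≤-trans (v≤n e) n≤)))
  where
  v≤n : suc u ℕ.+ v ≡ suc n → v ℕ.≤ n
  v≤n e = subst (v ℕ.≤_) (ℕ.suc-injective e) (ℕ.m≤n+m v u)

compare : ∀ p n → Comparison p n
compare p n = compare-bounded n p n ℕ.≤-refl

pos⊎nonPos : ∀ x → Pos x ⊎ NonNeg ((+ 0 , + 0) ⊝ x)
pos⊎nonPos (+ a , -[1+ b ]) with compare a (suc b)
... | less _ p = inj₂ (subst NonNeg (cong (_, + suc b) (sym (ℤ.+-identityˡ (ℤ.- + a)))) (pos⇒nonNeg p))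
... | greater _ p = inj₁ p
pos⊎nonPos (-[1+ a ] , + b) with compare (suc a) b
... | less _ p = inj₁ p
... | greater _ p = inj₂ (subst NonNeg (cong (+ suc a ,_) (sym (ℤ.+-identityˡ (ℤ.- + b)))) (pos⇒nonNeg p))
pos⊎nonPos (-[1+ a ] , -[1+ b ]) = inj₂ (coords-nonNeg (ℤ.+≤+ ℕ.z≤n) (ℤ.+≤+ ℕ.z≤n))
pos⊎nonPos (+ zero , + zero)     = inj₂ (coords-nonNeg ℤ.≤-refl ℤ.≤-refl)
pos⊎nonPos (+ suc a , + b)       = inj₁ (coords-pos (ℤ.+≤+ (ℕ.s≤s ℕ.z≤n)) (ℤ.+≤+ ℕ.z≤n))
pos⊎nonPos (+ zero , + suc b)    = inj₁ (posBy 1 (ℤ.+≤+ (ℕ.s≤s ℕ.z≤n)) (ℤ.+≤+ ℕ.z≤n))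

⌊half⌋ : ∀ m → m ℕ./ 2 ℕ.* 2 ℕ.≤ m × m ℕ.< suc (m ℕ./ 2) ℕ.* 2
⌊half⌋ m = ℕ.m/n*n≤m m 2 ,
  subst (ℕ._< suc (m ℕ./ 2) ℕ.* 2) (sym (ℕ.m≡m%n+[m/n]*n m 2)) (ℕ.+-monoˡ-< (m ℕ./ 2 ℕ.* 2) (ℕ.m%n<n m 2))

-- Completing the square, 4(p² - pn - n²) = (2p - n)² - 5n², and for p = A(n) the number 2p - n is
-- at most ⌊√(5n²)⌋. Writing p = n + w turns 2p - n into n + 2w and avoids subtraction.
floor-lower : ∀ n → 1 ℕ.≤ n → Pos (ℤ.- + A n , + n)
floor-lower n 1≤n with compare (A n) n
... | less _ p = p
... | both0 _ refl with () ← 1≤n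
... | greater norm _ with w , e ← ℕ.m≤n⇒∃[o]m+o≡n (n≤A n) =
  ⊥-elim (ℕ.<⇒≱ norm (ℕ.*-cancelˡ-≤ 4 (subst₂ ℕ._≤_ (sym (trans (cong (λ p → 4 ℕ.* (p ℕ.* p)) (sym e)) (lemma₁ n w)))
     (sym (trans (cong (λ p → 4 ℕ.* (p ℕ.* n ℕ.+ n ℕ.* n)) (sym e)) (lemma₂ n w))) (ℕ.+-monoʳ-≤ _ square))))
  where
  r = isqrt (5 ℕ.* (n ℕ.* n))
  lemma₁ : ∀ n w → 4 ℕ.* ((n ℕ.+ w) ℕ.* (n ℕ.+ w)) ≡ (n ℕ.* n ℕ.+ 2 ℕ.* (n ℕ.* (n ℕ.+ 2 ℕ.* w))) ℕ.+ (n ℕ.+ 2 ℕ.* w) ℕ.* (n ℕ.+ 2 ℕ.* w)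
  lemma₁ = ℕ-Ring.solve-∀
  lemma₂ : ∀ n w → 4 ℕ.* ((n ℕ.+ w) ℕ.* n ℕ.+ n ℕ.* n) ≡ (n ℕ.* n ℕ.+ 2 ℕ.* (n ℕ.* (n ℕ.+ 2 ℕ.* w))) ℕ.+ 5 ℕ.* (n ℕ.* n)
  lemma₂ = ℕ-Ring.solve-∀
  lemma₃ : ∀ n w → (n ℕ.+ w) ℕ.* 2 ≡ n ℕ.+ (n ℕ.+ 2 ℕ.* w)
  lemma₃ = ℕ-Ring.solve-∀
  y≤r : n ℕ.+ 2 ℕ.* w ℕ.≤ r
  y≤r = ℕ.+-cancelˡ-≤ n _ _ (subst (ℕ._≤ n ℕ.+ r) (trans (cong (ℕ._* 2) (sym e)) (lemma₃ n w)) (proj₁ (⌊half⌋ (n ℕ.+ r))))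
  square : (n ℕ.+ 2 ℕ.* w) ℕ.* (n ℕ.+ 2 ℕ.* w) ℕ.≤ 5 ℕ.* (n ℕ.* n)
  square = ℕ.≤-trans (ℕ.*-mono-≤ y≤r y≤r) (isqrt-lower (5 ℕ.* (n ℕ.* n)))

floor-upper : ∀ n → Pos (+ 1 ℤ.+ + A n , ℤ.- + n)
floor-upper n with compare (suc (A n)) n
... | greater _ p = p
... | both0 () _
... | less norm _ with w , e ← ℕ.m≤n⇒∃[o]m+o≡n (n≤A n) =
  ⊥-elim (ℕ.<⇒≱ norm (ℕ.*-cancelˡ-≤ 4 (subst₂ ℕ._≤_ (sym (trans (cong (λ p → 4 ℕ.* (suc p ℕ.* n ℕ.+ n ℕ.* n)) (sym e)) (lemma₂ n w)))
     (sym (trans (cong (λ p → 4 ℕ.* (suc p ℕ.* suc p)) (sym e)) (lemma₁ n w))) (ℕ.+-monoʳ-≤ _ square))))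
  where
  r = isqrt (5 ℕ.* (n ℕ.* n))
  y : ℕ → ℕ
  y w = n ℕ.+ 2 ℕ.* w ℕ.+ 2
  lemma₁ : ∀ n w → 4 ℕ.* ((1 ℕ.+ (n ℕ.+ w)) ℕ.* (1 ℕ.+ (n ℕ.+ w))) ≡
    (n ℕ.* n ℕ.+ 2 ℕ.* (n ℕ.* (n ℕ.+ 2 ℕ.* w ℕ.+ 2))) ℕ.+ (n ℕ.+ 2 ℕ.* w ℕ.+ 2) ℕ.* (n ℕ.+ 2 ℕ.* w ℕ.+ 2)
  lemma₁ = ℕ-Ring.solve-∀
  lemma₂ : ∀ n w → 4 ℕ.* ((1 ℕ.+ (n ℕ.+ w)) ℕ.* n ℕ.+ n ℕ.* n) ≡
    (n ℕ.* n ℕ.+ 2 ℕ.* (n ℕ.* (n ℕ.+ 2 ℕ.* w ℕ.+ 2))) ℕ.+ 5 ℕ.* (n ℕ.* n)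
  lemma₂ = ℕ-Ring.solve-∀
  lemma₃ : ∀ n w → (1 ℕ.+ (n ℕ.+ w)) ℕ.* 2 ≡ n ℕ.+ (n ℕ.+ 2 ℕ.* w ℕ.+ 2)
  lemma₃ = ℕ-Ring.solve-∀
  r<y : suc r ℕ.≤ y w
  r<y = ℕ.+-cancelˡ-< n _ _ (subst (n ℕ.+ r ℕ.<_) (trans (cong (λ p → suc p ℕ.* 2) (sym e)) (lemma₃ n w)) (proj₂ (⌊half⌋ (n ℕ.+ r))))
  square : 5 ℕ.* (n ℕ.* n) ℕ.≤ y w ℕ.* y w
  square = ℕ.<⇒≤ (ℕ.<-≤-trans (isqrt-upper (5 ℕ.* (n ℕ.* n))) (ℕ.*-mono-≤ r<y r<y))

B≡A+n : ∀ n → B n ≡ A n ℕ.+ n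
B≡A+n n = trans (cong (ℕ._/ 2) (lemma n (isqrt (5 ℕ.* (n ℕ.* n)))))
  (trans (ℕ.+-distrib-/-∣ʳ (n ℕ.+ isqrt (5 ℕ.* (n ℕ.* n))) {n ℕ.* 2} (divides n refl)) (cong (A n ℕ.+_) (ℕ.m*n/n≡m n 2)))
  where
  lemma : ∀ n r → 3 ℕ.* n ℕ.+ r ≡ (n ℕ.+ r) ℕ.+ n ℕ.* 2
  lemma = ℕ-Ring.solve-∀

-- Abstract, because unfolding isqrt at open terms is prohibitively expensive.
abstract
  ⌊φ_⌋ : ℕ → ℕ
  ⌊φ n ⌋ = A n

  A≡⌊φ⌋ : ∀ n → A n ≡ ⌊φ n ⌋
  A≡⌊φ⌋ n = refl

  ⌊φ0⌋ : ⌊φ 0 ⌋ ≡ 0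
  ⌊φ0⌋ = refl

  ⌊φ⌋-lower : ∀ n → 1 ℕ.≤ n → Pos (ℤ.- + ⌊φ n ⌋ , + n)
  ⌊φ⌋-lower = floor-lower

  ⌊φ⌋-upper : ∀ n → Pos (+ 1 ℤ.+ + ⌊φ n ⌋ , ℤ.- + n)
  ⌊φ⌋-upper = floor-upper

  n≤⌊φn⌋ : ∀ n → n ℕ.≤ ⌊φ n ⌋
  n≤⌊φn⌋ = n≤A

⌊φ²_⌋ : ℕ → ℕ
⌊φ² n ⌋ = ⌊φ n ⌋ ℕ.+ n

B≡⌊φ²⌋ : ∀ n → B n ≡ ⌊φ² n ⌋
B≡⌊φ²⌋ n = trans (B≡A+n n) (cong (ℕ._+ n) (A≡⌊φ⌋ n))

-- Fractional parts of nφ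

-- Settles closed elements by evaluation; the coordinates of φ⁸x show the sign for every constant
-- compared below.
nonNeg! : ∀ {x} {p : True (+ 0 ℤ.≤? proj₁ (φ^ 8 · x))} {q : True (+ 0 ℤ.≤? proj₂ (φ^ 8 · x))} → NonNeg x
nonNeg! {p = p} {q} = nonNegBy 8 (toWitness p) (toWitness q)

pos! : ∀ {x} {p : True (+ 1 ℤ.≤? proj₁ (φ^ 8 · x))} {q : True (+ 0 ℤ.≤? proj₂ (φ^ 8 · x))} → Pos x
pos! {p = p} {q} = posBy 8 (toWitness p) (toWitness q)

record In (lo hi x : ℤ[φ]) : Set where
  constructor within
  field
    lower : Pos (x ⊝ lo)
    upper : NonNeg (hi ⊝ x)
open In public

private
  variable
    lo hi lo₁ hi₁ lo₂ hi₂ lo₃ hi₃ ξ η : ℤ[φ]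

⊕-⊝-⊕ : ∀ x l y m → (x ⊝ l) ⊕ (y ⊝ m) ≡ (x ⊕ y) ⊝ (l ⊕ m)
⊕-⊝-⊕ (a , a′) (b , b′) (c , c′) (d , d′) = cong₂ _,_ (lemma a b c d) (lemma a′ b′ c′ d′)
  where
  lemma : ∀ a b c d → (a ℤ.- b) ℤ.+ (c ℤ.- d) ≡ (a ℤ.+ c) ℤ.- (b ℤ.+ d)
  lemma = solve-∀

⊝-⊝-⊝ : ∀ x l m y → (x ⊝ l) ⊕ (m ⊝ y) ≡ (x ⊝ y) ⊝ (l ⊝ m)
⊝-⊝-⊝ (a , a′) (b , b′) (c , c′) (d , d′) = cong₂ _,_ (lemma a b c d) (lemma a′ b′ c′ d′)
  where
  lemma : ∀ a b c d → (a ℤ.- b) ℤ.+ (c ℤ.- d) ≡ (a ℤ.- d) ℤ.- (b ℤ.- c)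
  lemma = solve-∀

⊝-shift : ∀ x y z → x ⊝ y ≡ (x ⊕ z) ⊝ (y ⊕ z)
⊝-shift (a , a′) (b , b′) (c , c′) = cong₂ _,_ (lemma a b c) (lemma a′ b′ c′)
  where
  lemma : ∀ a b c → a ℤ.- b ≡ (a ℤ.+ c) ℤ.- (b ℤ.+ c)
  lemma = solve-∀

In-⊕ : In lo₁ hi₁ ξ → In lo₂ hi₂ η → In (lo₁ ⊕ lo₂) (hi₁ ⊕ hi₂) (ξ ⊕ η)
In-⊕ {lo₁} {hi₁} {x} {lo₂} {hi₂} {y} (within p q) (within p′ q′) = within
  (subst Pos (⊕-⊝-⊕ x lo₁ y lo₂) (pos-⊕ p (pos⇒nonNeg p′)))
  (subst NonNeg (⊕-⊝-⊕ hi₁ x hi₂ y) (nonNeg-⊕ q q′))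

In-shift : ∀ c → In lo hi ξ → In (lo ⊕ c) (hi ⊕ c) (ξ ⊕ c)
In-shift {lo} {hi} {x} c (within p q) =
  within (subst Pos (⊝-shift x lo c) p) (subst NonNeg (⊝-shift hi x c) q)

⊝-⊕-⊝ : ∀ x y z → (x ⊝ y) ⊕ (y ⊝ z) ≡ x ⊝ z
⊝-⊕-⊝ (a , a′) (b , b′) (c , c′) = cong₂ _,_ (lemma a b c) (lemma a′ b′ c′)
  where
  lemma : ∀ a b c → (a ℤ.- b) ℤ.+ (b ℤ.- c) ≡ a ℤ.- c
  lemma = solve-∀

In-widen : NonNeg (lo ⊝ lo₁) → NonNeg (hi₁ ⊝ hi) → In lo hi ξ → In lo₁ hi₁ ξ
In-widen {lo} {lo₁} {hi₁} {hi} {x} l u (within p q) = within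
  (subst Pos (⊝-⊕-⊝ x lo lo₁) (pos-⊕ p l)) (subst NonNeg (⊝-⊕-⊝ hi₁ hi x) (nonNeg-⊕ u q))

record Open (lo hi x : ℤ[φ]) : Set where
  constructor between
  field
    lower : Pos (x ⊝ lo)
    upper : Pos (hi ⊝ x)

integer-bounds : ∀ {z i j} → Open lo hi (z , + 0) → NonNeg (lo ⊝ (i , + 0)) → NonNeg ((j , + 0) ⊝ hi) → i ℤ.< z × z ℤ.< j
integer-bounds {lo} {hi} {z} {i} {j} (between p q) l u =
  above (pos-integer (subst Pos (⊝-⊕-⊝ (z , + 0) lo (i , + 0)) (pos-⊕ p l))) ,
  above (pos-integer (subst Pos (⊝-⊕-⊝ (j , + 0) hi (z , + 0)) (⊕-pos u q)))
  where
  above : ∀ {a b} → + 1 ℤ.≤ a ℤ.- b → b ℤ.< a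
  above {a} {b} p = ℤ.suc[i]≤j⇒i<j (subst (+ 1 ℤ.+ b ℤ.≤_) (lemma a b) (ℤ.+-monoˡ-≤ b p))
    where
    lemma : ∀ a b → (a ℤ.- b) ℤ.+ b ≡ a
    lemma = solve-∀

no-integer : ∀ {z} j → Open lo hi (z , + 0) → NonNeg (lo ⊝ (j , + 0)) → NonNeg ((ℤ.suc j , + 0) ⊝ hi) → ⊥
no-integer j p l u = let j<z , z<1+j = integer-bounds p l u in
  ℤ.<⇒≱ z<1+j (ℤ.i<j⇒suc[i]≤j {j} j<z)

the-integer : ∀ {z} j → Open lo hi (z , + 0) → NonNeg (lo ⊝ (ℤ.pred j , + 0)) → NonNeg ((ℤ.suc j , + 0) ⊝ hi) → z ≡ j
the-integer {z = z} j p l u = let j-1<z , z<1+j = integer-bounds p l u in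
  ℤ.≤-antisym (subst (z ℤ.≤_) (ℤ.pred-suc j) (ℤ.i<j⇒i≤pred[j] {z} {ℤ.suc j} z<1+j))
              (subst (ℤ._≤ z) (ℤ.suc-pred j) (ℤ.i<j⇒suc[i]≤j j-1<z))

-- The upper bound is strict because the lower bound on y is.
Open-⊝ : In lo₁ hi₁ ξ → In lo₂ hi₂ η → Open (lo₁ ⊝ hi₂) (hi₁ ⊝ lo₂) (ξ ⊝ η)
Open-⊝ {lo₁} {hi₁} {x} {lo₂} {hi₂} {y} (within p q) (within p′ q′) = between
  (subst Pos (⊝-⊝-⊝ x lo₁ hi₂ y) (pos-⊕ p q′))
  (subst Pos (⊝-⊝-⊝ hi₁ x y lo₂) (⊕-pos q p′))

-- The subscripts are decimals: c₃₈₂ = 2 - φ = 0.382….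
c₀ c₁₄₆ c₂₃₆ c₃₈₂ c₆₁₈ c₇₆₄ c₁ : ℤ[φ]
c₀   = + 0 , + 0
c₁₄₆ = + 5 , -[1+ 2 ]
c₂₃₆ = -[1+ 2 ] , + 2
c₃₈₂ = + 2 , -[1+ 0 ]
c₆₁₈ = -[1+ 0 ] , + 1
c₇₆₄ = + 4 , -[1+ 1 ]
c₁   = + 1 , + 0

-- For 0 ≤ lo and hi ≤ 1: the fractional part of nφ, with 0φ given the
-- fractional part 1, lies in (lo , hi].
Frac : ℤ[φ] → ℤ[φ] → ℕ → Set
Frac lo hi n = ∃[ a ] In lo hi (a , + n)

FracA FracB ClassOne ClassNum ClassAB₀ : ℕ → Set
FracA    = Frac c₃₈₂ c₁
FracB    = Frac c₀ c₃₈₂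
ClassOne = Frac c₃₈₂ c₆₁₈
ClassNum = Frac c₆₁₈ c₇₆₄
ClassAB₀ = Frac c₇₆₄ c₁

Frac-widen : ∀ {n} → NonNeg (lo ⊝ lo₁) → NonNeg (hi₁ ⊝ hi) → Frac lo hi n → Frac lo₁ hi₁ n
Frac-widen l u (a , p) = a , In-widen l u p

⊝-flip : ∀ x y → (+ 0 , + 0) ⊝ (x ⊝ y) ≡ y ⊝ x
⊝-flip (a , a′) (b , b′) = cong₂ _,_ (lemma a b) (lemma a′ b′)
  where
  lemma : ∀ a b → + 0 ℤ.- (a ℤ.- b) ≡ b ℤ.- a
  lemma = solve-∀

Frac-split : ∀ {n} c → Frac lo hi n → Frac lo c n ⊎ Frac c hi n
Frac-split {n = n} c (a , within p q) with pos⊎nonPos ((a , + n) ⊝ c)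
... | inj₁ above = inj₂ (a , within above q)
... | inj₂ below = inj₁ (a , within p (subst NonNeg (⊝-flip (a , + n) c) below))

-- θ(k) + θ(d) - θ(k + d) is an integer because the multiples of φ cancel. Intervals for the three
-- terms confine this carry, and where they leave no integer a move between the classes is
-- impossible.
carry : ∀ {a b c k d} → In lo₁ hi₁ (a , + k) → In lo₂ hi₂ (b , + d) → In lo₃ hi₃ (c , + (k ℕ.+ d)) →
        Open (lo₁ ⊕ lo₂ ⊝ hi₃) (hi₁ ⊕ hi₂ ⊝ lo₃) (a ℤ.+ b ℤ.- c , + 0)
carry {lo₁} {hi₁} {lo₂} {hi₂} {lo₃} {hi₃} {a} {b} {c} {k} {d} p q r =
  subst (Open (lo₁ ⊕ lo₂ ⊝ hi₃) (hi₁ ⊕ hi₂ ⊝ lo₃)) (cong (a ℤ.+ b ℤ.- c ,_) (ℤ.+-inverseʳ (+ (k ℕ.+ d)))) (Open-⊝ (In-⊕ p q) r)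

no-carry : ∀ {k d} j → Frac lo₁ hi₁ k → Frac lo₂ hi₂ d → Frac lo₃ hi₃ (k ℕ.+ d) →
           NonNeg (lo₁ ⊕ lo₂ ⊝ hi₃ ⊝ (j , + 0)) → NonNeg ((ℤ.suc j , + 0) ⊝ (hi₁ ⊕ hi₂ ⊝ lo₃)) → ⊥
no-carry j (_ , p) (_ , q) (_ , r) = no-integer j (carry p q r)

B-move-from-One : ∀ {k d} → FracB d → ClassOne (k ℕ.+ d) → ¬ Frac c₆₁₈ c₁ k
B-move-from-One d h k = no-carry (+ 0) k d h nonNeg! nonNeg!

A-move-from-Num : ∀ {k d} → FracA d → ClassNum (k ℕ.+ d) → ¬ ClassOne k
A-move-from-Num d h k = no-carry (+ 0) k d h nonNeg! nonNeg!

B-move-from-Num : ∀ {k d} → FracB d → ClassNum (k ℕ.+ d) → ¬ ClassAB₀ k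
B-move-from-Num d h k = no-carry (+ 0) k d h nonNeg! nonNeg!

A-move-from-AB₀ : ∀ {k d} → FracA d → ClassAB₀ (k ℕ.+ d) → ¬ ClassNum k
A-move-from-AB₀ d h k = no-carry (+ 0) k d h nonNeg! nonNeg!

-- By convention 0 has fractional part 1, so an interval that ends below 1 excludes it.
Frac-pos : ∀ {n} → Frac lo hi n → NonNeg lo → Pos (c₁ ⊝ hi) → 1 ℕ.≤ n
Frac-pos {n = suc n} _ _ _ = ℕ.s≤s ℕ.z≤n
Frac-pos {lo₁ , lo₂} {hi} {zero} (a , within p q) l u = ⊥-elim (no-integer {lo₁ , lo₂} {c₁} {a} (+ 0)
  (between p (subst Pos (⊝-⊕-⊝ c₁ hi (a , + 0)) (pos-⊕ u q)))
  (subst NonNeg (cong₂ _,_ (sym (ℤ.+-identityʳ lo₁)) (sym (ℤ.+-identityʳ lo₂))) l) nonNeg!)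

fracB-pos : ∀ {n} → FracB n → 1 ℕ.≤ n
fracB-pos p = Frac-pos p nonNeg! pos!

floor-In : ∀ n → 1 ℕ.≤ n → In c₀ c₁ (ℤ.- + ⌊φ n ⌋ , + n)
floor-In n 1≤n = within
  (subst Pos (cong₂ _,_ (sym (ℤ.+-identityʳ (ℤ.- + ⌊φ n ⌋))) (sym (ℤ.+-identityʳ (+ n)))) (⌊φ⌋-lower n 1≤n))
  (subst NonNeg (cong₂ _,_ (cong (ℤ._+_ (+ 1)) (sym (ℤ.neg-involutive (+ ⌊φ n ⌋)))) (sym (ℤ.+-identityˡ (ℤ.- + n)))) (pos⇒nonNeg (⌊φ⌋-upper n)))

frac-total : ∀ n → Frac c₀ c₁ n
frac-total zero    = + 1 , within pos! nonNeg!
frac-total (suc n) = _ , floor-In (suc n) (ℕ.s≤s ℕ.z≤n)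

data Class (h : ℕ) : Set where
  inB   : FracB h → Class h
  inOne : ClassOne h → Class h
  inNum : ClassNum h → Class h
  inAB₀ : ClassAB₀ h → Class h

classify : ∀ h → Class h
classify h with Frac-split c₃₈₂ (frac-total h)
... | inj₁ p = inB p
... | inj₂ p with Frac-split c₆₁₈ p
... | inj₁ p = inOne p
... | inj₂ p with Frac-split c₇₆₄ p
... | inj₁ p = inNum p
... | inj₂ p = inAB₀ p

floor-unique : ∀ {q} i → 1 ℕ.≤ i → NonNeg (ℤ.- q , + i) → NonNeg (+ 1 ℤ.+ q , ℤ.- + i) → + ⌊φ i ⌋ ≡ q
floor-unique {q} i 1≤i p r = ℤ.≤-antisym
  (cancel (pos-integer (subst Pos (cong₂ _,_ (lemma q (+ ⌊φ i ⌋)) (ℤ.+-inverseʳ (+ i))) (pos-⊕ (⌊φ⌋-lower i 1≤i) r) )))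
  (cancel (pos-integer (subst Pos (cong₂ _,_ (lemma (+ ⌊φ i ⌋) q) (ℤ.+-inverseʳ (+ i))) (⊕-pos p (⌊φ⌋-upper i)))))
  where
  lemma : ∀ u v → ℤ.- v ℤ.+ (+ 1 ℤ.+ u) ≡ + 1 ℤ.+ u ℤ.- v
  lemma = solve-∀
  cancel : ∀ {u v} → + 1 ℤ.≤ + 1 ℤ.+ u ℤ.- v → v ℤ.≤ u
  cancel {u} {v} p = subst₂ ℤ._≤_ (lemma₁ v) (lemma₂ u v) (ℤ.+-monoʳ-≤ (v ℤ.- + 1) p)
    where
    lemma₁ : ∀ v → v ℤ.- + 1 ℤ.+ + 1 ≡ v
    lemma₁ = solve-∀
    lemma₂ : ∀ u v → v ℤ.- + 1 ℤ.+ (+ 1 ℤ.+ u ℤ.- v) ≡ u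
    lemma₂ = solve-∀

-- If d = ⌊φ i ⌋ then d φ ≡ 1 - (iφ - d)/φ modulo 1.
inA⇒ : ∀ {d} → Range⁺ ⌊φ_⌋ d → 1 ℕ.≤ d × FracA d
inA⇒ (i , 1≤i , refl) = ℕ.≤-trans 1≤i (n≤⌊φn⌋ i) , + 1 ℤ.- + i ℤ.- + ⌊φ i ⌋ , within
  (pos-φ⁻ (subst Pos (cong₂ _,_ (lemma₁ (+ ⌊φ i ⌋)) (lemma₂ (+ i) (+ ⌊φ i ⌋))) (⌊φ⌋-upper i)))
  (nonNeg-φ⁻ (subst NonNeg (cong₂ _,_ (lemma₃ (+ ⌊φ i ⌋)) (lemma₄ (+ i) (+ ⌊φ i ⌋))) (pos⇒nonNeg (⌊φ⌋-lower i 1≤i))))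
  where
  lemma₁ : ∀ d → + 1 ℤ.+ d ≡ d ℤ.- -[1+ 0 ]
  lemma₁ = solve-∀
  lemma₂ : ∀ i d → ℤ.- i ≡ (+ 1 ℤ.- i ℤ.- d) ℤ.- + 2 ℤ.+ (d ℤ.- -[1+ 0 ])
  lemma₂ = solve-∀
  lemma₃ : ∀ d → ℤ.- d ≡ + 0 ℤ.- d
  lemma₃ = solve-∀
  lemma₄ : ∀ i d → i ≡ + 1 ℤ.- (+ 1 ℤ.- i ℤ.- d) ℤ.+ (+ 0 ℤ.- d)
  lemma₄ = solve-∀

-- Solves the congruence behind `inA⇒` for the index, since there a = 1 - i - d. The equation is
-- returned along with the index because `A-fracB` needs it.
inA-index : ∀ {a d} → 1 ℕ.≤ d → In c₃₈₂ c₁ (a , + d) → ∃[ i ] (1 ℕ.≤ i × ⌊φ i ⌋ ≡ d × + i ≡ + 1 ℤ.- a ℤ.- + d)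
inA-index {a} {d} 1≤d (within p q) = index (+ 1 ℤ.- a ℤ.- + d) refl lower′ upper′
  where
  lemma₁ : ∀ d → + 0 ℤ.- d ≡ ℤ.- d
  lemma₁ = solve-∀
  lemma₂ : ∀ a d → + 1 ℤ.- a ℤ.+ (+ 0 ℤ.- d) ≡ + 1 ℤ.- a ℤ.- d
  lemma₂ = solve-∀
  lemma₃ : ∀ d → d ℤ.- -[1+ 0 ] ≡ + 1 ℤ.+ d
  lemma₃ = solve-∀
  lemma₄ : ∀ a d → a ℤ.- + 2 ℤ.+ (d ℤ.- -[1+ 0 ]) ≡ ℤ.- (+ 1 ℤ.- a ℤ.- d)
  lemma₄ = solve-∀
  lower′ : NonNeg (ℤ.- + d , + 1 ℤ.- a ℤ.- + d)
  lower′ = subst NonNeg (cong₂ _,_ (lemma₁ (+ d)) (lemma₂ a (+ d))) (nonNeg-φ⁺ q)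
  upper′ : Pos (+ 1 ℤ.+ + d , ℤ.- (+ 1 ℤ.- a ℤ.- + d))
  upper′ = subst Pos (cong₂ _,_ (lemma₃ (+ d)) (lemma₄ a (+ d))) (pos-φ⁺ p)
  index : ∀ i → i ≡ + 1 ℤ.- a ℤ.- + d → NonNeg (ℤ.- + d , i) → Pos (+ 1 ℤ.+ + d , ℤ.- i) →
          ∃[ j ] (1 ℕ.≤ j × ⌊φ j ⌋ ≡ d × + j ≡ + 1 ℤ.- a ℤ.- + d)
  index (+ suc i) e l u = suc i , ℕ.s≤s ℕ.z≤n , ℤ.+-injective (floor-unique (suc i) (ℕ.s≤s ℕ.z≤n) l (pos⇒nonNeg u)) , e
  index (+ zero) _ l u = ⊥-elim (pos⇒¬nonNeg (ℤ.+-inverseʳ (+ d)) refl (coords-pos {b = + 0} (ℤ.+≤+ 1≤d) ℤ.≤-refl) l)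
  index -[1+ i ] _ l u = ⊥-elim (pos⇒¬nonNeg (ℤ.+-inverseʳ (+ d)) (ℤ.+-inverseʳ (+ suc i)) (coords-pos {b = + suc i} (ℤ.+≤+ 1≤d) (ℤ.+≤+ ℕ.z≤n)) l)

⇒inA : ∀ {d} → 1 ℕ.≤ d → FracA d → Range⁺ ⌊φ_⌋ d
⇒inA 1≤d (_ , p) = let i , 1≤i , e , _ = inA-index 1≤d p in i , 1≤i , e

-- Fractional parts on the sets built from A and B

φ⁻²·_ : ℤ[φ] → ℤ[φ]
φ⁻²· (a , b) = a ℤ.+ a ℤ.- b , b ℤ.- a

φ²φ⁻² : ∀ x → φ· φ· φ⁻²· x ≡ x
φ²φ⁻² (a , b) = cong₂ _,_ (lemma₁ a b) (lemma₂ a b)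
  where
  lemma₁ : ∀ a b → a ℤ.+ a ℤ.- b ℤ.+ (b ℤ.- a) ≡ a
  lemma₁ = solve-∀
  lemma₂ : ∀ a b → b ℤ.- a ℤ.+ (a ℤ.+ a ℤ.- b ℤ.+ (b ℤ.- a)) ≡ b
  lemma₂ = solve-∀

φ⁻²-⊝ : ∀ x y → φ⁻²· (x ⊝ y) ≡ φ⁻²· x ⊝ φ⁻²· y
φ⁻²-⊝ (a , b) (c , d) = cong₂ _,_ (lemma₁ a b c d) (lemma₂ a b c d)
  where
  lemma₁ : ∀ a b c d → a ℤ.- c ℤ.+ (a ℤ.- c) ℤ.- (b ℤ.- d) ≡ (a ℤ.+ a ℤ.- b) ℤ.- (c ℤ.+ c ℤ.- d)
  lemma₁ = solve-∀
  lemma₂ : ∀ a b c d → b ℤ.- d ℤ.- (a ℤ.- c) ≡ (b ℤ.- a) ℤ.- (d ℤ.- c)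
  lemma₂ = solve-∀

pos-φ⁻² : Pos ξ → Pos (φ⁻²· ξ)
pos-φ⁻² {x} p = pos-φ⁻ (pos-φ⁻ (subst Pos (sym (φ²φ⁻² x)) p))

nonNeg-φ⁻² : NonNeg ξ → NonNeg (φ⁻²· ξ)
nonNeg-φ⁻² {x} p = nonNeg-φ⁻ (nonNeg-φ⁻ (subst NonNeg (sym (φ²φ⁻² x)) p))

φ⁻¹·_ : ℤ[φ] → ℤ[φ]
φ⁻¹· (a , b) = b ℤ.- a , a

φφ⁻¹ : ∀ x → φ· φ⁻¹· x ≡ x
φφ⁻¹ (a , b) = cong (a ,_) (lemma a b)
  where
  lemma : ∀ a b → b ℤ.- a ℤ.+ a ≡ b
  lemma = solve-∀

pos-φ⁻¹ : Pos ξ → Pos (φ⁻¹· ξ)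
pos-φ⁻¹ {x} p = pos-φ⁻ (subst Pos (sym (φφ⁻¹ x)) p)

nonNeg-φ⁻¹ : NonNeg ξ → NonNeg (φ⁻¹· ξ)
nonNeg-φ⁻¹ {x} p = nonNeg-φ⁻ (subst NonNeg (sym (φφ⁻¹ x)) p)

In-φ⁻² : In lo hi ξ → In (φ⁻²· lo) (φ⁻²· hi) (φ⁻²· ξ)
In-φ⁻² {lo} {hi} {x} (within p q) = within
  (subst Pos (φ⁻²-⊝ x lo) (pos-φ⁻² p)) (subst NonNeg (φ⁻²-⊝ hi x) (nonNeg-φ⁻² q))

φ-⊝ : ∀ x y → φ· (x ⊝ y) ≡ φ· x ⊝ φ· y
φ-⊝ (a , b) (c , d) = cong (b ℤ.- d ,_) (lemma a b c d)
  where
  lemma : ∀ a b c d → a ℤ.- c ℤ.+ (b ℤ.- d) ≡ (a ℤ.+ b) ℤ.- (c ℤ.+ d)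
  lemma = solve-∀

In-φ : In lo hi ξ → In (φ· lo) (φ· hi) (φ· ξ)
In-φ {lo} {hi} {x} (within p q) = within
  (subst Pos (φ-⊝ x lo) (pos-φ⁺ p)) (subst NonNeg (φ-⊝ hi x) (nonNeg-φ⁺ q))

-- This says θ(B(i)) = φ⁻²θ(i) for i ≥ 1: scaling takes (0, 1] to (0, φ⁻²], which is why that
-- interval describes B.
φ⁻²-floor : ∀ i → φ⁻²· (ℤ.- + ⌊φ i ⌋ , + i) ≡ (ℤ.- + (⌊φ i ⌋ ℕ.+ ⌊φ² i ⌋) , + ⌊φ² i ⌋)
φ⁻²-floor i = cong₂ _,_ (lemma₁ (+ ⌊φ i ⌋) (+ i)) (lemma₂ (+ ⌊φ i ⌋) (+ i))
  where
  lemma₁ : ∀ a i → ℤ.- a ℤ.+ ℤ.- a ℤ.- i ≡ ℤ.- (a ℤ.+ (a ℤ.+ i))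
  lemma₁ = solve-∀
  lemma₂ : ∀ a i → i ℤ.- ℤ.- a ≡ a ℤ.+ i
  lemma₂ = solve-∀

inB-In : ∀ i → 1 ℕ.≤ i → In c₀ c₃₈₂ (ℤ.- + (⌊φ i ⌋ ℕ.+ ⌊φ² i ⌋) , + ⌊φ² i ⌋)
inB-In i 1≤i = subst (In c₀ c₃₈₂) (φ⁻²-floor i) (In-φ⁻² (floor-In i 1≤i))

inB⇒ : ∀ {d} → Range⁺ ⌊φ²_⌋ d → 1 ℕ.≤ d × FracB d
inB⇒ (i , 1≤i , refl) = ℕ.≤-trans 1≤i (ℕ.m≤n+m i ⌊φ i ⌋) , _ , inB-In i 1≤i

φ⁻²φ² : ∀ x → φ⁻²· φ· φ· x ≡ x
φ⁻²φ² (a , b) = cong₂ _,_ (lemma₁ a b) (lemma₂ a b)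
  where
  lemma₁ : ∀ a b → a ℤ.+ b ℤ.+ (a ℤ.+ b) ℤ.- (b ℤ.+ (a ℤ.+ b)) ≡ a
  lemma₁ = solve-∀
  lemma₂ : ∀ a b → b ℤ.+ (a ℤ.+ b) ℤ.- (a ℤ.+ b) ≡ b
  lemma₂ = solve-∀

-- φ²x for x = a + dφ > 0 has the φ-coordinate a + 2d > d(2 - φ).
φ²-index : ∀ {a d} → Pos ((a , + d) ⊝ c₀) → ∃[ i ] (1 ℕ.≤ i × φ· φ· (a , + d) ≡ (a ℤ.+ + d , + i))
φ²-index {a} {d} p = index (d′ ℤ.+ (a ℤ.+ d′)) refl (pos-integer positive)
  where
  d′ = + d
  lemma₁ : ∀ a d → a ℤ.- + 0 ℤ.+ (d ℤ.+ d) ≡ d ℤ.+ (a ℤ.+ d)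
  lemma₁ = solve-∀
  lemma₂ : ∀ d → d ℤ.- + 0 ℤ.+ ℤ.- d ≡ + 0
  lemma₂ = solve-∀
  lemma₃ : ∀ d → d ≡ d ℤ.+ d ℤ.+ ℤ.- d
  lemma₃ = solve-∀
  lemma₄ : ∀ d → + 0 ≡ ℤ.- d ℤ.+ (d ℤ.+ d ℤ.+ ℤ.- d)
  lemma₄ = solve-∀
  positive : Pos (d′ ℤ.+ (a ℤ.+ d′) , + 0)
  positive = subst Pos (cong₂ _,_ (lemma₁ a d′) (lemma₂ d′)) (pos-⊕ p
    (nonNegBy 2 {d′ ℤ.+ d′ , ℤ.- d′} (subst (+ 0 ℤ.≤_) (lemma₃ d′) (ℤ.+≤+ ℕ.z≤n)) (subst (+ 0 ℤ.≤_) (lemma₄ d′) ℤ.≤-refl)))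
  index : ∀ i → i ≡ d′ ℤ.+ (a ℤ.+ d′) → + 1 ℤ.≤ i → ∃[ j ] (1 ℕ.≤ j × φ· φ· (a , + d) ≡ (a ℤ.+ + d , + j))
  index (+ suc i) e _ = suc i , ℕ.s≤s ℕ.z≤n , cong (a ℤ.+ + d ,_) (sym e)
  index (+ zero) _ (ℤ.+≤+ ())

inB-index : ∀ {a d} → In c₀ c₃₈₂ (a , + d) → ∃[ i ] (1 ℕ.≤ i × (a , + d) ≡ φ⁻²· (ℤ.- + ⌊φ i ⌋ , + i))
inB-index {a} {d} p = index (φ²-index {a} {d} (lower p))
  where
  lemma₁ : ∀ a d → a ℤ.+ d ℤ.- + 0 ≡ ℤ.- (ℤ.- (a ℤ.+ d))
  lemma₁ = solve-∀
  A-value : ∀ {i} → 1 ℕ.≤ i → In c₀ c₁ (a ℤ.+ + d , + i) → + ⌊φ i ⌋ ≡ ℤ.- (a ℤ.+ + d)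
  A-value {i} 1≤i q = floor-unique i 1≤i
    (subst NonNeg (cong₂ _,_ (lemma₁ a (+ d)) (ℤ.+-identityʳ (+ i))) (pos⇒nonNeg (lower q)))
    (subst NonNeg (cong (+ 1 ℤ.- (a ℤ.+ + d) ,_) (ℤ.+-identityˡ (ℤ.- + i))) (upper q))
  index : ∃[ i ] (1 ℕ.≤ i × φ· φ· (a , + d) ≡ (a ℤ.+ + d , + i)) → ∃[ i ] (1 ℕ.≤ i × (a , + d) ≡ φ⁻²· (ℤ.- + ⌊φ i ⌋ , + i))
  index (i , 1≤i , e) = i , 1≤i ,
    trans (sym (φ⁻²φ² (a , + d))) (cong φ⁻²·_ (trans e (cong (_, + i) (trans (sym (ℤ.neg-involutive (a ℤ.+ + d)))
      (cong ℤ.-_ (sym (A-value 1≤i (subst (In c₀ c₁) e (In-φ (In-φ p))))))))))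

⇒inB : ∀ {d} → FracB d → Range⁺ ⌊φ²_⌋ d
⇒inB (_ , p) = let i , 1≤i , e = inB-index p in i , 1≤i , sym (ℤ.+-injective (cong proj₂ (trans e (φ⁻²-floor i))))

-- The identity AB(n) = A(n) + B(n), read off from the integer coordinate of the point in `inB-In`.
⌊φ⌊φ²⌋⌋ : ∀ n → 1 ℕ.≤ n → ⌊φ ⌊φ² n ⌋ ⌋ ≡ ⌊φ n ⌋ ℕ.+ ⌊φ² n ⌋
⌊φ⌊φ²⌋⌋ n 1≤n = ℤ.+-injective (floor-unique (⌊φ² n ⌋) (proj₁ (inB⇒ (n , 1≤n , refl)))
  (subst NonNeg (cong₂ _,_ (ℤ.+-identityʳ (ℤ.- + (⌊φ n ⌋ ℕ.+ ⌊φ² n ⌋))) (ℤ.+-identityʳ (+ ⌊φ² n ⌋))) (pos⇒nonNeg (lower p)))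
  (subst NonNeg (cong₂ _,_ (lemma (+ (⌊φ n ⌋ ℕ.+ ⌊φ² n ⌋))) (ℤ.+-identityˡ (ℤ.- + ⌊φ² n ⌋)))
    (upper (In-widen {lo₁ = c₀} {hi₁ = c₁} nonNeg! nonNeg! p))))
  where
  p = inB-In n 1≤n
  lemma : ∀ q → + 1 ℤ.- (ℤ.- q) ≡ + 1 ℤ.+ q
  lemma = solve-∀

classOne-1 : ClassOne 1
classOne-1 = -[1+ 0 ] , within pos! nonNeg!

-- For n ≥ 1 the coordinate `d₁` expresses θ(AB(n)) = 1 - φ⁻³θ(n), which exceeds 1 - φ⁻³ = 4 - 2φ;
-- one more counter shifts θ by φ - 2. For n = 0 the heap is 1.
inAB₀^⇒ : ∀ {h} → (∃[ n ] ⌊φ ⌊φ² n ⌋ ⌋ ℕ.+ 1 ≡ h) → ClassOne h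
inAB₀^⇒ (zero , refl) = subst (λ z → ClassOne (z ℕ.+ 1)) (sym (trans (cong (λ z → ⌊φ z ℕ.+ 0 ⌋) ⌊φ0⌋) ⌊φ0⌋)) classOne-1
inAB₀^⇒ (n@(suc _) , refl) = d₁ ℤ.+ -[1+ 1 ] , subst (λ z → In c₃₈₂ c₆₁₈ (d₁ ℤ.+ -[1+ 1 ] , + (z ℕ.+ 1)))
  (sym (⌊φ⌊φ²⌋⌋ n (ℕ.s≤s ℕ.z≤n)))
  (In-shift (-[1+ 1 ] , + 1) (within {lo = c₇₆₄} {c₁} {d₁ , + (⌊φ n ⌋ ℕ.+ (⌊φ n ⌋ ℕ.+ n))}
    (subst Pos (cong₂ _,_ (lemma₁ (+ ⌊φ n ⌋) (+ n)) (lemma₂ (+ ⌊φ n ⌋) (+ n))) (pos-φ⁻¹ (pos-φ⁻² (⌊φ⌋-upper n))))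
    (subst NonNeg (cong₂ _,_ (lemma₃ (+ ⌊φ n ⌋) (+ n)) (lemma₄ (+ ⌊φ n ⌋) (+ n))) (nonNeg-φ⁻¹ (nonNeg-φ⁻² (pos⇒nonNeg (⌊φ⌋-lower n (ℕ.s≤s ℕ.z≤n))))))))
  where
  d₁ : ℤ
  d₁ = + 1 ℤ.- (+ ⌊φ n ⌋ ℤ.+ + n) ℤ.- (+ ⌊φ n ⌋ ℤ.+ (+ ⌊φ n ⌋ ℤ.+ + n))
  lemma₁ : ∀ u n → ℤ.- n ℤ.- (+ 1 ℤ.+ u) ℤ.- (+ 1 ℤ.+ u ℤ.+ (+ 1 ℤ.+ u) ℤ.- ℤ.- n) ≡ + 1 ℤ.- (u ℤ.+ n) ℤ.- (u ℤ.+ (u ℤ.+ n)) ℤ.- + 4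
  lemma₁ = solve-∀
  lemma₂ : ∀ u n → + 1 ℤ.+ u ℤ.+ (+ 1 ℤ.+ u) ℤ.- ℤ.- n ≡ u ℤ.+ (u ℤ.+ n) ℤ.- -[1+ 1 ]
  lemma₂ = solve-∀
  lemma₃ : ∀ u n → n ℤ.- ℤ.- u ℤ.- (ℤ.- u ℤ.+ ℤ.- u ℤ.- n) ≡ + 1 ℤ.- (+ 1 ℤ.- (u ℤ.+ n) ℤ.- (u ℤ.+ (u ℤ.+ n)))
  lemma₃ = solve-∀
  lemma₄ : ∀ u n → ℤ.- u ℤ.+ ℤ.- u ℤ.- n ≡ + 0 ℤ.- (u ℤ.+ (u ℤ.+ n))
  lemma₄ = solve-∀

-- θ(B(B(n))) = φ⁻⁴θ(n), and one more counter adds φ⁻¹; the upper end is φ⁻¹ + φ⁻⁴ = 4 - 2φ.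
inB²^⇒ : ∀ {h} → Range⁺ (λ n → ⌊φ² ⌊φ² n ⌋ ⌋ ℕ.+ 1) h → ClassNum h
inB²^⇒ (n , 1≤n , refl) = _ , In-shift c₆₁₈ (subst (In c₀ c₁₄₆) eq (In-φ⁻² (inB-In n 1≤n)))
  where
  eq : φ⁻²· (ℤ.- + (⌊φ n ⌋ ℕ.+ ⌊φ² n ⌋) , + ⌊φ² n ⌋) ≡ (ℤ.- + (⌊φ ⌊φ² n ⌋ ⌋ ℕ.+ ⌊φ² ⌊φ² n ⌋ ⌋) , + ⌊φ² ⌊φ² n ⌋ ⌋)
  eq = trans (cong (λ z → φ⁻²· (ℤ.- + z , + ⌊φ² n ⌋)) (sym (⌊φ⌊φ²⌋⌋ n 1≤n))) (φ⁻²-floor (⌊φ² n ⌋))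

-- As θ(d) = 1 - θ(i)/φ, the bound θ(d) > 1 - φ⁻³ amounts to θ(i) < φ⁻².
A-fracB : ∀ {a i d} → 1 ℕ.≤ i → ⌊φ i ⌋ ≡ d → In c₇₆₄ c₁ (a , + d) → + i ≡ + 1 ℤ.- a ℤ.- + d → FracB i
A-fracB {a} {i} {d} 1≤i A≡d p e = ℤ.- + d , within
  (subst Pos (cong₂ _,_ (trans (cong (λ z → ℤ.- + z) A≡d) (sym (ℤ.+-identityʳ (ℤ.- + d)))) (sym (ℤ.+-identityʳ (+ i)))) (⌊φ⌋-lower i 1≤i))
  (subst NonNeg (cong₂ _,_ (lemma₁ (+ d)) (trans (lemma₂ a (+ d)) (cong (λ z → -[1+ 0 ] ℤ.- z) (sym e)))) (nonNeg-φ⁺ (pos⇒nonNeg (lower p))))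
  where
  lemma₁ : ∀ d → d ℤ.- -[1+ 1 ] ≡ + 2 ℤ.- (ℤ.- d)
  lemma₁ = solve-∀
  lemma₂ : ∀ a d → a ℤ.- + 4 ℤ.+ (d ℤ.- -[1+ 1 ]) ≡ -[1+ 0 ] ℤ.- (+ 1 ℤ.- a ℤ.- d)
  lemma₂ = solve-∀

⇒inAB₀ : ∀ {h} → ClassAB₀ h → ∃[ n ] ⌊φ ⌊φ² n ⌋ ⌋ ≡ h
⇒inAB₀ {zero} _ = 0 , trans (cong (λ z → ⌊φ z ℕ.+ 0 ⌋) ⌊φ0⌋) ⌊φ0⌋
⇒inAB₀ {suc h} (a , p) =
  let i , 1≤i , A≡h , e = inA-index (ℕ.s≤s ℕ.z≤n) (In-widen {lo₁ = c₃₈₂} {hi₁ = c₁} nonNeg! nonNeg! p)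
      n , _ , B≡i = ⇒inB (A-fracB 1≤i A≡h p e)
  in n , trans (cong ⌊φ_⌋ B≡i) A≡h

-- Fibonacci numbers as best approximations

-- fo n = F(2n+1) and fe n = F(2n+2).
fo fe : ℕ → ℕ
fo zero    = 1
fo (suc n) = fo n ℕ.+ fe n
fe zero    = 1
fe (suc n) = fo (suc n) ℕ.+ fe n

F-fo-fe : ∀ n → F (suc (n ℕ.* 2)) ≡ fo n × F (suc (suc (n ℕ.* 2))) ≡ fe n
F-fo-fe zero    = refl , refl
F-fo-fe (suc n) = let p , q = F-fo-fe n
                      r = trans (cong₂ ℕ._+_ q p) (ℕ.+-comm (fe n) (fo n))
                  in r , cong₂ ℕ._+_ r q

F-2n+1 : ∀ n → F (2 ℕ.* n ℕ.+ 1) ≡ fo n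
F-2n+1 n = trans (cong F (lemma n)) (proj₁ (F-fo-fe n))
  where
  lemma : ∀ n → 2 ℕ.* n ℕ.+ 1 ≡ 1 ℕ.+ n ℕ.* 2
  lemma = ℕ-Ring.solve-∀

F-2n+2 : ∀ n → F (2 ℕ.* n ℕ.+ 2) ≡ fe n
F-2n+2 n = trans (cong F (lemma n)) (proj₂ (F-fo-fe n))
  where
  lemma : ∀ n → 2 ℕ.* n ℕ.+ 2 ≡ 2 ℕ.+ n ℕ.* 2
  lemma = ℕ-Ring.solve-∀

F-2n+3 : ∀ n → F (2 ℕ.* n ℕ.+ 3) ≡ fo (suc n)
F-2n+3 n = trans (cong F (lemma n)) (proj₁ (F-fo-fe (suc n)))
  where
  lemma : ∀ n → 2 ℕ.* n ℕ.+ 3 ≡ 3 ℕ.+ n ℕ.* 2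
  lemma = ℕ-Ring.solve-∀

F-2n+4 : ∀ n → F (2 ℕ.* n ℕ.+ 4) ≡ fe (suc n)
F-2n+4 n = trans (cong F (lemma n)) (proj₂ (F-fo-fe (suc n)))
  where
  lemma : ∀ n → 2 ℕ.* n ℕ.+ 4 ≡ 4 ℕ.+ n ℕ.* 2
  lemma = ℕ-Ring.solve-∀

fo-pos : ∀ n → 1 ℕ.≤ fo n
fo-pos zero    = ℕ.≤-refl
fo-pos (suc n) = ℕ.≤-trans (fo-pos n) (ℕ.m≤m+n _ _)

fe-pos : ∀ n → 1 ℕ.≤ fe n
fe-pos zero    = ℕ.≤-refl
fe-pos (suc n) = ℕ.≤-trans (fe-pos n) (ℕ.m≤n+m _ _)

fo-suc-≥2 : ∀ n → 2 ℕ.≤ fo (suc n)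
fo-suc-≥2 n = ℕ.+-mono-≤ (fo-pos n) (fe-pos n)

fe-suc-≥2 : ∀ n → 2 ℕ.≤ fe (suc n)
fe-suc-≥2 n = ℕ.≤-trans (fo-suc-≥2 n) (ℕ.m≤m+n _ _)

fo-mono : ∀ {m n} → m ℕ.≤ n → fo m ℕ.≤ fo n
fo-mono {m} {n} m≤n = go (ℕ.≤⇒≤′ m≤n)
  where
  go : ∀ {n} → m ℕ.≤′ n → fo m ℕ.≤ fo n
  go (ℕ.≤′-reflexive refl) = ℕ.≤-refl
  go (ℕ.≤′-step p) = ℕ.≤-trans (go p) (ℕ.m≤m+n _ _)

fo-cancel-< : ∀ {m n} → fo m ℕ.< fo n → m ℕ.< n
fo-cancel-< p = ℕ.≰⇒> (λ n≤m → ℕ.<⇒≱ p (fo-mono n≤m))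

fe-mono : ∀ {m n} → m ℕ.≤ n → fe m ℕ.≤ fe n
fe-mono {m} {n} m≤n = go (ℕ.≤⇒≤′ m≤n)
  where
  go : ∀ {n} → m ℕ.≤′ n → fe m ℕ.≤ fe n
  go (ℕ.≤′-reflexive refl) = ℕ.≤-refl
  go (ℕ.≤′-step p) = ℕ.≤-trans (go p) (ℕ.m≤n+m _ _)

fe-cancel-< : ∀ {m n} → fe m ℕ.< fe n → m ℕ.< n
fe-cancel-< p = ℕ.≰⇒> (λ n≤m → ℕ.<⇒≱ p (fe-mono n≤m))

-- shrink n x = φ⁻²ⁿx
shrink : ℕ → ℤ[φ] → ℤ[φ]
shrink zero    x = x
shrink (suc n) x = φ⁻²· (shrink n x)

pos-shrink : ∀ n → Pos ξ → Pos (shrink n ξ)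
pos-shrink zero    p = p
pos-shrink (suc n) p = pos-φ⁻² (pos-shrink n p)

nonNeg-shrink : ∀ n → NonNeg ξ → NonNeg (shrink n ξ)
nonNeg-shrink zero    p = p
nonNeg-shrink (suc n) p = nonNeg-φ⁻² (nonNeg-shrink n p)

In-shrink : ∀ n → In lo hi ξ → In (shrink n lo) (shrink n hi) (shrink n ξ)
In-shrink zero    p = p
In-shrink (suc n) p = In-φ⁻² (In-shrink n p)

shrink-⊝ : ∀ n x y → shrink n (x ⊝ y) ≡ shrink n x ⊝ shrink n y
shrink-⊝ zero    x y = refl
shrink-⊝ (suc n) x y = trans (cong φ⁻²·_ (shrink-⊝ n x y)) (φ⁻²-⊝ (shrink n x) (shrink n y))

shrink-φ⁻² : ∀ n x → shrink n (φ⁻²· x) ≡ shrink (suc n) x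
shrink-φ⁻² zero    x = refl
shrink-φ⁻² (suc n) x = cong φ⁻²·_ (shrink-φ⁻² n x)

shrink-c₀ : ∀ n → shrink n c₀ ≡ c₀
shrink-c₀ zero    = refl
shrink-c₀ (suc n) = cong φ⁻²·_ (shrink-c₀ n)

nonNeg-c₀ : ∀ x → NonNeg (x ⊝ x)
nonNeg-c₀ (a , b) = subst NonNeg (cong₂ _,_ (sym (ℤ.+-inverseʳ a)) (sym (ℤ.+-inverseʳ b))) nonNeg!

shrink-decreasing : ∀ {x} → NonNeg x → ∀ {m n} → m ℕ.≤ n → NonNeg (shrink m x ⊝ shrink n x)
shrink-decreasing {x} p {m} m≤n = go (ℕ.≤⇒≤′ m≤n)
  where
  step : ∀ y → φ⁻¹· y ≡ y ⊝ φ⁻²· y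
  step (a , b) = cong₂ _,_ (lemma₁ a b) (lemma₂ a b)
    where
    lemma₁ : ∀ a b → b ℤ.- a ≡ a ℤ.- (a ℤ.+ a ℤ.- b)
    lemma₁ = solve-∀
    lemma₂ : ∀ a b → a ≡ b ℤ.- (b ℤ.- a)
    lemma₂ = solve-∀
  go : ∀ {n} → m ℕ.≤′ n → NonNeg (shrink m x ⊝ shrink n x)
  go (ℕ.≤′-reflexive refl) = nonNeg-c₀ (shrink m x)
  go (ℕ.≤′-step {n} q) = subst NonNeg (⊝-⊕-⊝ (shrink m x) (shrink n x) (shrink (suc n) x))
    (nonNeg-⊕ (go q) (subst NonNeg (step (shrink n x)) (nonNeg-φ⁻¹ (nonNeg-shrink n p))))

shrink-coords : ∀ m a b → shrink (suc m) (a , b) ≡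
  (a ℤ.* + fo (suc m) ℤ.- b ℤ.* + fe m , b ℤ.* + fo m ℤ.- a ℤ.* + fe m)
shrink-coords zero a b = cong₂ _,_ (lemma₁ a b) (lemma₂ a b)
  where
  lemma₁ : ∀ a b → a ℤ.+ a ℤ.- b ≡ a ℤ.* + 2 ℤ.- b ℤ.* + 1
  lemma₁ = solve-∀
  lemma₂ : ∀ a b → b ℤ.- a ≡ b ℤ.* + 1 ℤ.- a ℤ.* + 1
  lemma₂ = solve-∀
shrink-coords (suc m) a b = trans (cong φ⁻²·_ (shrink-coords m a b))
  (cong₂ _,_ (lemma₁ a b (+ fo m) (+ fe m)) (lemma₂ a b (+ fo m) (+ fe m)))
  where
  lemma₁ : ∀ a b o e → (a ℤ.* (o ℤ.+ e) ℤ.- b ℤ.* e) ℤ.+ (a ℤ.* (o ℤ.+ e) ℤ.- b ℤ.* e) ℤ.- (b ℤ.* o ℤ.- a ℤ.* e)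
    ≡ a ℤ.* (o ℤ.+ e ℤ.+ (o ℤ.+ e ℤ.+ e)) ℤ.- b ℤ.* (o ℤ.+ e ℤ.+ e)
  lemma₁ = solve-∀
  lemma₂ : ∀ a b o e → (b ℤ.* o ℤ.- a ℤ.* e) ℤ.- (a ℤ.* (o ℤ.+ e) ℤ.- b ℤ.* e)
    ≡ b ℤ.* (o ℤ.+ e) ℤ.- a ℤ.* (o ℤ.+ e ℤ.+ e)
  lemma₂ = solve-∀

-- The approximation errors in closed form: F(2n+1)φ exceeds F(2n+2) by φ⁻²ⁿ⁻¹, and by `fe-point`
-- F(2n+2)φ falls short of F(2n+3) by φ⁻²ⁿ⁻².
fo-point : ∀ n → shrink n c₆₁₈ ≡ (ℤ.- + fe n , + fo n)
fo-point zero    = refl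
fo-point (suc n) = trans (cong φ⁻²·_ (fo-point n)) (cong₂ _,_ (lemma₁ (+ fo n) (+ fe n)) (lemma₂ (+ fo n) (+ fe n)))
  where
  lemma₁ : ∀ o e → ℤ.- e ℤ.+ ℤ.- e ℤ.- o ≡ ℤ.- (o ℤ.+ e ℤ.+ e)
  lemma₁ = solve-∀
  lemma₂ : ∀ o e → o ℤ.- ℤ.- e ≡ o ℤ.+ e
  lemma₂ = solve-∀

fe-point : ∀ n → c₀ ⊝ shrink (suc n) c₁ ≡ (ℤ.- + fo (suc n) , + fe n)
fe-point n = trans (cong (c₀ ⊝_) (shrink-coords n (+ 1) (+ 0))) (cong₂ _,_ (lemma₁ (+ fo (suc n)) (+ fe n)) (lemma₂ (+ fo n) (+ fe n)))
  where
  lemma₁ : ∀ o e → + 0 ℤ.- (+ 1 ℤ.* o ℤ.- + 0 ℤ.* e) ≡ ℤ.- o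
  lemma₁ = solve-∀
  lemma₂ : ∀ o e → + 0 ℤ.- (+ 0 ℤ.* o ℤ.- + 1 ℤ.* e) ≡ e
  lemma₂ = solve-∀

φ²-shrink-⊝ : ∀ n x → φ· φ· (shrink (suc n) c₁ ⊝ x) ≡ shrink n c₁ ⊝ φ· φ· x
φ²-shrink-⊝ n x = trans (cong φ·_ (φ-⊝ (shrink (suc n) c₁) x)) (trans (φ-⊝ (φ· shrink (suc n) c₁) (φ· x))
  (cong (_⊝ φ· φ· x) (φ²φ⁻² (shrink n c₁))))

-- A point (d , p) below the line p = φd and closer to it than φ⁻²ⁿ has
-- d ≥ F(2n+1): multiplication by φ² keeps it below and at positive d.
approx-below : ∀ n {a d} → + 1 ℤ.≤ d → Pos (a , d) → Pos (shrink n c₁ ⊝ (a , d)) → + fo n ℤ.≤ d × + fe n ℤ.≤ ℤ.- a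
approx-below zero {a} {d} 1≤d _ close = 1≤d , pos-integer
  (subst Pos (cong₂ _,_ (lemma₁ a) (lemma₂ d)) (pos-⊕ close (nonNegBy 1 { -[1+ 0 ] , d} (ℤ.≤-trans (ℤ.+≤+ ℕ.z≤n) 1≤d)
    (subst (+ 0 ℤ.≤_) (ℤ.+-comm d -[1+ 0 ]) (ℤ.i≤j⇒0≤j-i 1≤d)))))
  where
  lemma₁ : ∀ a → + 1 ℤ.- a ℤ.+ -[1+ 0 ] ≡ ℤ.- a
  lemma₁ = solve-∀
  lemma₂ : ∀ d → + 0 ℤ.- d ℤ.+ d ≡ + 0
  lemma₂ = solve-∀
approx-below (suc n) {a} {d} 1≤d p close = step (approx-below n
  (pos-integer (subst Pos (cong₂ _,_ (lemma₁ a d) (lemma₂ d)) (pos-⊕ p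
    (nonNegBy 2 {d ℤ.+ d , ℤ.- d} (subst (+ 0 ℤ.≤_) (lemma₃ d) (ℤ.≤-trans (ℤ.+≤+ ℕ.z≤n) 1≤d)) (subst (+ 0 ℤ.≤_) (lemma₄ d) ℤ.≤-refl)))))
  (pos-φ⁺ (pos-φ⁺ p)) (subst Pos (φ²-shrink-⊝ n (a , d)) (pos-φ⁺ (pos-φ⁺ close))))
  where
  lemma₁ : ∀ a d → a ℤ.+ (d ℤ.+ d) ≡ d ℤ.+ (a ℤ.+ d)
  lemma₁ = solve-∀
  lemma₂ : ∀ d → d ℤ.+ ℤ.- d ≡ + 0
  lemma₂ = solve-∀
  lemma₃ : ∀ d → d ≡ d ℤ.+ d ℤ.+ ℤ.- d
  lemma₃ = solve-∀
  lemma₄ : ∀ d → + 0 ≡ ℤ.- d ℤ.+ (d ℤ.+ d ℤ.+ ℤ.- d)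
  lemma₄ = solve-∀
  lemma₅ : ∀ a d → d ℤ.+ (a ℤ.+ d) ℤ.+ ℤ.- (a ℤ.+ d) ≡ d
  lemma₅ = solve-∀
  lemma₆ : ∀ a d → d ℤ.+ ℤ.- (a ℤ.+ d) ≡ ℤ.- a
  lemma₆ = solve-∀
  step : + fo n ℤ.≤ d ℤ.+ (a ℤ.+ d) × + fe n ℤ.≤ ℤ.- (a ℤ.+ d) → + fo (suc n) ℤ.≤ d × + fe (suc n) ℤ.≤ ℤ.- a
  step (f , g) = first , subst (+ fe (suc n) ℤ.≤_) (lemma₆ a d) (ℤ.+-mono-≤ first g)
    where
    first : + fo (suc n) ℤ.≤ d
    first = subst (+ fo (suc n) ℤ.≤_) (lemma₅ a d) (ℤ.+-mono-≤ f g)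

φ²-shrink-⊕ : ∀ n x → φ· φ· (shrink (suc n) c₁ ⊕ x) ≡ shrink n c₁ ⊕ φ· φ· x
φ²-shrink-⊕ n x = trans (cong φ·_ (φ-⊕ (shrink (suc n) c₁) x)) (trans (φ-⊕ (φ· shrink (suc n) c₁) (φ· x))
  (cong (_⊕ φ· φ· x) (φ²φ⁻² (shrink n c₁))))
  where
  φ-⊕ : ∀ x y → φ· (x ⊕ y) ≡ φ· x ⊕ φ· y
  φ-⊕ (a , b) (c , d) = cong (b ℤ.+ d ,_) (lemma a b c d)
    where
    lemma : ∀ a b c d → a ℤ.+ c ℤ.+ (b ℤ.+ d) ≡ (a ℤ.+ b) ℤ.+ (c ℤ.+ d)
    lemma = solve-∀

-- The mirror image of `approx-below`. The new φ-coordinate a + 2t = (a + tφ) + tφ⁻² stays positive,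
-- because here a + tφ > -φ⁻² and t ≥ 1.
approx-above : ∀ n {a t} → + 1 ℤ.≤ t → NonNeg (c₀ ⊝ (a , t)) → Pos (shrink n c₁ ⊕ (a , t)) → + fe n ℤ.≤ t × + fo (suc n) ℤ.≤ ℤ.- a
approx-above zero {a} {t} 1≤t p _ = 1≤t , 2≤ (pos-integer
  (subst Pos (cong₂ _,_ (lemma₁ a) (lemma₂ t)) (⊕-pos p (posBy 1 { -[1+ 0 ] , t} 1≤t
    (subst (+ 0 ℤ.≤_) (ℤ.+-comm t -[1+ 0 ]) (ℤ.i≤j⇒0≤j-i 1≤t))))))
  where
  lemma₁ : ∀ a → + 0 ℤ.- a ℤ.+ -[1+ 0 ] ≡ ℤ.- a ℤ.- + 1
  lemma₁ = solve-∀
  lemma₂ : ∀ t → + 0 ℤ.- t ℤ.+ t ≡ + 0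
  lemma₂ = solve-∀
  lemma₃ : ∀ b → b ℤ.- + 1 ℤ.+ + 1 ≡ b
  lemma₃ = solve-∀
  2≤ : ∀ {b} → + 1 ℤ.≤ b ℤ.- + 1 → + 2 ℤ.≤ b
  2≤ {b} q = subst (+ 2 ℤ.≤_) (lemma₃ b) (ℤ.+-monoˡ-≤ (+ 1) q)
approx-above (suc n) {a} {t} 1≤t p close = step (approx-above n
  (pos-integer (subst Pos (cong₂ _,_ (lemma₁ (proj₁ ψ) a t) (lemma₂ (proj₂ ψ) t))
    (pos-⊕ (pos-⊕ close (shrink-decreasing {c₁} nonNeg! (ℕ.s≤s (ℕ.z≤n {n})))) u-nonNeg)))
  (subst NonNeg (trans (cong φ·_ (φ-⊝ c₀ (a , t))) (φ-⊝ (φ· c₀) (φ· (a , t)))) (nonNeg-φ⁺ (nonNeg-φ⁺ p)))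
  (subst Pos (φ²-shrink-⊕ n (a , t)) (pos-φ⁺ (pos-φ⁺ close))))
  where
  ψ : ℤ[φ]
  ψ = shrink (suc n) c₁
  u : ℤ
  u = t ℤ.- + 1
  lemma₃ : ∀ u → u ≡ u ℤ.+ u ℤ.+ ℤ.- u
  lemma₃ = solve-∀
  lemma₄ : ∀ u → + 0 ≡ ℤ.- u ℤ.+ (u ℤ.+ u ℤ.+ ℤ.- u)
  lemma₄ = solve-∀
  u-nonNeg : NonNeg (u ℤ.+ u , ℤ.- u)
  u-nonNeg = nonNegBy 2 (subst (+ 0 ℤ.≤_) (lemma₃ u) (ℤ.i≤j⇒0≤j-i 1≤t)) (subst (+ 0 ℤ.≤_) (lemma₄ u) ℤ.≤-refl)
  lemma₁ : ∀ z a t → z ℤ.+ a ℤ.+ (+ 2 ℤ.- z) ℤ.+ ((t ℤ.- + 1) ℤ.+ (t ℤ.- + 1)) ≡ t ℤ.+ (a ℤ.+ t)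
  lemma₁ = solve-∀
  lemma₂ : ∀ z t → z ℤ.+ t ℤ.+ (-[1+ 0 ] ℤ.- z) ℤ.+ ℤ.- (t ℤ.- + 1) ≡ + 0
  lemma₂ = solve-∀
  lemma₅ : ∀ a d → d ℤ.+ (a ℤ.+ d) ℤ.+ ℤ.- (a ℤ.+ d) ≡ d
  lemma₅ = solve-∀
  lemma₆ : ∀ a d → ℤ.- (a ℤ.+ d) ℤ.+ d ≡ ℤ.- a
  lemma₆ = solve-∀
  step : + fe n ℤ.≤ t ℤ.+ (a ℤ.+ t) × + fo (suc n) ℤ.≤ ℤ.- (a ℤ.+ t) → + fe (suc n) ℤ.≤ t × + fo (suc (suc n)) ℤ.≤ ℤ.- a
  step (f , g) = first , subst (+ fo (suc (suc n)) ℤ.≤_) (lemma₆ a t) (ℤ.+-mono-≤ g first)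
    where
    first : + fe (suc n) ℤ.≤ t
    first = subst₂ ℤ._≤_ (cong +_ (ℕ.+-comm (fe n) (fo (suc n)))) (lemma₅ a t) (ℤ.+-mono-≤ f g)

-- Moves between the classes of heaps

⊝-c₀ : ∀ x → x ⊝ c₀ ≡ x
⊝-c₀ (a , b) = cong₂ _,_ (ℤ.+-identityʳ a) (ℤ.+-identityʳ b)

In⇒Open : Pos (hi₁ ⊝ hi) → In lo hi ξ → Open lo hi₁ ξ
In⇒Open {hi₁} {hi} {lo} {x} u (within p q) = between p (subst Pos (⊝-⊕-⊝ hi₁ hi x) (pos-⊕ u q))

no-integer-In : ∀ {z} j → In lo hi (z , + 0) → NonNeg (lo ⊝ (j , + 0)) → Pos ((ℤ.suc j , + 0) ⊝ hi) → ⊥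
no-integer-In {lo} {hi} j p l u = no-integer {lo} {ℤ.suc j , + 0} j (In⇒Open u p) l (nonNeg-c₀ (ℤ.suc j , + 0))

Frac-shift : ∀ {lo hi n} c d m → + n ℤ.+ d ≡ + m → Frac lo hi n → Frac (lo ⊕ (c , d)) (hi ⊕ (c , d)) m
Frac-shift {lo} {hi} {n} c d m e (a , p) = a ℤ.+ c ,
  subst (λ z → In (lo ⊕ (c , d)) (hi ⊕ (c , d)) (a ℤ.+ c , z)) e (In-shift (c , d) p)

fo-In : ∀ n → In c₀ c₂₃₆ (ℤ.- + fe (suc n) , + fo (suc n))
fo-In n = subst (In c₀ c₂₃₆) (fo-point (suc n)) (within
  (subst Pos (sym (⊝-c₀ (shrink (suc n) c₆₁₈))) (pos-shrink (suc n) (pos! {c₆₁₈})))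
  (shrink-decreasing {c₆₁₈} nonNeg! (ℕ.s≤s (ℕ.z≤n {n}))))

fo-fracB : ∀ n → FracB (fo (suc n))
fo-fracB n = _ , In-widen {lo₁ = c₀} {hi₁ = c₃₈₂} nonNeg! nonNeg! (fo-In n)

-- Used with c = 1 for θ(F(2n+2)) and with c = 4 - 2φ for θ(F(2n+2) - 2): in both cases θ is `c`
-- less the error φ⁻²ⁿ⁻², which is at most φ⁻²ᵏ.
fe-In : ∀ {lo} n k c → k ℕ.≤ suc n → Pos (c ⊝ shrink k c₁ ⊝ lo) → In lo c ((ℤ.- + fo (suc n) , + fe n) ⊕ c)
fe-In {lo} n k c k≤ p = subst (In lo c) (trans (lemma₁ c (shrink (suc n) c₁)) (cong (_⊕ c) (fe-point n))) (within
  (subst Pos (lemma₂ c (shrink k c₁) lo (shrink (suc n) c₁)) (pos-⊕ p (shrink-decreasing {c₁} nonNeg! k≤)))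
  (subst NonNeg (lemma₃ c (shrink (suc n) c₁)) (nonNeg-shrink (suc n) (nonNeg! {c₁}))))
  where
  lemma₁ : ∀ x y → x ⊝ y ≡ (c₀ ⊝ y) ⊕ x
  lemma₁ (a , b) (c , d) = cong₂ _,_ (eq a c) (eq b d)
    where
    eq : ∀ x y → x ℤ.- y ≡ (+ 0 ℤ.- y) ℤ.+ x
    eq = solve-∀
  lemma₂ : ∀ c x l y → (c ⊝ x ⊝ l) ⊕ (x ⊝ y) ≡ (c ⊝ y) ⊝ l
  lemma₂ (a , a′) (b , b′) (c , c′) (d , d′) = cong₂ _,_ (eq a b c d) (eq a′ b′ c′ d′)
    where
    eq : ∀ c x l y → (c ℤ.- x ℤ.- l) ℤ.+ (x ℤ.- y) ≡ (c ℤ.- y) ℤ.- l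
    eq = solve-∀
  lemma₃ : ∀ c x → x ≡ c ⊝ (c ⊝ x)
  lemma₃ (a , a′) (b , b′) = cong₂ _,_ (eq a b) (eq a′ b′)
    where
    eq : ∀ c x → x ≡ c ℤ.- (c ℤ.- x)
    eq = solve-∀

fe-fracA : ∀ n → FracA (fe n)
fe-fracA n = _ , subst (λ z → In c₃₈₂ c₁ (ℤ.- + fo (suc n) ℤ.+ + 1 , z)) (ℤ.+-identityʳ (+ fe n)) (fe-In n 1 c₁ (ℕ.s≤s ℕ.z≤n) pos!)

-- The case n = 0 is a true exception: F(4) - 2 = 1 lies in AB₀ + 1.
fe-classNum : ∀ {h} n → 1 ℕ.≤ n → 2 ℕ.+ h ≡ fe (suc n) → ClassNum h
fe-classNum {h} n 1≤n e = _ , subst (λ z → In c₆₁₈ c₇₆₄ (ℤ.- + fo (suc (suc n)) ℤ.+ + 4 , z))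
  (cong (λ z → + z ℤ.+ -[1+ 1 ]) (sym e)) (fe-In (suc n) 3 c₇₆₄ (ℕ.s≤s (ℕ.s≤s 1≤n)) pos!)

fo-classAB₀ : ∀ {h} n → 2 ℕ.+ h ≡ fo (suc n) → ClassAB₀ h
fo-classAB₀ {h} n e = Frac-shift {c₀} {c₂₃₆} (+ 4) -[1+ 1 ] h (cong (λ z → + z ℤ.+ -[1+ 1 ]) (sym e)) (_ , fo-In n)

fracA-1 : FracA 1
fracA-1 = -[1+ 0 ] , within pos! nonNeg!

fracA-3 : FracA 3
fracA-3 = -[1+ 3 ] , within pos! nonNeg!

-- Taking 1 adds φ⁻² to θ and taking 3 adds φ⁻⁴. The first reaches AB₀ + 1 when θ ≤ φ⁻³, the second
-- when φ⁻³ < θ ≤ φ⁻².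
classB-A-move : ∀ h → FracB h → ∃₂ λ k d → h ≡ k ℕ.+ d × 1 ℕ.≤ d × FracA d × ClassOne k
classB-A-move h p = split (Frac-split c₂₃₆ p)
  where
  low : ∀ h → Frac c₀ c₂₃₆ h → ∃₂ λ k d → h ≡ k ℕ.+ d × 1 ℕ.≤ d × FracA d × ClassOne k
  low zero    p = ⊥-elim (ℕ.n≮0 (Frac-pos p nonNeg! pos!))
  low (suc h) p = h , 1 , ℕ.+-comm 1 h , ℕ.≤-refl , fracA-1 , Frac-shift (+ 2) -[1+ 0 ] h refl p
  high : ∀ h → Frac c₂₃₆ c₃₈₂ h → ∃₂ λ k d → h ≡ k ℕ.+ d × 1 ℕ.≤ d × FracA d × ClassOne k
  high 0 p = ⊥-elim (ℕ.n≮0 (Frac-pos p nonNeg! pos!))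
  high 1 (a , p) = ⊥-elim (no-integer-In -[1+ 0 ] (In-shift (+ 1 , -[1+ 0 ]) p) nonNeg! pos!)
  high 2 (a , p) = ⊥-elim (no-integer-In (+ 0) (In-shift (+ 3 , -[1+ 1 ]) p) nonNeg! pos!)
  high (suc (suc (suc h))) p = h , 3 , ℕ.+-comm 3 h , ℕ.s≤s ℕ.z≤n , fracA-3 ,
    Frac-widen {lo₁ = c₃₈₂} {hi₁ = c₆₁₈} nonNeg! nonNeg! (Frac-shift {n = suc (suc (suc h))} (+ 5) -[1+ 2 ] h refl p)
  split : Frac c₀ c₂₃₆ h ⊎ Frac c₂₃₆ c₃₈₂ h → ∃₂ λ k d → h ≡ k ℕ.+ d × 1 ℕ.≤ d × FracA d × ClassOne k
  split (inj₁ p) = low h p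
  split (inj₂ p) = high h p

-- θ(h - 1) = θ(h) + φ⁻² > φ⁻², so Left may leave the heap 1, whose value is 1.
classOne-A-move : ∀ h → ClassOne h → h ≡ 1 ⊎ (∃[ d ] (h ≡ 1 ℕ.+ d × 1 ℕ.≤ d × FracA d))
classOne-A-move zero p = ⊥-elim (ℕ.n≮0 (Frac-pos p nonNeg! pos!))
classOne-A-move (suc zero)      p = inj₁ refl
classOne-A-move (suc d@(suc _)) p = inj₂ (d , refl , ℕ.s≤s ℕ.z≤n ,
  Frac-widen {lo₁ = c₃₈₂} {hi₁ = c₁} nonNeg! nonNeg! (Frac-shift {n = suc d} (+ 2) -[1+ 0 ] d refl p))

-- θ(h - 1) = θ(h) - φ⁻¹ ≤ φ⁻⁴, so Right may leave the heap 1, which keeps the value of `h` below 1.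
classNum-B-move : ∀ h → ClassNum h → ∃[ d ] (h ≡ 1 ℕ.+ d × FracB d)
classNum-B-move zero p = ⊥-elim (ℕ.n≮0 (Frac-pos p nonNeg! pos!))
classNum-B-move (suc d) p = d , refl ,
  Frac-widen {lo₁ = c₀} {hi₁ = c₃₈₂} nonNeg! nonNeg! (Frac-shift {n = suc d} (+ 1) -[1+ 0 ] d refl p)

In-combine : ∀ {a b c k d} j → In lo₁ hi₁ (a , + k) → In lo₂ hi₂ (b , + d) → In lo₃ hi₃ (c , + (k ℕ.+ d)) →
  NonNeg (lo₁ ⊕ lo₂ ⊝ hi₃ ⊝ (ℤ.pred j , + 0)) → NonNeg ((ℤ.suc j , + 0) ⊝ (hi₁ ⊕ hi₂ ⊝ lo₃)) →
  a ℤ.+ b ℤ.- c ≡ j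
In-combine j p q r l u = the-integer j (carry p q r) l u

module _ {kᴸ kᴿ a b : ℕ} where
  -- φkᴸ = φh + 1 - φa and φkᴿ = φh - φb modulo integers.
  private
    difference : FracA a → FracB b → ClassNum (kᴸ ℕ.+ a) → kᴸ ℕ.+ a ≡ kᴿ ℕ.+ b → ClassNum kᴸ → ClassNum kᴿ →
                 ∃[ z ] In c₀ c₁₄₆ (z , + kᴸ ℤ.- + kᴿ)
    difference (u , p) (v , q) (w , r) e (x , xᴸ) (y , yᴿ) = x ℤ.- y , within
      (subst Pos (cong₂ _,_ (trans (lemma₁ u v x y w) (trans (cong₂ (λ i j → x ℤ.- y ℤ.+ (+ 1 ℤ.- i ℤ.+ j)) carryᴸ carryᴿ) (lemma₂ (x ℤ.- y))))
          (lemma₃ (+ a) (+ b) (+ kᴸ) (+ kᴿ) (cong +_ e)))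
        (pos-⊕ (lower q) (upper p)))
      (subst NonNeg (cong₂ _,_ (lemma₄ x y) (lemma₅ (+ kᴸ) (+ kᴿ))) (nonNeg-⊕ (upper xᴸ) (pos⇒nonNeg (lower yᴿ))))
      where
      carryᴸ : x ℤ.+ u ℤ.- w ≡ + 1
      carryᴸ = In-combine (+ 1) xᴸ p r nonNeg! nonNeg!
      carryᴿ : y ℤ.+ v ℤ.- w ≡ + 0
      carryᴿ = In-combine (+ 0) yᴿ q (subst (λ n → In c₆₁₈ c₇₆₄ (w , + n)) e r) nonNeg! nonNeg!
      lemma₁ : ∀ u v x y w → v ℤ.- + 0 ℤ.+ (+ 1 ℤ.- u) ≡ x ℤ.- y ℤ.+ (+ 1 ℤ.- (x ℤ.+ u ℤ.- w) ℤ.+ (y ℤ.+ v ℤ.- w))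
      lemma₁ = solve-∀
      lemma₂ : ∀ z → z ℤ.+ (+ 1 ℤ.- + 1 ℤ.+ + 0) ≡ z ℤ.- + 0
      lemma₂ = solve-∀
      lemma₃ : ∀ a b k l → k ℤ.+ a ≡ l ℤ.+ b → b ℤ.- + 0 ℤ.+ (+ 0 ℤ.- a) ≡ k ℤ.- l ℤ.- + 0
      lemma₃ a b k l e = trans (eq₁ a b l) (trans (cong (λ z → z ℤ.- a ℤ.- l) (sym e)) (eq₂ a k l))
        where
        eq₁ : ∀ a b l → b ℤ.- + 0 ℤ.+ (+ 0 ℤ.- a) ≡ l ℤ.+ b ℤ.- a ℤ.- l
        eq₁ = solve-∀
        eq₂ : ∀ a k l → k ℤ.+ a ℤ.- a ℤ.- l ≡ k ℤ.- l ℤ.- + 0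
        eq₂ = solve-∀
      lemma₄ : ∀ x y → + 4 ℤ.- x ℤ.+ (y ℤ.- -[1+ 0 ]) ≡ + 5 ℤ.- (x ℤ.- y)
      lemma₄ = solve-∀
      lemma₅ : ∀ k l → -[1+ 1 ] ℤ.- k ℤ.+ (l ℤ.- + 1) ≡ -[1+ 2 ] ℤ.- (k ℤ.- l)
      lemma₅ = solve-∀

  -- The difference θ(kᴸ) - θ(kᴿ) lies in (0, φ⁻⁴]. If kᴸ is the larger heap, this is θ(kᴸ - kᴿ),
  -- small enough for Right; otherwise θ(kᴿ - kᴸ) is 1 minus it, large enough for Left.
  classNum-options : FracA a → FracB b → ClassNum (kᴸ ℕ.+ a) → kᴸ ℕ.+ a ≡ kᴿ ℕ.+ b → ClassNum kᴸ → ClassNum kᴿ →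
    (∃[ d ] (kᴿ ≡ kᴸ ℕ.+ d × 1 ℕ.≤ d × FracA d)) ⊎ (∃[ d ] (kᴸ ≡ kᴿ ℕ.+ d × FracB d))
  classNum-options p q r e kl kr = cases (difference p q r e kl kr) (ℕ.≤-total kᴸ kᴿ)
    where
    cases : ∃[ z ] In c₀ c₁₄₆ (z , + kᴸ ℤ.- + kᴿ) → kᴸ ℕ.≤ kᴿ ⊎ kᴿ ℕ.≤ kᴸ →
      (∃[ d ] (kᴿ ≡ kᴸ ℕ.+ d × 1 ℕ.≤ d × FracA d)) ⊎ (∃[ d ] (kᴸ ≡ kᴿ ℕ.+ d × FracB d))
    cases (z , p) (inj₂ le) = inj₂ (kᴸ ℕ.∸ kᴿ , sym (ℕ.m+[n∸m]≡n le) , z ,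
      subst (λ y → In c₀ c₃₈₂ (z , y)) (trans (ℤ.m-n≡m⊖n kᴸ kᴿ) (ℤ.⊖-≥ le)) (In-widen {lo₁ = c₀} {hi₁ = c₃₈₂} nonNeg! nonNeg! p))
    cases (z , p) (inj₁ le) with kᴿ ℕ.∸ kᴸ in eq
    -- Equal heaps cannot occur; the resulting `FracB 0` is contradictory and is passed on as a
    -- Right move.
    ... | zero = inj₂ (0 , trans (ℕ.≤-antisym le (ℕ.m∸n≡0⇒m≤n eq)) (sym (ℕ.+-identityʳ kᴿ)) ,
      z , subst (λ y → In c₀ c₃₈₂ (z , y)) (trans (ℤ.m-n≡m⊖n kᴸ kᴿ) (trans (cong (kᴸ ℤ.⊖_) (ℕ.≤-antisym (ℕ.m∸n≡0⇒m≤n eq) le)) (ℤ.n⊖n≡0 kᴸ)))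
        (In-widen {lo₁ = c₀} {hi₁ = c₃₈₂} nonNeg! nonNeg! p))
    ... | d@(suc _) = inj₁ (d , trans (sym (ℕ.m+[n∸m]≡n le)) (cong (kᴸ ℕ.+_) eq) , ℕ.s≤s ℕ.z≤n ,
      + 1 ℤ.- z , flipped)
      where
      flipped : In c₃₈₂ c₁ (+ 1 ℤ.- z , + d)
      flipped = within
        (subst Pos (cong₂ _,_ (lemma₁ z) (trans (cong (λ y → -[1+ 2 ] ℤ.- y ℤ.+ + 4) diff) (lemma₂ (+ d)))) (⊕-pos (upper p) (pos! { -[1+ 5 ] , + 4})))
        (subst NonNeg (cong₂ _,_ (lemma₃ z) (trans (cong (ℤ._- + 0) diff) (lemma₄ (+ d)))) (pos⇒nonNeg (lower p)))
        where
        diff : + kᴸ ℤ.- + kᴿ ≡ ℤ.- + d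
        diff = trans (ℤ.m-n≡m⊖n kᴸ kᴿ) (trans (ℤ.⊖-≤ le) (cong (λ z → ℤ.- + z) eq))
        lemma₁ : ∀ z → + 5 ℤ.- z ℤ.+ -[1+ 5 ] ≡ + 1 ℤ.- z ℤ.- + 2
        lemma₁ = solve-∀
        lemma₂ : ∀ d → -[1+ 2 ] ℤ.- (ℤ.- d) ℤ.+ + 4 ≡ d ℤ.- -[1+ 0 ]
        lemma₂ = solve-∀
        lemma₃ : ∀ z → z ℤ.- + 0 ≡ + 1 ℤ.- (+ 1 ℤ.- z)
        lemma₃ = solve-∀
        lemma₄ : ∀ d → ℤ.- d ℤ.- + 0 ≡ + 0 ℤ.- d
        lemma₄ = solve-∀

classNum-near : ∀ {a h} → In c₆₁₈ c₇₆₄ (a , + h) → In (c₀ ⊝ c₁₄₆) c₀ (a ℤ.+ -[1+ 3 ] , + (2 ℕ.+ h))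
classNum-near {a} {h} p = subst (λ z → In (c₀ ⊝ c₁₄₆) c₀ (a ℤ.+ -[1+ 3 ] , z)) (ℤ.+-comm (+ h) (+ 2)) (In-shift (-[1+ 3 ] , + 2) p)

⊝-neg : ∀ x y → x ⊝ (c₀ ⊝ y) ≡ y ⊕ x
⊝-neg (a , a′) (b , b′) = cong₂ _,_ (lemma a b) (lemma a′ b′)
  where
  lemma : ∀ x y → x ℤ.- (+ 0 ℤ.- y) ≡ y ℤ.+ x
  lemma = solve-∀

-- `c₁₄₆` = φ⁻⁴ is `shrink 2 c₁`, so `approx-above` at 2 gives F(6) = 8.
classNum-≥8 : ∀ {h} → ClassNum h → 8 ℕ.≤ 2 ℕ.+ h
classNum-≥8 {h} (a , p) = ℤ.drop‿+≤+ (proj₁ (approx-above 2 {a ℤ.+ -[1+ 3 ]} {+ (2 ℕ.+ h)} (ℤ.+≤+ (ℕ.s≤s ℕ.z≤n)) (upper near) (subst Pos (⊝-neg (a ℤ.+ -[1+ 3 ] , + (2 ℕ.+ h)) c₁₄₆) (lower near))))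
  where
  near : In (c₀ ⊝ c₁₄₆) c₀ (a ℤ.+ -[1+ 3 ] , + (2 ℕ.+ h))
  near = classNum-near p

locate-fe : ∀ e → ∃[ n ] (1 ℕ.≤ n × fe (suc n) ℕ.≤ 8 ℕ.+ e × 8 ℕ.+ e ℕ.< fe (suc (suc n)))
locate-fe zero = 1 , ℕ.≤-refl , ℕ.≤-refl , ℕ.m≤m+n 9 12
locate-fe (suc e) with locate-fe e
... | n , 1≤n , l , u with ℕ.m≤n⇒m<n∨m≡n u
... | inj₁ u′ = n , 1≤n , ℕ.≤-trans l (ℕ.n≤1+n (8 ℕ.+ e)) , u′
... | inj₂ eq = suc n , ℕ.s≤s ℕ.z≤n , ℕ.≤-reflexive (sym eq) ,
  subst (ℕ._< fe (suc (suc (suc n)))) (sym eq) (ℕ.m<n+m (fe (suc (suc n))) (fo-pos (suc (suc (suc n)))))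

-- Choose n with F(2n+4) ≤ h + 2 < F(2n+6). By `approx-above`, (h + 2)φ then falls short of an
-- integer by at least φ⁻²ⁿ⁻⁴, the error of F(2n+4), and by less than φ⁻⁴; so the difference of the
-- two numbers has θ near 1 and Left may take it. This bounds the value from below by q(n).
classNum-A-move : ∀ {h} → ClassNum h → ∃[ n ] (1 ℕ.≤ n ×
  ((2 ℕ.+ h ≡ fe (suc n)) ⊎ (∃₂ λ k d → h ≡ k ℕ.+ d × 2 ℕ.+ k ≡ fe (suc n) × 1 ℕ.≤ d × FracA d)))
classNum-A-move {h} (a , p) = located (locate-fe (2 ℕ.+ h ℕ.∸ 8))
  where
  x : ℤ[φ]
  x = a ℤ.+ -[1+ 3 ] , + (2 ℕ.+ h)
  near : In (c₀ ⊝ c₁₄₆) c₀ x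
  near = classNum-near p
  far : ∀ n → 2 ℕ.+ h ℕ.< fe (suc (suc n)) → NonNeg (c₀ ⊝ (shrink (suc (suc n)) c₁ ⊕ x))
  far n u with pos⊎nonPos (shrink (suc (suc n)) c₁ ⊕ x)
  ... | inj₂ le = le
  ... | inj₁ close = ⊥-elim (ℕ.<⇒≱ u (ℤ.drop‿+≤+ (proj₁ (approx-above (suc (suc n)) (ℤ.+≤+ (ℕ.s≤s ℕ.z≤n)) (upper near) close))))
  result : ∀ n → 1 ℕ.≤ n → fe (suc n) ℕ.≤ 2 ℕ.+ h → NonNeg (c₀ ⊝ (shrink (suc (suc n)) c₁ ⊕ x)) →
    (2 ℕ.+ h ≡ fe (suc n)) ⊎ (∃₂ λ k d → h ≡ k ℕ.+ d × 2 ℕ.+ k ≡ fe (suc n) × 1 ℕ.≤ d × FracA d)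
  result n 1≤n l le with ℕ.m≤n⇒m<n∨m≡n l | ℕ.m≤n⇒∃[o]m+o≡n (fe-suc-≥2 n)
  ... | inj₂ e | _ = inj₁ (sym e)
  ... | inj₁ lt | k , e with ℕ.m≤n⇒∃[o]m+o≡n lt
  ... | d , e′ = inj₂ (k , suc d , ℕ.+-cancelˡ-≡ 2 h (k ℕ.+ suc d) (trans (sym e′) (trans (sym (ℕ.+-suc (fe (suc n)) d)) (cong (ℕ._+ suc d) (sym e)))) ,
    e , ℕ.s≤s ℕ.z≤n , ((a ℤ.+ -[1+ 3 ]) ℤ.- (ℤ.- + fo (suc (suc n))) ℤ.+ + 1) , within
      (subst Pos (trans (lemma₁ (shrink (suc (suc n)) c₁) x) element) (⊕-pos (nonNeg-shrink (suc (suc n)) (nonNeg! {c₁})) (pos-⊕ (lower near) (nonNeg! { -[1+ 5 ] , + 4}))))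
      (subst NonNeg (trans (lemma₂ (shrink (suc (suc n)) c₁) x) element′) le))
    where
    y : ℤ[φ]
    y = (a ℤ.+ -[1+ 3 ]) ℤ.- (ℤ.- + fo (suc (suc n))) ℤ.+ + 1 , + suc d
    c : ℤ
    c = ℤ.- + fo (suc (suc n))
    coord₂ : + (2 ℕ.+ h) ℤ.- + fe (suc n) ℤ.+ + 0 ≡ + suc d
    coord₂ = trans (cong (λ z → + z ℤ.- + fe (suc n) ℤ.+ + 0) (trans (sym e′) (sym (ℕ.+-suc (fe (suc n)) d)))) (lemma₃ (+ fe (suc n)) (+ suc d))
      where
      lemma₃ : ∀ f d → f ℤ.+ d ℤ.- f ℤ.+ + 0 ≡ d
      lemma₃ = solve-∀
    yy : x ⊝ (c₀ ⊝ shrink (suc (suc n)) c₁) ⊕ c₁ ≡ y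
    yy = trans (cong (λ z → x ⊝ z ⊕ c₁) (fe-point (suc n))) (cong (a ℤ.+ -[1+ 3 ] ℤ.- c ℤ.+ + 1 ,_) coord₂)
    element : x ⊝ (c₀ ⊝ shrink (suc (suc n)) c₁) ⊕ c₁ ⊝ c₃₈₂ ≡ y ⊝ c₃₈₂
    element = cong (_⊝ c₃₈₂) yy
    element′ : c₁ ⊝ (x ⊝ (c₀ ⊝ shrink (suc (suc n)) c₁) ⊕ c₁) ≡ c₁ ⊝ y
    element′ = cong (c₁ ⊝_) yy
    lemma₁ : ∀ s x → s ⊕ (x ⊝ (c₀ ⊝ c₁₄₆) ⊕ (-[1+ 5 ] , + 4)) ≡ x ⊝ (c₀ ⊝ s) ⊕ c₁ ⊝ c₃₈₂
    lemma₁ (a , b) (c , d) = cong₂ _,_ (eq₁ a c) (eq₂ b d)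
      where
      eq₁ : ∀ s x → s ℤ.+ (x ℤ.- -[1+ 4 ] ℤ.+ -[1+ 5 ]) ≡ x ℤ.- (+ 0 ℤ.- s) ℤ.+ + 1 ℤ.- + 2
      eq₁ = solve-∀
      eq₂ : ∀ s x → s ℤ.+ (x ℤ.- + 3 ℤ.+ + 4) ≡ x ℤ.- (+ 0 ℤ.- s) ℤ.+ + 0 ℤ.- -[1+ 0 ]
      eq₂ = solve-∀
    lemma₂ : ∀ s x → c₀ ⊝ (s ⊕ x) ≡ c₁ ⊝ (x ⊝ (c₀ ⊝ s) ⊕ c₁)
    lemma₂ (a , b) (c , d) = cong₂ _,_ (eq₁ a c) (eq₂ b d)
      where
      eq₁ : ∀ s x → + 0 ℤ.- (s ℤ.+ x) ≡ + 1 ℤ.- (x ℤ.- (+ 0 ℤ.- s) ℤ.+ + 1)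
      eq₁ = solve-∀
      eq₂ : ∀ s x → + 0 ℤ.- (s ℤ.+ x) ≡ + 0 ℤ.- (x ℤ.- (+ 0 ℤ.- s) ℤ.+ + 0)
      eq₂ = solve-∀
  located : (∃[ n ] (1 ℕ.≤ n × fe (suc n) ℕ.≤ 8 ℕ.+ (2 ℕ.+ h ℕ.∸ 8) × 8 ℕ.+ (2 ℕ.+ h ℕ.∸ 8) ℕ.< fe (suc (suc n)))) →
    ∃[ n ] (1 ℕ.≤ n × ((2 ℕ.+ h ≡ fe (suc n)) ⊎ (∃₂ λ k d → h ≡ k ℕ.+ d × 2 ℕ.+ k ≡ fe (suc n) × 1 ℕ.≤ d × FracA d)))
  located (n , 1≤n , l , u) = n , 1≤n , result n 1≤n (subst (fe (suc n) ℕ.≤_) e l) (far n (subst (ℕ._< fe (suc (suc n))) e u))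
    where
    e : 8 ℕ.+ (2 ℕ.+ h ℕ.∸ 8) ≡ 2 ℕ.+ h
    e = ℕ.m+[n∸m]≡n (classNum-≥8 (a , p))

-- The left option k would have φk ≥ φh modulo integers, so k + 2 would be a
-- better approximation from above than F(2n+4).
fe-no-classNum : ∀ {k d} n → 1 ℕ.≤ n → 2 ℕ.+ (k ℕ.+ d) ≡ fe (suc n) → 1 ℕ.≤ d → FracA d → ¬ ClassNum k
fe-no-classNum {k} {d} n 1≤n e 1≤d (u , p) (x , q) = ℕ.<⇒≱ small (ℤ.drop‿+≤+ (proj₁
  (approx-above (suc n) (ℤ.+≤+ (ℕ.s≤s ℕ.z≤n)) (upper (classNum-near q)) close)))
  where
  small : 2 ℕ.+ k ℕ.< fe (suc n)
  small = subst (2 ℕ.+ k ℕ.<_) e (ℕ.+-monoʳ-< 2 (ℕ.m<m+n k 1≤d))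
  o = + fo (suc (suc n))
  r : In c₆₁₈ c₇₆₄ (ℤ.- o ℤ.+ + 4 , + (k ℕ.+ d))
  r = subst (λ z → In c₆₁₈ c₇₆₄ (ℤ.- o ℤ.+ + 4 , z)) (cong (λ z → + z ℤ.+ -[1+ 1 ]) (sym e)) (fe-In (suc n) 3 c₇₆₄ (ℕ.s≤s (ℕ.s≤s 1≤n)) pos!)
  carry-1 : x ℤ.+ u ℤ.- (ℤ.- o ℤ.+ + 4) ≡ + 1
  carry-1 = In-combine (+ 1) q p r nonNeg! nonNeg!
  -- φ⁻²ⁿ⁻² > φ⁻²ⁿ⁻⁴ ≥ the distance of φ(k + 2) from the next integer.
  gap : Pos (shrink (suc n) c₁ ⊝ shrink (suc (suc n)) c₁)
  gap = subst Pos (trans (shrink-⊝ (suc n) c₁ c₃₈₂) (cong (shrink (suc n) c₁ ⊝_) (shrink-φ⁻² (suc n) c₁)))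
    (pos-shrink (suc n) (pos! {c₁ ⊝ c₃₈₂}))
  close : Pos (shrink (suc n) c₁ ⊕ (x ℤ.+ -[1+ 3 ] , + (2 ℕ.+ k)))
  close = subst Pos (cong₂ _,_
      (trans (lemma₁ (proj₁ S) (proj₁ S′) u x o) (trans (cong₂ (λ i j → proj₁ S ℤ.+ (x ℤ.+ -[1+ 3 ]) ℤ.- (i ℤ.- + 1) ℤ.+ j) carry-1 s₁) (lemma₃ (proj₁ S) x)))
      (trans (lemma₂ (proj₂ S) (proj₂ S′) (+ d) (+ k)) (trans (cong (λ z → proj₂ S ℤ.+ (+ 2 ℤ.+ + k) ℤ.+ z) s₂) (ℤ.+-identityʳ _))))
    (pos-⊕ gap (upper p))
    where
    S S′ : ℤ[φ]
    S = shrink (suc n) c₁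
    S′ = shrink (suc (suc n)) c₁
    s₁ : o ℤ.- proj₁ S′ ≡ + 0
    s₁ = trans (lemma o (proj₁ S′)) (trans (cong (λ z → o ℤ.+ proj₁ z) (fe-point (suc n))) (ℤ.+-inverseʳ o))
      where
      lemma : ∀ o s → o ℤ.- s ≡ o ℤ.+ (+ 0 ℤ.- s)
      lemma = solve-∀
    s₂ : ℤ.- proj₂ S′ ℤ.- (+ 2 ℤ.+ (+ k ℤ.+ + d)) ≡ + 0
    s₂ = trans (lemma (proj₂ S′) (+ 2 ℤ.+ (+ k ℤ.+ + d))) (trans (cong₂ (λ z w → proj₂ z ℤ.- + w) (fe-point (suc n)) e) (ℤ.+-inverseʳ (+ fe (suc n))))
      where
      lemma : ∀ s z → ℤ.- s ℤ.- z ≡ (+ 0 ℤ.- s) ℤ.- z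
      lemma = solve-∀
    lemma₁ : ∀ s s′ u x o → s ℤ.- s′ ℤ.+ (+ 1 ℤ.- u) ≡ s ℤ.+ (x ℤ.+ -[1+ 3 ]) ℤ.- (x ℤ.+ u ℤ.- (ℤ.- o ℤ.+ + 4) ℤ.- + 1) ℤ.+ (o ℤ.- s′)
    lemma₁ = solve-∀
    lemma₂ : ∀ s s′ d k → s ℤ.- s′ ℤ.+ (+ 0 ℤ.- d) ≡ s ℤ.+ (+ 2 ℤ.+ k) ℤ.+ (ℤ.- s′ ℤ.- (+ 2 ℤ.+ (k ℤ.+ d)))
    lemma₂ = solve-∀
    lemma₃ : ∀ s x → s ℤ.+ (x ℤ.+ -[1+ 3 ]) ℤ.- (+ 1 ℤ.- + 1) ℤ.+ + 0 ≡ s ℤ.+ (x ℤ.+ -[1+ 3 ])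
    lemma₃ = solve-∀

-- Here k + 1 and d + 1 sum to F(2n+3) without carry, so k + 1 would be a
-- better approximation from below than F(2n+3).
fo-no-classOne : ∀ {k d} n → 2 ℕ.+ (k ℕ.+ d) ≡ fo (suc n) → FracA d → ¬ ClassOne k
fo-no-classOne {k} {d} n e (u , p) (x , q) = ℕ.<⇒≱ small (ℤ.drop‿+≤+ (proj₁
  (approx-below (suc n) (ℤ.+≤+ (ℕ.s≤s ℕ.z≤n)) (subst Pos (⊝-c₀ _) (lower q′)) close)))
  where
  small : suc k ℕ.< fo (suc n)
  small = subst (suc k ℕ.<_) e (ℕ.s≤s (ℕ.s≤s (ℕ.m≤m+n k d)))
  q′ : In c₀ c₂₃₆ (x ℤ.+ -[1+ 1 ] , + suc k)
  q′ = subst (λ z → In c₀ c₂₃₆ (x ℤ.+ -[1+ 1 ] , z)) (ℤ.+-comm (+ k) (+ 1)) (In-shift (-[1+ 1 ] , + 1) q)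
  p′ : In c₀ c₆₁₈ (u ℤ.+ -[1+ 1 ] , + suc d)
  p′ = subst (λ z → In c₀ c₆₁₈ (u ℤ.+ -[1+ 1 ] , z)) (ℤ.+-comm (+ d) (+ 1)) (In-shift (-[1+ 1 ] , + 1) p)
  sum : suc k ℕ.+ suc d ≡ fo (suc n)
  sum = trans (ℕ.+-suc (suc k) d) e
  r : In c₀ c₂₃₆ (ℤ.- + fe (suc n) , + (suc k ℕ.+ suc d))
  r = subst (λ z → In c₀ c₂₃₆ (ℤ.- + fe (suc n) , + z)) (sym sum) (fo-In n)
  carry-0 : x ℤ.+ -[1+ 1 ] ℤ.+ (u ℤ.+ -[1+ 1 ]) ℤ.- ℤ.- + fe (suc n) ≡ + 0
  carry-0 = In-combine (+ 0) q′ p′ r nonNeg! nonNeg!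
  S = shrink (suc n) c₁
  O = shrink (suc n) c₆₁₈
  close : Pos (S ⊝ (x ℤ.+ -[1+ 1 ] , + suc k))
  close = subst Pos (cong₂ _,_
      (trans (lemma₁ (proj₁ S) (proj₁ O) (x ℤ.+ -[1+ 1 ]) (u ℤ.+ -[1+ 1 ]) (ℤ.- + fe (suc n)))
        (trans (cong₂ (λ i j → proj₁ S ℤ.- (x ℤ.+ -[1+ 1 ]) ℤ.+ i ℤ.- j) carry-0 (trans (cong (λ z → proj₁ z ℤ.- (ℤ.- + fe (suc n))) (fo-point (suc n))) (ℤ.+-inverseʳ (ℤ.- + fe (suc n)))))
          (lemma₃ (proj₁ S ℤ.- (x ℤ.+ -[1+ 1 ])))))
      (trans (lemma₂ (proj₂ S) (proj₂ O) (+ suc k) (+ suc d))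
        (trans (cong (λ j → proj₂ S ℤ.- + suc k ℤ.- j) (trans (cong₂ (λ z w → proj₂ z ℤ.- + w) (fo-point (suc n)) sum) (ℤ.+-inverseʳ (+ fo (suc n)))))
          (ℤ.+-identityʳ _))))
    (pos-⊕ (subst Pos (shrink-⊝ (suc n) c₁ c₆₁₈) (pos-shrink (suc n) (pos! {c₁ ⊝ c₆₁₈}))) (pos⇒nonNeg (lower p′)))
    where
    lemma₁ : ∀ s o x u e → s ℤ.- o ℤ.+ (u ℤ.- + 0) ≡ s ℤ.- x ℤ.+ (x ℤ.+ u ℤ.- e) ℤ.- (o ℤ.- e)
    lemma₁ = solve-∀
    lemma₂ : ∀ s o k d → s ℤ.- o ℤ.+ (d ℤ.- + 0) ≡ s ℤ.- k ℤ.- (o ℤ.- (k ℤ.+ d))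
    lemma₂ = solve-∀
    lemma₃ : ∀ s → s ℤ.+ + 0 ℤ.- + 0 ≡ s
    lemma₃ = solve-∀

-- γ i m = G⟨ i ⟩ m + 2 and γ i m = δ i m + F(2m+3), where δ i m is the
-- (m+1)-fold iterate of B at i.
γ δ : ℕ → ℕ → ℕ
γ i m = suc i ℕ.* fo m ℕ.+ suc ⌊φ i ⌋ ℕ.* fe m
δ i m = i ℕ.* fo m ℕ.+ ⌊φ i ⌋ ℕ.* fe m

γ-δ : ∀ i m → γ i m ≡ δ i m ℕ.+ fo (suc m)
γ-δ i m = lemma i ⌊φ i ⌋ (fo m) (fe m)
  where
  lemma : ∀ i f o e → suc i ℕ.* o ℕ.+ suc f ℕ.* e ≡ (i ℕ.* o ℕ.+ f ℕ.* e) ℕ.+ (o ℕ.+ e)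
  lemma = ℕ-Ring.solve-∀

γ-0 : ∀ m → γ 0 m ≡ fo (suc m)
γ-0 m = trans (γ-δ 0 m) (cong (λ z → z ℕ.* fe m ℕ.+ fo (suc m)) ⌊φ0⌋)

fo≤γ : ∀ i m → fo (suc m) ℕ.≤ γ i m
fo≤γ i m = subst (fo (suc m) ℕ.≤_) (sym (γ-δ i m)) (ℕ.m≤n+m (fo (suc m)) (δ i m))

-- (i + 1)φ - (⌊iφ⌋ + 1) is φ⁻¹ plus the excess of iφ over its floor; scaled by φ⁻²ᵐ⁻² it becomes γ
-- i m · φ less an integer. For i = 0 it is the point of F(2m+3).
γ-point : ℕ → ℕ → ℤ[φ]
γ-point i m = shrink (suc m) (ℤ.- + suc ⌊φ i ⌋ , + suc i)

γ-coord : ∀ i m → proj₂ (γ-point i m) ≡ + γ i m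
γ-coord i m = trans (cong proj₂ (shrink-coords m (ℤ.- + suc ⌊φ i ⌋) (+ suc i)))
  (trans (lemma (+ suc i) (+ suc ⌊φ i ⌋) (+ fo m) (+ fe m))
    (cong₂ ℤ._+_ (sym (ℤ.pos-* (suc i) (fo m))) (sym (ℤ.pos-* (suc ⌊φ i ⌋) (fe m)))))
  where
  lemma : ∀ i f o e → i ℤ.* o ℤ.- (ℤ.- f) ℤ.* e ≡ i ℤ.* o ℤ.+ f ℤ.* e
  lemma = solve-∀

δ-coord : ∀ i m → proj₂ (shrink (suc m) (ℤ.- + ⌊φ i ⌋ , + i)) ≡ + δ i m
δ-coord i m = trans (cong proj₂ (shrink-coords m (ℤ.- + ⌊φ i ⌋) (+ i)))
  (trans (lemma (+ i) (+ ⌊φ i ⌋) (+ fo m) (+ fe m))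
    (cong₂ ℤ._+_ (sym (ℤ.pos-* i (fo m))) (sym (ℤ.pos-* ⌊φ i ⌋ (fe m)))))
  where
  lemma : ∀ i f o e → i ℤ.* o ℤ.- (ℤ.- f) ℤ.* e ≡ i ℤ.* o ℤ.+ f ℤ.* e
  lemma = solve-∀

γ-start : ∀ f i → (ℤ.- f , i) ⊕ c₆₁₈ ≡ (ℤ.- (+ 1 ℤ.+ f) , + 1 ℤ.+ i)
γ-start f i = cong₂ _,_ (lemma f) (ℤ.+-comm i (+ 1))
  where
  lemma : ∀ f → ℤ.- f ℤ.+ -[1+ 0 ] ≡ ℤ.- (+ 1 ℤ.+ f)
  lemma = solve-∀

γ-start-In : ∀ i → Open c₀ (+ 0 , + 1) (ℤ.- + suc ⌊φ i ⌋ , + suc i)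
γ-start-In zero rewrite ⌊φ0⌋ = between pos! pos!
γ-start-In (suc i) = subst (Open c₀ (+ 0 , + 1)) (γ-start (+ ⌊φ suc i ⌋) (+ suc i)) (between
  (subst Pos (sym (⊝-c₀ _)) (pos-⊕ (⌊φ⌋-lower (suc i) (ℕ.s≤s ℕ.z≤n)) (nonNeg! {c₆₁₈})))
  (subst Pos (cong₂ _,_ (lemma₁ (+ ⌊φ suc i ⌋)) (lemma₂ (+ suc i))) (⌊φ⌋-upper (suc i))))
  where
  lemma₁ : ∀ f → + 1 ℤ.+ f ≡ + 0 ℤ.- (ℤ.- f ℤ.+ -[1+ 0 ])
  lemma₁ = solve-∀
  lemma₂ : ∀ i → ℤ.- i ≡ + 1 ℤ.- (i ℤ.+ + 1)
  lemma₂ = solve-∀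

-- Resolution of AB₀ into F(2m+3) - 2 and the sets G(m)

Shape : ℤ → ℕ → Set
Shape a t = ∃₂ λ m i → (a , + t) ≡ γ-point i m × (i ≡ 0 ⊎ (1 ℕ.≤ m × 1 ℕ.≤ i))

In-split : ∀ {lo hi x} c → In lo hi x → In lo c x ⊎ In c hi x
In-split {x = x} c (within p q) with pos⊎nonPos (x ⊝ c)
... | inj₁ above = inj₂ (within above q)
... | inj₂ below = inj₁ (within p (subst NonNeg (⊝-flip x c) below))

unit : ∀ {lo hi a} j c → In lo hi (a , + j) → NonNeg (lo ⊕ (c , ℤ.- + j) ⊝ (-[1+ 0 ] , + 0)) → Pos (c₁ ⊝ (hi ⊕ (c , ℤ.- + j))) → a ℤ.+ c ≡ + 0
unit {lo} {hi} {a} j c p l u = the-integer {lo ⊕ (c , ℤ.- + j)} {c₁} (+ 0)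
  (In⇒Open u (subst (λ z → In (lo ⊕ (c , ℤ.- + j)) (hi ⊕ (c , ℤ.- + j)) (a ℤ.+ c , z)) (ℤ.+-inverseʳ (+ j)) (In-shift (c , ℤ.- + j) p))) l (nonNeg-c₀ c₁)

-- Multiplying by φ² leads to a smaller number with θ ≤ φ⁻¹. If even θ ≤ φ⁻³, the recursion applies
-- and `m` grows by one; otherwise subtracting 2 leaves a number with θ ≤ φ⁻², that is some B(i),
-- and m = 1. The case i = 0 comes from the bottom t = 2 = F(3).
shape : ∀ t → 2 ℕ.≤ t → ∀ a → In c₀ c₂₃₆ (a , + t) → Shape a t
shape = <-rec (λ t → 2 ℕ.≤ t → ∀ a → In c₀ c₂₃₆ (a , + t) → Shape a t) step
  where
  +-cancel-0 : ∀ a c → a ℤ.+ c ≡ + 0 → a ≡ ℤ.- c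
  +-cancel-0 a c e = trans (lemma a c) (trans (cong (ℤ._- c) e) (ℤ.+-identityˡ (ℤ.- c)))
    where
    lemma : ∀ a c → a ≡ a ℤ.+ c ℤ.- c
    lemma = solve-∀

  module Step (t : ℕ) (rec : ∀ {s} → s ℕ.< t → 2 ℕ.≤ s → ∀ a → In c₀ c₂₃₆ (a , + s) → Shape a s)
              (3≤t : 3 ℕ.≤ t) (a : ℤ) where

    smaller : ∀ {a′ s} → 1 ℕ.≤ s → In c₀ c₆₁₈ (a′ , + s) → (a , + t) ≡ φ⁻²· (a′ , + s) → s ℕ.< t
    smaller {a′} {s} 1≤s p e = ℤ.drop‿+<+ (ℤ.suc[i]≤j⇒i<j (subst₂ ℤ._≤_ refl (sym (trans (cong proj₂ e) (lemma₃ a′ (+ s))))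
      (ℤ.+-monoˡ-≤ (+ s) (pos-integer negative))))
      where
      lemma₁ : ∀ a → -[1+ 0 ] ℤ.- a ℤ.+ + 1 ≡ ℤ.- a
      lemma₁ = solve-∀
      lemma₂ : ∀ s → + 1 ℤ.- s ℤ.+ (s ℤ.- + 1) ≡ + 0
      lemma₂ = solve-∀
      lemma₃ : ∀ a s → s ℤ.- a ≡ ℤ.- a ℤ.+ s
      lemma₃ = solve-∀
      negative : Pos (ℤ.- a′ , + 0)
      negative = subst Pos (cong₂ _,_ (lemma₁ a′) (lemma₂ (+ s)))
        (⊕-pos (upper p) (coords-pos {+ 1} ℤ.≤-refl (ℤ.i≤j⇒0≤j-i (ℤ.+≤+ 1≤s))))

    low : ∀ {a′} s → 1 ℕ.≤ s → s ℕ.< t → In c₀ c₂₃₆ (a′ , + s) → (a , + t) ≡ φ⁻²· (a′ , + s) → Shape a t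
    low 0 () _ _ _
    low 1 _ _ p _ = ⊥-elim (no-integer-In -[1+ 0 ] (In-shift (+ 1 , -[1+ 0 ]) p) nonNeg! pos!)
    low {a′} (suc (suc s)) _ s<t p e = extend (rec s<t (ℕ.s≤s (ℕ.s≤s ℕ.z≤n)) a′ p)
      where
      extend : Shape a′ (suc (suc s)) → Shape a t
      extend (m , i , e′ , c) = suc m , i , trans e (cong φ⁻²·_ e′) , weaken c
        where
        weaken : i ≡ 0 ⊎ (1 ℕ.≤ m × 1 ℕ.≤ i) → i ≡ 0 ⊎ (1 ℕ.≤ suc m × 1 ℕ.≤ i)
        weaken (inj₁ z)         = inj₁ z
        weaken (inj₂ (_ , 1≤i)) = inj₂ (ℕ.s≤s ℕ.z≤n , 1≤i)

    high : ∀ {a′} s → 1 ℕ.≤ s → In c₂₃₆ c₆₁₈ (a′ , + s) → (a , + t) ≡ φ⁻²· (a′ , + s) → Shape a t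
    high 0 () _ _
    high {a′} 1 _ p e = ⊥-elim (ℕ.<⇒≢ 3≤t (ℤ.+-injective (sym (trans (cong proj₂ e)
      (cong (λ z → + 1 ℤ.- z) (+-cancel-0 a′ (+ 1) (unit 1 (+ 1) p nonNeg! pos!)))))))
    high 2 _ p _ = ⊥-elim (no-integer-In (+ 0) (In-shift (+ 3 , -[1+ 1 ]) p) nonNeg! pos!)
    high {a′} (suc (suc (suc s))) _ p e = base (inB-index (In-shift {ξ = a′ , + suc (suc (suc s))} (+ 3 , -[1+ 1 ]) p))
      where
      base : ∃[ i ] (1 ℕ.≤ i × (a′ ℤ.+ + 3 , + suc s) ≡ φ⁻²· (ℤ.- + ⌊φ i ⌋ , + i)) → Shape a t
      -- The number is B(i) + 2, and 2 contributes φ⁻³ = φ⁻² · φ⁻¹ to θ. Pulling out φ⁻² adds φ⁻¹ to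
      -- the point of `i`, which makes it the point of i + 1.
      base (i , 1≤i , e′) = 1 , i , trans e (cong φ⁻²·_ (begin
        (a′ , + suc (suc (suc s)))                        ≡⟨ cong₂ _,_ (lemma₁ a′) (cong +_ (ℕ.+-comm 2 (suc s))) ⟩
        (a′ ℤ.+ + 3 , + suc s) ⊕ φ⁻²· c₆₁₈                ≡⟨ cong (_⊕ φ⁻²· c₆₁₈) e′ ⟩
        φ⁻²· (ℤ.- + ⌊φ i ⌋ , + i) ⊕ φ⁻²· c₆₁₈             ≡⟨ cong₂ _,_ (lemma₂ (+ ⌊φ i ⌋) (+ i)) (lemma₃ (+ ⌊φ i ⌋) (+ i)) ⟩
        φ⁻²· ((ℤ.- + ⌊φ i ⌋ , + i) ⊕ c₆₁₈)                ≡⟨ cong φ⁻²·_ (γ-start (+ ⌊φ i ⌋) (+ i)) ⟩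
        φ⁻²· (ℤ.- + suc ⌊φ i ⌋ , + suc i)                 ∎)) , inj₂ (ℕ.≤-refl , 1≤i)
        where
        open ≡-Reasoning
        lemma₁ : ∀ a → a ≡ a ℤ.+ + 3 ℤ.+ -[1+ 2 ]
        lemma₁ = solve-∀
        lemma₂ : ∀ f i → ℤ.- f ℤ.+ ℤ.- f ℤ.- i ℤ.+ -[1+ 2 ] ≡ ℤ.- f ℤ.+ -[1+ 0 ] ℤ.+ (ℤ.- f ℤ.+ -[1+ 0 ]) ℤ.- (i ℤ.+ + 1)
        lemma₂ = solve-∀
        lemma₃ : ∀ f i → i ℤ.- ℤ.- f ℤ.+ + 2 ≡ i ℤ.+ + 1 ℤ.- (ℤ.- f ℤ.+ -[1+ 0 ])
        lemma₃ = solve-∀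

    descend : In c₀ c₂₃₆ (a , + t) → Shape a t
    descend p = split (φ²-index {a} {t} (lower p))
      where
      split : ∃[ s ] (1 ℕ.≤ s × φ· φ· (a , + t) ≡ (a ℤ.+ + t , + s)) → Shape a t
      split (s , 1≤s , e) = cases (In-split c₂₃₆ r)
        where
        r : In c₀ c₆₁₈ (a ℤ.+ + t , + s)
        r = subst (In c₀ c₆₁₈) e (In-φ (In-φ p))
        back : (a , + t) ≡ φ⁻²· (a ℤ.+ + t , + s)
        back = trans (sym (φ⁻²φ² (a , + t))) (cong φ⁻²·_ e)
        cases : In c₀ c₂₃₆ (a ℤ.+ + t , + s) ⊎ In c₂₃₆ c₆₁₈ (a ℤ.+ + t , + s) → Shape a t
        cases (inj₁ l) = low s 1≤s (smaller 1≤s r back) l back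
        cases (inj₂ h) = high s 1≤s h back

  step : ∀ t → (∀ {s} → s ℕ.< t → 2 ℕ.≤ s → ∀ a → In c₀ c₂₃₆ (a , + s) → Shape a s) →
         2 ℕ.≤ t → ∀ a → In c₀ c₂₃₆ (a , + t) → Shape a t
  step 0 _ () _ _
  step 1 _ (ℕ.s≤s ()) _ _
  step 2 _ _ a p = 0 , 0 , trans (cong (_, + 2) (+-cancel-0 a (+ 3) (unit 2 (+ 3) p nonNeg! pos!)))
    (cong (λ f → φ⁻²· (ℤ.- + suc f , + 1)) (sym ⌊φ0⌋)) , inj₁ refl
  step t@(suc (suc (suc _))) rec _ a p = Step.descend t rec (ℕ.s≤s (ℕ.s≤s (ℕ.s≤s ℕ.z≤n))) a p

classAB₀-shape : ∀ {h} → ClassAB₀ h → ∃₂ λ m i → 2 ℕ.+ h ≡ γ i m × (i ≡ 0 ⊎ (1 ℕ.≤ m × 1 ℕ.≤ i))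
classAB₀-shape {h} (a , p) = coordinates (shape (2 ℕ.+ h) (ℕ.s≤s (ℕ.s≤s ℕ.z≤n)) (a ℤ.+ -[1+ 3 ])
  (subst (λ z → In c₀ c₂₃₆ (a ℤ.+ -[1+ 3 ] , z)) (ℤ.+-comm (+ h) (+ 2)) (In-shift (-[1+ 3 ] , + 2) p)))
  where
  coordinates : Shape (a ℤ.+ -[1+ 3 ]) (2 ℕ.+ h) → ∃₂ λ m i → 2 ℕ.+ h ≡ γ i m × (i ≡ 0 ⊎ (1 ℕ.≤ m × 1 ℕ.≤ i))
  coordinates (m , i , e , c) = m , i , ℤ.+-injective (trans (cong proj₂ e) (γ-coord i m)) , c

δ-In : ∀ i m → 1 ℕ.≤ i → In c₀ (shrink (suc m) c₁) (proj₁ (shrink (suc m) (ℤ.- + ⌊φ i ⌋ , + i)) , + δ i m)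
δ-In i m 1≤i = subst₂ (λ l z → In l (shrink (suc m) c₁) (proj₁ (shrink (suc m) (ℤ.- + ⌊φ i ⌋ , + i)) , z))
  (shrink-c₀ (suc m)) (δ-coord i m) (In-shrink (suc m) (floor-In i 1≤i))

-- So from the heap γ i m - 2 Right may take `δ i m`, leaving F(2m+3) - 2 with value s(m).
δ-fracB : ∀ i m → 1 ℕ.≤ i → FracB (δ i m)
δ-fracB i m 1≤i = _ , In-widen {lo₁ = c₀} {hi₁ = c₃₈₂} nonNeg! (shrink-decreasing {c₁} nonNeg! (ℕ.s≤s (ℕ.z≤n {m}))) (δ-In i m 1≤i)

δ-near : ∀ i m → 1 ℕ.≤ m → 1 ℕ.≤ i → Frac c₀ c₁₄₆ (δ i m)
δ-near i m 1≤m 1≤i = _ , In-widen {lo₁ = c₀} {hi₁ = c₁₄₆} nonNeg! (shrink-decreasing {c₁} nonNeg! (ℕ.s≤s 1≤m)) (δ-In i m 1≤i)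

γ-classAB₀ : ∀ {h} i m → 1 ℕ.≤ m → 1 ℕ.≤ i → 2 ℕ.+ h ≡ γ i m → ClassAB₀ h
γ-classAB₀ {h} i m 1≤m 1≤i e = Frac-widen {lo₁ = c₇₆₄} {hi₁ = c₁} nonNeg! nonNeg!
  (Frac-shift (+ 4) -[1+ 1 ] h (cong (λ z → + z ℤ.+ -[1+ 1 ]) (trans (sym (γ-δ i m)) (sym e)))
    (_ , In-⊕ (proj₂ (δ-near i m 1≤m 1≤i)) near))
  where
  near : In c₀ (shrink 2 c₆₁₈) (ℤ.- + fe (suc m) , + fo (suc m))
  near = subst (In c₀ (shrink 2 c₆₁₈)) (fo-point (suc m)) (within
    (subst Pos (sym (⊝-c₀ (shrink (suc m) c₆₁₈))) (pos-shrink (suc m) (pos! {c₆₁₈})))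
    (shrink-decreasing {c₆₁₈} nonNeg! (ℕ.s≤s 1≤m)))

-- F(2m+3) - 1 is taken by Left, leaving δ i m - 1.
γ-A-move : ∀ {h} i m → 1 ℕ.≤ m → 1 ℕ.≤ i → 2 ℕ.+ h ≡ γ i m → ∃₂ λ k d → h ≡ k ℕ.+ d × 1 ℕ.≤ d × FracA d × ClassOne k
γ-A-move {h} i m 1≤m 1≤i e = move-to (δ i m) (fo (suc m)) (fracB-pos (δ-fracB i m 1≤i)) (fo-suc-≥2 m) refl refl
  where
  move-to : ∀ u v → 1 ℕ.≤ u → 2 ℕ.≤ v → u ≡ δ i m → v ≡ fo (suc m) → ∃₂ λ k d → h ≡ k ℕ.+ d × 1 ℕ.≤ d × FracA d × ClassOne k
  move-to (suc k) (suc (suc d)) _ _ e₁ e₂ = k , suc d ,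
    ℕ.+-cancelˡ-≡ 2 h (k ℕ.+ suc d) (trans e (trans (γ-δ i m) (trans (sym (cong₂ ℕ._+_ e₁ e₂)) (cong suc (ℕ.+-suc k (suc d)))))) ,
    ℕ.s≤s ℕ.z≤n ,
    Frac-widen {lo₁ = c₃₈₂} {hi₁ = c₁} nonNeg! nonNeg! (Frac-shift {c₀} {c₂₃₆} {suc (suc d)} (+ 2) -[1+ 0 ] (suc d) refl (subst (Frac c₀ c₂₃₆) (sym e₂) (_ , fo-In m))) ,
    Frac-widen {lo₁ = c₃₈₂} {hi₁ = c₆₁₈} nonNeg! nonNeg! (Frac-shift {c₀} {c₁₄₆} {suc k} (+ 2) -[1+ 0 ] k refl (subst (Frac c₀ c₁₄₆) (sym e₁) (δ-near i m 1≤m 1≤i)))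
  move-to _ 1 _ (ℕ.s≤s ()) _ _

-- If m′ < m, then φ times γ i m - F(2m′+3) is slightly below an integer.
γ-B-move : ∀ {k d} i m m′ → 2 ℕ.+ (k ℕ.+ d) ≡ γ i m → 2 ℕ.+ k ≡ fo (suc m′) → FracB d → m ℕ.≤ m′
γ-B-move {k} {d} i m m′ e e′ (a , p) = ℕ.≮⇒≥ λ m′<m → no-integer (+ 0)
  (subst (Open (c₀ ⊝ c₀) (c₃₈₂ ⊝ (c₀ ⊝ c₂₃₆))) (cong (a ℤ.- proj₁ w ,_) (trans (cong (λ z → + d ℤ.- z) w₂) (ℤ.+-inverseʳ (+ d))))
    (Open-⊝ p (w-In m′<m)))
  nonNeg! nonNeg!
  where
  g o w : ℤ[φ]
  g = γ-point i m
  o = shrink (suc m′) c₆₁₈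
  w = g ⊝ o
  w₂ : proj₂ w ≡ + d
  w₂ = trans (cong₂ ℤ._-_ (trans (γ-coord i m) (cong +_ (sym e))) (trans (cong proj₂ (fo-point (suc m′))) (cong +_ (sym e′)))) (lemma (+ k) (+ d))
    where
    lemma : ∀ k d → + 2 ℤ.+ (k ℤ.+ d) ℤ.- (+ 2 ℤ.+ k) ≡ d
    lemma = solve-∀
  w-In : m′ ℕ.< m → In (c₀ ⊝ c₂₃₆) c₀ w
  w-In m′<m = within
    (subst Pos (lemma₁ g o c₂₃₆) (pos-⊕ (pos-shrink (suc m) (subst Pos (⊝-c₀ _) (Open.lower (γ-start-In i)))) (shrink-decreasing {c₆₁₈} nonNeg! (ℕ.s≤s (ℕ.z≤n {m′})))))
    (subst NonNeg (lemma₂ (shrink m c₆₁₈) o g) (nonNeg-⊕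
      (shrink-decreasing {c₆₁₈} nonNeg! m′<m)
      (pos⇒nonNeg (subst Pos (trans (shrink-⊝ (suc m) (+ 0 , + 1) _) (cong (_⊝ g) (sym (shrink-φ⁻² m (+ 0 , + 1))))) (pos-shrink (suc m) (Open.upper (γ-start-In i)))))))
    where
    lemma₁ : ∀ g o c → g ⊕ (c ⊝ o) ≡ (g ⊝ o) ⊝ (c₀ ⊝ c)
    lemma₁ (a , a′) (b , b′) (c , c′) = cong₂ _,_ (eq a b c) (eq a′ b′ c′)
      where
      eq : ∀ g o c → g ℤ.+ (c ℤ.- o) ≡ (g ℤ.- o) ℤ.- (+ 0 ℤ.- c)
      eq = solve-∀
    lemma₂ : ∀ s o g → (o ⊝ s) ⊕ (s ⊝ g) ≡ c₀ ⊝ (g ⊝ o)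
    lemma₂ (a , a′) (b , b′) (c , c′) = cong₂ _,_ (eq a b c) (eq a′ b′ c′)
      where
      eq : ∀ s o g → (o ℤ.- s) ℤ.+ (s ℤ.- g) ≡ + 0 ℤ.- (g ℤ.- o)
      eq = solve-∀

-- The values of the heaps

range⁺-cong : ∀ {f g : ℕ → ℕ} {d} → (∀ n → f n ≡ g n) → Range⁺ f d → Range⁺ g d
range⁺-cong e (i , 1≤i , p) = i , 1≤i , trans (sym (e i)) p

A⇒fracA : ∀ {d} → Range⁺ A d → 1 ℕ.≤ d × FracA d
A⇒fracA p = inA⇒ (range⁺-cong A≡⌊φ⌋ p)

fracA⇒A : ∀ {d} → 1 ℕ.≤ d → FracA d → Range⁺ A d
fracA⇒A 1≤d p = range⁺-cong (λ n → sym (A≡⌊φ⌋ n)) (⇒inA 1≤d p)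

B⇒fracB : ∀ {d} → Range⁺ B d → 1 ℕ.≤ d × FracB d
B⇒fracB p = inB⇒ (range⁺-cong B≡⌊φ²⌋ p)

fracB⇒B : ∀ {d} → FracB d → Range⁺ B d
fracB⇒B p = range⁺-cong (λ n → sym (B≡⌊φ²⌋ n)) (⇒inB p)

heaps : ∀ {h} → List (Fin h) → List Game
heaps = map (λ k → heap (toℕ k))

∈-heaps⁺ : ∀ {P : ℕ → Set} (P? : ∀ d → Dec (P d)) {h} k d → h ≡ k ℕ.+ d → 1 ℕ.≤ d → P d →
  heap k ∈ heaps (filter (λ i → P? (h ℕ.∸ toℕ i)) (allFin h))
∈-heaps⁺ {P} P? {h} k d refl 1≤d p = subst (λ z → heap z ∈ heaps moves) (toℕ-fromℕ< k<h)
  (∈-map⁺ (λ i → heap (toℕ i)) (∈-filter⁺ (λ i → P? (h ℕ.∸ toℕ i)) (∈-allFin (fromℕ< k<h))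
    (subst P (sym (trans (cong (h ℕ.∸_) (toℕ-fromℕ< k<h)) (ℕ.m+n∸m≡n k d))) p)))
  where
  moves : List (Fin h)
  moves = filter (λ i → P? (h ℕ.∸ toℕ i)) (allFin h)
  k<h : k ℕ.< h
  k<h = ℕ.m<m+n k 1≤d

∈-heaps⁻ : ∀ {P : ℕ → Set} (P? : ∀ d → Dec (P d)) {h X} →
  X ∈ heaps (filter (λ i → P? (h ℕ.∸ toℕ i)) (allFin h)) → ∃₂ λ k d → h ≡ k ℕ.+ d × P d × X ≡ heap k
∈-heaps⁻ {P} P? {h} X∈ =
  let i , i∈ , e = ∈-map⁻ (λ i → heap (toℕ i)) X∈
      _ , p      = ∈-filter⁻ (λ i → P? (h ℕ.∸ toℕ i)) {xs = allFin h} i∈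
  in toℕ i , h ℕ.∸ toℕ i , sym (ℕ.m+[n∸m]≡n (ℕ.<⇒≤ (toℕ<n i))) , p , e

abstract
  -- From here on heaps are seen only through these rules for their options.
  H : ℕ → Game
  H = heap

  H≡heap : ∀ h → H h ≡ heap h
  H≡heap h = refl

  H-0 : H 0 ≡ 0ᴳ
  H-0 = refl

  H-1 : H 1 ≡ 1ᴳ
  H-1 = refl

  left-H⁺ : ∀ {h k d} → h ≡ k ℕ.+ d → 1 ℕ.≤ d → FracA d → H k ∈ left (H h)
  left-H⁺ {h} {k} {d} e 1≤d p = subst (λ G → heap k ∈ left G) (sym (heap-unfold h))
    (∈-heaps⁺ (range⁺? A n≤A) k d e 1≤d (fracA⇒A 1≤d p))

  right-H⁺ : ∀ {h k d} → h ≡ k ℕ.+ d → FracB d → H k ∈ right (H h)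
  right-H⁺ {h} {k} {d} e p = subst (λ G → heap k ∈ right G) (sym (heap-unfold h))
    (∈-heaps⁺ (range⁺? B n≤B) k d e (fracB-pos p) (fracB⇒B p))

  left-H⁻ : ∀ {h X} → X ∈ left (H h) → ∃₂ λ k d → h ≡ k ℕ.+ d × (1 ℕ.≤ d × FracA d) × X ≡ H k
  left-H⁻ {h} {X} X∈ =
    let k , d , e , p , x = ∈-heaps⁻ (range⁺? A n≤A) (subst (λ G → X ∈ left G) (heap-unfold h) X∈)
    in k , d , e , A⇒fracA p , x

  right-H⁻ : ∀ {h X} → X ∈ right (H h) → ∃₂ λ k d → h ≡ k ℕ.+ d × (1 ℕ.≤ d × FracB d) × X ≡ H k
  right-H⁻ {h} {X} X∈ =
    let k , d , e , p , x = ∈-heaps⁻ (range⁺? B n≤B) (subst (λ G → X ∈ right G) (heap-unfold h) X∈)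
    in k , d , e , B⇒fracB p , x

≡⇒≈ : ∀ {G K} → G ≡ K → G ≈ K
≡⇒≈ refl = ≈-refl _

-- The numbers s(n) and q(n) as games

sᴳ qᴳ : ℕ → Game
sᴳ zero    = 0ᴳ
sᴳ (suc n) = ⟨ sᴳ n ∷ [] ∣ qᴳ n ∷ [] ⟩
qᴳ zero    = 1ᴳ
qᴳ (suc n) = ⟨ sᴳ (suc n) ∷ [] ∣ qᴳ n ∷ [] ⟩

-- third n = (4ⁿ - 1) / 3
third : ℕ → ℤ
third zero    = + 0
third (suc n) = ℤ.suc (double (double (third n)))

-- s(n) and q(n) are neighbours on the grid of 1/4ⁿ, and so are s(n+1) and q(n) on that of 1/(2·4ⁿ).
-- Hence the recursive trees are literally those that `dyadic` builds for the midpoints.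
sᴳ-dyadic : ∀ n → sᴳ n ≡ dyadic (double (third n)) (n ℕ.* 2)
qᴳ-dyadic : ∀ n → qᴳ n ≡ dyadic (ℤ.suc (double (third n))) (n ℕ.* 2)
sᴳ-odd    : ∀ n → sᴳ (suc n) ≡ dyadic (third (suc n)) (suc (n ℕ.* 2))
sᴳ-dyadic zero    = refl
sᴳ-dyadic (suc n) = trans (sᴳ-odd n) (sym (dyadic-double (third (suc n)) (suc (n ℕ.* 2))))
sᴳ-odd n = trans (cong₂ (λ L R → ⟨ L ∷ [] ∣ R ∷ [] ⟩) (sᴳ-dyadic n) (qᴳ-dyadic n)) (sym (dyadic-odd (double (third n)) (n ℕ.* 2)))
qᴳ-dyadic zero    = refl
qᴳ-dyadic (suc n) = trans
  (cong₂ (λ L R → ⟨ L ∷ [] ∣ R ∷ [] ⟩) (sᴳ-odd n)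
    (trans (qᴳ-dyadic n) (trans (sym (dyadic-double (ℤ.suc (double (third n))) (n ℕ.* 2)))
      (cong (λ z → dyadic z (suc (n ℕ.* 2))) (sym (suc-suc-double (double (third n))))))))
  (sym (dyadic-odd (third (suc n)) (suc (n ℕ.* 2))))

isDyadic-s : ∀ n → IsDyadic (sᴳ n)
isDyadic-s n = double (third n) , n ℕ.* 2 , sᴳ-dyadic n

isDyadic-q : ∀ n → IsDyadic (qᴳ n)
isDyadic-q n = ℤ.suc (double (third n)) , n ℕ.* 2 , qᴳ-dyadic n

isDyadic-≽-left : ∀ {S L} → IsDyadic S → L ∈ left S → S ≽ L
isDyadic-≽-left (m , k , refl) = ≽-left k m

isDyadic-right-≽ : ∀ {S R} → IsDyadic S → R ∈ right S → R ≽ S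
isDyadic-right-≽ (m , k , refl) = right-≽′ k m

s-mono : ∀ m n → m ℕ.≤ n → sᴳ n ≽ sᴳ m
s-mono m n m≤n = go (ℕ.≤⇒≤′ m≤n)
  where
  go : ∀ {n} → m ℕ.≤′ n → sᴳ n ≽ sᴳ m
  go (ℕ.≤′-reflexive refl) = ≽-refl (sᴳ m)
  go (ℕ.≤′-step {n} p) = ≽-trans (isDyadic-≽-left (isDyadic-s (suc n)) (here refl)) (go p)

q-mono : ∀ m n → m ℕ.≤ n → qᴳ m ≽ qᴳ n
q-mono m n m≤n = go (ℕ.≤⇒≤′ m≤n)
  where
  go : ∀ {n} → m ℕ.≤′ n → qᴳ m ≽ qᴳ n
  go (ℕ.≤′-reflexive refl) = ≽-refl (qᴳ m)
  go (ℕ.≤′-step {n} p) = ≽-trans (go p) (isDyadic-right-≽ (isDyadic-q (suc n)) (here refl))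

qₙ⊳sₙ : ∀ n → qᴳ n ⊳ sᴳ n
qₙ⊳sₙ zero    = ⊳-left (here refl)
qₙ⊳sₙ (suc n) = ⊳-left (here refl)

q⊳s : ∀ n m → qᴳ n ⊳ sᴳ m
q⊳s n m with ℕ.≤-total m n
... | inj₁ m≤n = ⊳-≽-trans (qₙ⊳sₙ n) (s-mono m n m≤n)
... | inj₂ n≤m = ≽-⊳-trans (q-mono n m n≤m) (qₙ⊳sₙ m)

1⊳s : ∀ n → 1ᴳ ⊳ sᴳ n
1⊳s = q⊳s 0

q⊳q-suc : ∀ n → qᴳ n ⊳ qᴳ (suc n)
q⊳q-suc n = right-⊳ (here refl)

1⊳q : ∀ n → 1 ℕ.≤ n → 1ᴳ ⊳ qᴳ n
1⊳q n 1≤n = ⊳-≽-trans (q⊳q-suc 0) (q-mono 1 n 1≤n)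

s≽0 : ∀ n → sᴳ n ≽ 0ᴳ
s≽0 n = s-mono 0 n ℕ.z≤n

dyadic-left : ∀ {S L} → IsDyadic S → L ∈ left S → IsDyadic L
dyadic-left (m , k , refl) = left-dyadic k m

dyadic-right : ∀ {S R} → IsDyadic S → R ∈ right S → IsDyadic R
dyadic-right (m , k , refl) = right-dyadic k m

-- A dyadic strictly between `T` and `U` absorbs the infinitesimal.
⊵⇒⊳ : ∀ {G T U} → IsDyadic T → IsDyadic U → G ⊵ T → T ⊳ U → G ⊳ U
⊵⇒⊳ t u p T⊳U = let V , v , T⊳V , V⊳U = dyadic-dense t u T⊳U in ≽-⊳-trans (p v T⊳V) V⊳U

⊴⇒⊳ : ∀ {G T U} → IsDyadic T → IsDyadic U → G ⊴ T → U ⊳ T → U ⊳ G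
⊴⇒⊳ t u p U⊳T = let V , v , U⊳V , V⊳T = dyadic-dense u t U⊳T in ⊳-≽-trans U⊳V (p v V⊳T)

fracB-2 : FracB 2
fracB-2 = -[1+ 2 ] , within pos! nonNeg!

-- Left can always take 1 = A(1) as long as counters remain, so she is never short of a move by more
-- than an infinitesimal.
H-⊵0 : ∀ h → H h ⊵ 0ᴳ
H-⊵0 = <-rec (λ h → H h ⊵ 0ᴳ) step
  where
  right-case : ∀ h → (∀ {k} → k ℕ.< h → H k ⊵ 0ᴳ) → ∀ {U R} → IsDyadic U → 0ᴳ ⊳ U →
    (∃₂ λ k d → h ≡ k ℕ.+ d × (1 ℕ.≤ d × FracB d) × R ≡ H k) → R ⊳ U
  right-case h rec u p (k , d , refl , (1≤d , _) , refl) = ⊵⇒⊳ isDyadic-0 u (rec (ℕ.m<m+n k 1≤d)) p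
  step : ∀ h → (∀ {k} → k ℕ.< h → H k ⊵ 0ᴳ) → H h ⊵ 0ᴳ
  step zero rec {U} u p = subst (_≽ U) (sym H-0) (dyadic-⊳⇒≽ isDyadic-0 u p)
  step (suc h) rec {U} u p = second
    (λ R∈ → right-case (suc h) rec u p (right-H⁻ R∈))
    (λ L∈ → byLeft (left-H⁺ (ℕ.+-comm 1 h) ℕ.≤-refl fracA-1)
      (rec (ℕ.n<1+n h) (dyadic-left u L∈) (⊳-≽-trans p (isDyadic-≽-left u L∈))))

-- Right can take 2 = B(1) from any heap except 0 and 1, whose values are 0 and 1.
H-⊴1 : ∀ h → H h ⊴ 1ᴳ
H-⊴1 = <-rec (λ h → H h ⊴ 1ᴳ) step
  where
  left-case : ∀ h → (∀ {k} → k ℕ.< h → H k ⊴ 1ᴳ) → ∀ {U L} → IsDyadic U → U ⊳ 1ᴳ →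
    (∃₂ λ k d → h ≡ k ℕ.+ d × (1 ℕ.≤ d × FracA d) × L ≡ H k) → U ⊳ L
  left-case h rec u p (k , d , refl , (1≤d , _) , refl) = ⊴⇒⊳ isDyadic-1 u (rec (ℕ.m<m+n k 1≤d)) p
  step : ∀ h → (∀ {k} → k ℕ.< h → H k ⊴ 1ᴳ) → H h ⊴ 1ᴳ
  step zero rec {U} u p = subst (U ≽_) (sym H-0) (≽-trans (dyadic-⊳⇒≽ u isDyadic-1 p) (suc-≽ 0 (+ 0)))
  step (suc zero) rec {U} u p = subst (U ≽_) (sym H-1) (dyadic-⊳⇒≽ u isDyadic-1 p)
  step (suc (suc h)) rec {U} u p = second
    (λ R∈ → byRight (right-H⁺ (ℕ.+-comm 2 h) fracB-2)
      (rec (ℕ.m<n⇒m<1+n (ℕ.n<1+n h)) (dyadic-right u R∈) (≽-⊳-trans (isDyadic-right-≽ u R∈) p)))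
    (λ L∈ → left-case (suc (suc h)) rec u p (left-H⁻ L∈))

-- The simultaneous induction on heaps

HasOne : ℕ → Set
HasOne h = ∃[ M ] (M ∈ left (H h) × M ⊵ 1ᴳ)

HasRight : ℕ → Game → Set
HasRight h S = ∃[ R ] (R ∈ right (H h) × R ≈ S)

-- `size` and `S≽q` link the value to the size: a heap of this class below F(2n+6) - 2 has value at
-- least q(n). The Right options in `step-que` are controlled by this.
record NumberValue (h : ℕ) : Set where
  field
    S     : Game
    isDy  : IsDyadic S
    value : H h ≈ S
    1⊳S   : 1ᴳ ⊳ S
    n     : ℕ
    1≤n   : 1 ℕ.≤ n
    size  : fe (suc n) ℕ.≤ 2 ℕ.+ h
    S≽q   : S ≽ qᴳ n

record Values (h : ℕ) : Set where
  field
    one : ClassOne h → H h ⊵ 1ᴳ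
    bee : FracB h → HasOne h
    num : ClassNum h → NumberValue h
    gee : ∀ i m → 1 ℕ.≤ m → 1 ℕ.≤ i → 2 ℕ.+ h ≡ γ i m → HasOne h × HasRight h (sᴳ m)
    ess : ∀ m → 2 ℕ.+ h ≡ fo (suc m) → H h ≈ sᴳ m
    que : ∀ n → 2 ℕ.+ h ≡ fe (suc n) → H h ≈ qᴳ n

open Values

data View (k : ℕ) : Set where
  is-hot    : FracB k → HasOne k → View k
  is-one    : ClassOne k → H k ⊵ 1ᴳ → View k
  is-number : ClassNum k → NumberValue k → View k
  is-ess    : ∀ m → 2 ℕ.+ k ≡ fo (suc m) → H k ≈ sᴳ m → View k
  is-gee    : ∀ i m → 1 ℕ.≤ m → 1 ℕ.≤ i → 2 ℕ.+ k ≡ γ i m → HasOne k → HasRight k (sᴳ m) → View k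

view-AB₀ : ∀ {k} → Values k → (∃₂ λ m i → 2 ℕ.+ k ≡ γ i m × (i ≡ 0 ⊎ (1 ℕ.≤ m × 1 ℕ.≤ i))) → View k
view-AB₀ v (m , _ , e , inj₁ refl)        = is-ess m (trans e (γ-0 m)) (ess v m (trans e (γ-0 m)))
view-AB₀ v (m , i , e , inj₂ (1≤m , 1≤i)) = is-gee i m 1≤m 1≤i e (proj₁ (gee v i m 1≤m 1≤i e)) (proj₂ (gee v i m 1≤m 1≤i e))

view : ∀ {k} → Values k → View k
view {k} v with classify k
... | inB p   = is-hot p (bee v p)
... | inOne p = is-one p (one v p)
... | inNum p = is-number p (num v p)
... | inAB₀ p = view-AB₀ v (classAB₀-shape p)

H0-right : ∀ {k} → FracB k → HasRight k 0ᴳ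
H0-right p = H 0 , right-H⁺ refl p , ≡⇒≈ H-0

⊳-hasRight : ∀ {U k S} → HasRight k S → U ≽ S → U ⊳ H k
⊳-hasRight (R , R∈ , _ , S≽R) p = byRight R∈ (≽-trans p S≽R)

hasOne-⊳ : ∀ {U k} → IsDyadic U → HasOne k → 1ᴳ ⊳ U → H k ⊳ U
hasOne-⊳ u (M , M∈ , M⊵1) p = byLeft M∈ (M⊵1 u p)

remove : ∀ {u t} v → 2 ℕ.≤ u → t ≡ u ℕ.+ v → ∀ {h} → 2 ℕ.+ h ≡ t → ∃[ k ] (2 ℕ.+ k ≡ u × h ≡ k ℕ.+ v)
remove {suc (suc k)} v _ refl {h} e = k , refl , ℕ.suc-injective (ℕ.suc-injective e)
remove {suc zero} v (ℕ.s≤s ()) _ _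

module Step (h : ℕ) (rec : ∀ {k} → k ℕ.< h → Values k) where

  rec′ : ∀ {k d} → h ≡ k ℕ.+ d → 1 ℕ.≤ d → Values k
  rec′ {k} refl 1≤d = rec (ℕ.m<m+n k 1≤d)

  hasOne : (∃₂ λ k d → h ≡ k ℕ.+ d × 1 ℕ.≤ d × FracA d × ClassOne k) → HasOne h
  hasOne (k , d , e , 1≤d , a , c) = H k , left-H⁺ e 1≤d a , one (rec′ e 1≤d) c

  step-bee : FracB h → HasOne h
  step-bee p = hasOne (classB-A-move h p)

  step-gee : ∀ i m → 1 ℕ.≤ m → 1 ℕ.≤ i → 2 ℕ.+ h ≡ γ i m → HasOne h × HasRight h (sᴳ m)
  step-gee i m 1≤m 1≤i e = hasOne (γ-A-move i m 1≤m 1≤i e) ,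
    to-s (remove (δ i m) (fo-suc-≥2 m) (trans (γ-δ i m) (ℕ.+-comm (δ i m) (fo (suc m)))) e)
    where
    to-s : ∃[ k ] (2 ℕ.+ k ≡ fo (suc m) × h ≡ k ℕ.+ δ i m) → HasRight h (sᴳ m)
    to-s (k , e′ , e″) = H k , right-H⁺ e″ (δ-fracB i m 1≤i) , ess (rec′ e″ (fracB-pos (δ-fracB i m 1≤i))) m e′

  -- Right's moves lead to the same class or to B, and in B Left restores about 1. Left's own
  -- resource is the move to the heap 1.
  step-one : ClassOne h → H h ⊵ 1ᴳ
  step-one c {U} u 1⊳U = second (λ R∈ → rights (right-H⁻ R∈)) (λ L∈ → lefts (classOne-A-move h c) L∈)
    where
    rights : ∀ {R} → (∃₂ λ k d → h ≡ k ℕ.+ d × (1 ℕ.≤ d × FracB d) × R ≡ H k) → R ⊳ U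
    rights (k , d , e , (1≤d , b) , refl) = by-class (classify k)
      where
      c′ : ClassOne (k ℕ.+ d)
      c′ = subst ClassOne e c
      by-class : Class k → H k ⊳ U
      by-class (inB p)   = hasOne-⊳ u (bee (rec′ e 1≤d) p) 1⊳U
      by-class (inOne p) = ⊵⇒⊳ isDyadic-1 u (one (rec′ e 1≤d) p) 1⊳U
      by-class (inNum p) = ⊥-elim (B-move-from-One b c′ (Frac-widen {lo₁ = c₆₁₈} {hi₁ = c₁} nonNeg! nonNeg! p))
      by-class (inAB₀ p) = ⊥-elim (B-move-from-One b c′ (Frac-widen {lo₁ = c₆₁₈} {hi₁ = c₁} nonNeg! nonNeg! p))
    lefts : h ≡ 1 ⊎ (∃[ d ] (h ≡ 1 ℕ.+ d × 1 ℕ.≤ d × FracA d)) → ∀ {L} → L ∈ left U → H h ⊳ L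
    lefts (inj₁ e) {L} L∈ = subst (_⊳ L) (sym (trans (cong H e) H-1)) (⊳-≽-trans 1⊳U (isDyadic-≽-left u L∈))
    lefts (inj₂ (d , e , 1≤d , a)) {L} L∈ = byLeft (left-H⁺ e 1≤d a) (subst (_≽ L) (sym H-1)
      (≽-trans (dyadic-⊳⇒≽ isDyadic-1 u 1⊳U) (isDyadic-≽-left u L∈)))

  -- For F(2m+5) - 2 Left takes F(2m+4), leaving s(m), and Right takes F(2m+3), leaving q(m). Every
  -- other option is hot and answered at once, excluded by its class, or no better; Right's moves to
  -- a smaller F(2m′+3) - 2 are excluded by `γ-B-move`.
  step-ess : ∀ m → 2 ℕ.+ h ≡ fo (suc m) → H h ≈ sᴳ m
  step-ess zero e = ≡⇒≈ (trans (cong H (ℕ.suc-injective (ℕ.suc-injective e))) H-0)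
  step-ess (suc m) e =
    second (λ R∈ → rights (right-H⁻ R∈)) (λ { (here refl) → to-s (remove (fe (suc m)) (fo-suc-≥2 m) refl e) }) ,
    second (λ { (here refl) → to-q (remove (fo (suc m)) (fe-suc-≥2 m) (ℕ.+-comm (fo (suc m)) (fe (suc m))) e) }) (λ L∈ → lefts (left-H⁻ L∈))
    where
    to-s : ∃[ k ] (2 ℕ.+ k ≡ fo (suc m) × h ≡ k ℕ.+ fe (suc m)) → H h ⊳ sᴳ m
    to-s (k , e′ , e″) = byLeft (left-H⁺ e″ (fe-pos (suc m)) (fe-fracA (suc m))) (proj₁ (ess (rec′ e″ (fe-pos (suc m))) m e′))
    to-q : ∃[ k ] (2 ℕ.+ k ≡ fe (suc m) × h ≡ k ℕ.+ fo (suc m)) → qᴳ m ⊳ H h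
    to-q (k , e′ , e″) = byRight (right-H⁺ e″ (fo-fracB m)) (proj₂ (que (rec′ e″ (fo-pos (suc m))) m e′))
    smaller : ∀ {k d} → h ≡ k ℕ.+ d → 1 ℕ.≤ d → 2 ℕ.+ k ℕ.< fo (suc (suc m))
    smaller {k} refl 1≤d = subst (2 ℕ.+ k ℕ.<_) e (ℕ.+-monoʳ-< 2 (ℕ.m<m+n k 1≤d))
    rights : ∀ {R} → (∃₂ λ k d → h ≡ k ℕ.+ d × (1 ℕ.≤ d × FracB d) × R ≡ H k) → R ⊳ sᴳ (suc m)
    rights (k , d , e′ , (1≤d , b) , refl) = by-view (view (rec′ e′ 1≤d))
      where
      by-view : View k → H k ⊳ sᴳ (suc m)
      by-view (is-hot _ o)           = hasOne-⊳ (isDyadic-s (suc m)) o (1⊳s (suc m))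
      by-view (is-one _ o)           = ⊵⇒⊳ isDyadic-1 (isDyadic-s (suc m)) o (1⊳s (suc m))
      by-view (is-number _ v)        = ≽-⊳-trans (≽-trans (proj₁ (NumberValue.value v)) (NumberValue.S≽q v)) (q⊳s (NumberValue.n v) (suc m))
      by-view (is-gee _ _ _ _ _ o _) = hasOne-⊳ (isDyadic-s (suc m)) o (1⊳s (suc m))
      by-view (is-ess m′ e″ _)       = ⊥-elim (ℕ.<⇒≱ (ℕ.≤-pred (fo-cancel-< (subst (ℕ._< fo (suc (suc m))) e″ (smaller e′ 1≤d))))
        (γ-B-move 0 (suc m) m′ (trans (cong (2 ℕ.+_) (sym e′)) (trans e (sym (γ-0 (suc m))))) e″ b))
    lefts : ∀ {L} → (∃₂ λ k d → h ≡ k ℕ.+ d × (1 ℕ.≤ d × FracA d) × L ≡ H k) → sᴳ (suc m) ⊳ L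
    lefts (k , d , e′ , (1≤d , a) , refl) = by-view (view (rec′ e′ 1≤d))
      where
      below : ∀ {m′ t} → 2 ℕ.+ k ≡ t → fo (suc m′) ℕ.≤ t → m′ ℕ.≤ m
      below e″ le = ℕ.≤-pred (ℕ.≤-pred (fo-cancel-< (ℕ.≤-<-trans le (subst (ℕ._< fo (suc (suc m))) e″ (smaller e′ 1≤d)))))
      by-view : View k → sᴳ (suc m) ⊳ H k
      by-view (is-hot b _)     = ⊳-hasRight (H0-right b) (s≽0 (suc m))
      by-view (is-one c _)     = ⊥-elim (fo-no-classOne (suc m) (trans (cong (2 ℕ.+_) (sym e′)) e) a c)
      by-view (is-number c _)  = ⊥-elim (A-move-from-AB₀ a (subst ClassAB₀ e′ (fo-classAB₀ (suc m) e)) c)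
      by-view (is-ess m′ e″ v) = ⊳-≽-trans (⊳-left (here refl)) (≽-trans (s-mono m′ m (below {m′} e″ ℕ.≤-refl)) (proj₂ v))
      by-view (is-gee i m′ _ _ e″ _ r) = ⊳-hasRight r (s-mono m′ (suc m) (ℕ.m≤n⇒m≤1+n (below {m′} e″ (fo≤γ i m′))))

  -- For F(2n+6) - 2 Left takes F(2n+4), leaving s(n+1), and Right takes F(2n+5), leaving q(n).
  -- Other numbers among Right's options are at least q(n) by their size; Left has none in the class
  -- B² + 1.
  step-que : ∀ n → 2 ℕ.+ h ≡ fe (suc n) → H h ≈ qᴳ n
  step-que zero e = ≡⇒≈ (trans (cong H (ℕ.suc-injective (ℕ.suc-injective e))) H-1)
  step-que (suc n) e =
    second (λ R∈ → rights (right-H⁻ R∈)) (λ { (here refl) → to-s (remove (fe (suc n)) (fo-suc-≥2 (suc n)) refl e) }) ,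
    second (λ { (here refl) → to-q (remove (fo (suc (suc n))) (fe-suc-≥2 n) (ℕ.+-comm (fo (suc (suc n))) (fe (suc n))) e) }) (λ L∈ → lefts (left-H⁻ L∈))
    where
    c : ClassNum h
    c = fe-classNum (suc n) (ℕ.s≤s ℕ.z≤n) e
    to-s : ∃[ k ] (2 ℕ.+ k ≡ fo (suc (suc n)) × h ≡ k ℕ.+ fe (suc n)) → H h ⊳ sᴳ (suc n)
    to-s (k , e′ , e″) = byLeft (left-H⁺ e″ (fe-pos (suc n)) (fe-fracA (suc n))) (proj₁ (ess (rec′ e″ (fe-pos (suc n))) (suc n) e′))
    to-q : ∃[ k ] (2 ℕ.+ k ≡ fe (suc n) × h ≡ k ℕ.+ fo (suc (suc n))) → qᴳ n ⊳ H h
    to-q (k , e′ , e″) = byRight (right-H⁺ e″ (fo-fracB (suc n))) (proj₂ (que (rec′ e″ (fo-pos (suc (suc n)))) n e′))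
    rights : ∀ {R} → (∃₂ λ k d → h ≡ k ℕ.+ d × (1 ℕ.≤ d × FracB d) × R ≡ H k) → R ⊳ qᴳ (suc n)
    rights (k , d , e′ , (1≤d , b) , refl) = by-class (classify k)
      where
      by-number : NumberValue k → H k ⊳ qᴳ (suc n)
      by-number v = ≽-⊳-trans (≽-trans (proj₁ value) (≽-trans S≽q (q-mono n′ n n′≤n))) (q⊳q-suc n)
        where
        open NumberValue v renaming (n to n′)
        n′≤n : n′ ℕ.≤ n
        n′≤n = ℕ.≤-pred (ℕ.≤-pred (fe-cancel-< (ℕ.≤-<-trans size (subst (2 ℕ.+ k ℕ.<_) (trans (cong (2 ℕ.+_) (sym e′)) e) (ℕ.+-monoʳ-< 2 (ℕ.m<m+n k 1≤d))))))
      by-class : Class k → H k ⊳ qᴳ (suc n)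
      by-class (inB p)   = hasOne-⊳ (isDyadic-q (suc n)) (bee (rec′ e′ 1≤d) p) (1⊳q (suc n) (ℕ.s≤s ℕ.z≤n))
      by-class (inOne p) = ⊵⇒⊳ isDyadic-1 (isDyadic-q (suc n)) (one (rec′ e′ 1≤d) p) (1⊳q (suc n) (ℕ.s≤s ℕ.z≤n))
      by-class (inNum p) = by-number (num (rec′ e′ 1≤d) p)
      by-class (inAB₀ p) = ⊥-elim (B-move-from-Num b (subst ClassNum e′ c) p)
    lefts : ∀ {L} → (∃₂ λ k d → h ≡ k ℕ.+ d × (1 ℕ.≤ d × FracA d) × L ≡ H k) → qᴳ (suc n) ⊳ L
    lefts (k , d , e′ , (1≤d , a) , refl) = by-view (view (rec′ e′ 1≤d))
      where
      by-view : View k → qᴳ (suc n) ⊳ H k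
      by-view (is-hot b _)     = ⊳-hasRight (H0-right b) (dyadic-⊳⇒≽ (isDyadic-q (suc n)) isDyadic-0 (q⊳s (suc n) 0))
      by-view (is-one p _)     = ⊥-elim (A-move-from-Num a (subst ClassNum e′ c) p)
      by-view (is-number p _)  = ⊥-elim (fe-no-classNum (suc n) (ℕ.s≤s ℕ.z≤n) (trans (cong (2 ℕ.+_) (sym e′)) e) 1≤d a p)
      by-view (is-ess m _ v)   = ⊳-≽-trans (q⊳s (suc n) m) (proj₂ v)
      by-view (is-gee _ m _ _ _ _ r) = ⊳-hasRight r (dyadic-⊳⇒≽ (isDyadic-q (suc n)) (isDyadic-s m) (q⊳s (suc n) m))

  module _ (c : ClassNum h) where

    -- An option may be hot and then has no value to compare. A dyadic stands in for it: 1 for a hot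
    -- Right option, 0 or s(m) for a hot Left option.
    Above Below : Game → Game → Set
    Above R r = ∀ {x} → IsDyadic x → r ⊳ x → R ⊳ x
    Below L l = ∀ {x} → IsDyadic x → x ⊳ l → x ⊳ L

    Separates : Game → Set
    Separates r = r ⊳ 0ᴳ × (∀ {L} → L ∈ left (H h) → ∃[ l ] (IsDyadic l × r ⊳ l × Below L l))

    separates : ∀ {r} → r ⊳ 0ᴳ → (∀ m → r ⊳ sᴳ m) →
      (∀ {k d} → h ≡ k ℕ.+ d → 1 ℕ.≤ d → FracA d → ClassNum k → (v : NumberValue k) → r ⊳ NumberValue.S v) → Separates r
    separates {r} r⊳0 r⊳s r⊳num = r⊳0 , λ L∈ → lefts (left-H⁻ L∈)
      where
      lefts : ∀ {L} → (∃₂ λ k d → h ≡ k ℕ.+ d × (1 ℕ.≤ d × FracA d) × L ≡ H k) → ∃[ l ] (IsDyadic l × r ⊳ l × Below L l)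
      lefts (k , d , e , (1≤d , a) , refl) = by-view (view (rec′ e 1≤d))
        where
        by-view : View k → ∃[ l ] (IsDyadic l × r ⊳ l × Below (H k) l)
        by-view (is-hot b _)    = 0ᴳ , isDyadic-0 , r⊳0 , λ x p → ⊳-hasRight (H0-right b) (dyadic-⊳⇒≽ x isDyadic-0 p)
        by-view (is-one p _)    = ⊥-elim (A-move-from-Num a (subst ClassNum e c) p)
        by-view (is-number p v) = NumberValue.S v , NumberValue.isDy v , r⊳num e 1≤d a p v , λ _ q → ⊳-≽-trans q (proj₂ (NumberValue.value v))
        by-view (is-ess m _ v)  = sᴳ m , isDyadic-s m , r⊳s m , λ _ q → ⊳-≽-trans q (proj₂ v)
        by-view (is-gee _ m _ _ _ _ r) = sᴳ m , isDyadic-s m , r⊳s m , λ x p → ⊳-hasRight r (dyadic-⊳⇒≽ x (isDyadic-s m) p)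

    separates-1 : Separates 1ᴳ
    separates-1 = separates (1⊳s 0) 1⊳s (λ _ _ _ _ v → NumberValue.1⊳S v)

    -- The critical pair is a number on either side. By `classNum-options` one heap is an option of
    -- the other, in the direction that makes Right's value the larger.
    separates-number : ∀ {k d} → h ≡ k ℕ.+ d → FracB d → ClassNum k → (v : NumberValue k) → Separates (NumberValue.S v)
    separates-number {kᴿ} {b} eᴿ p kr v = separates (≽-⊳-trans S≽q (q⊳s n 0)) (λ m → ≽-⊳-trans S≽q (q⊳s n m))
      λ {kᴸ} {a} eᴸ 1≤a q kl w → compare-values kᴸ w (classNum-options q p (subst ClassNum eᴸ c) (trans (sym eᴸ) eᴿ) kl kr)
      where
      open NumberValue v
      compare-values : ∀ kᴸ (w : NumberValue kᴸ) → (∃[ d ] (kᴿ ≡ kᴸ ℕ.+ d × 1 ℕ.≤ d × FracA d)) ⊎ (∃[ d ] (kᴸ ≡ kᴿ ℕ.+ d × FracB d)) → S ⊳ NumberValue.S w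
      compare-values kᴸ w o = ≽-⊳-trans (proj₂ value) (⊳-≽-trans (option o) (proj₁ (NumberValue.value w)))
        where
        option : (∃[ d ] (kᴿ ≡ kᴸ ℕ.+ d × 1 ℕ.≤ d × FracA d)) ⊎ (∃[ d ] (kᴸ ≡ kᴿ ℕ.+ d × FracB d)) → H kᴿ ⊳ H kᴸ
        option (inj₁ (d , e , 1≤d , a)) = ⊳-left (left-H⁺ e 1≤d a)
        option (inj₂ (d , e , b))       = right-⊳ (right-H⁺ e b)

    right-bound : ∀ {R} → (∃₂ λ k d → h ≡ k ℕ.+ d × (1 ℕ.≤ d × FracB d) × R ≡ H k) → ∃[ r ] (IsDyadic r × Separates r × Above R r)
    right-bound (k , d , e , (1≤d , b) , refl) = by-class (classify k)
      where
      by-class : Class k → ∃[ r ] (IsDyadic r × Separates r × Above (H k) r)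
      by-class (inB p)   = 1ᴳ , isDyadic-1 , separates-1 , λ x q → hasOne-⊳ x (bee (rec′ e 1≤d) p) q
      by-class (inOne p) = 1ᴳ , isDyadic-1 , separates-1 , λ x q → ⊵⇒⊳ isDyadic-1 x (one (rec′ e 1≤d) p) q
      by-class (inNum p) = let v = num (rec′ e 1≤d) p in
        NumberValue.S v , NumberValue.isDy v , separates-number e b p v , λ _ q → ≽-⊳-trans (proj₁ (NumberValue.value v)) q
      by-class (inAB₀ p) = ⊥-elim (B-move-from-Num b (subst ClassNum e c) p)

    -- The least Right bound is one of the bounds or the default 1, so it still separates; all Left
    -- bounds, with default 0, lie below it, and a dyadic fits into the gap.
    fitting : ∃₂ λ k m → Simplest.Fits (H h) (dyadic m k)
    fitting =
      let r , rd , (r⊳0 , rL) , _ , above = greatest-bound {Separates} (right (H h)) isDyadic-1 separates-1 (λ R∈ → right-bound (right-H⁻ R∈))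
          l , ld , r⊳l , _ , below = least-bound {r ⊳_} (left (H h)) isDyadic-0 r⊳0 rL
          _ , (m , k , e) , r⊳x , x⊳l = dyadic-dense rd ld r⊳l
      in k , m , (λ L∈ → below L∈ (m , k , refl) (subst (_⊳ l) e x⊳l)) , (λ R∈ → above R∈ (m , k , refl) (subst (r ⊳_) e r⊳x))

    step-num : NumberValue h
    step-num = by-move (classNum-A-move c)
      where
      by-move : ∃[ n ] (1 ℕ.≤ n × ((2 ℕ.+ h ≡ fe (suc n)) ⊎ (∃₂ λ k d → h ≡ k ℕ.+ d × 2 ℕ.+ k ≡ fe (suc n) × 1 ℕ.≤ d × FracA d))) → NumberValue h
      by-move (n , 1≤n , inj₁ e) = record
        { S = qᴳ n ; isDy = isDyadic-q n ; value = step-que n e ; 1⊳S = 1⊳q n 1≤n ; n = n ; 1≤n = 1≤n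
        ; size = ℕ.≤-reflexive (sym e) ; S≽q = ≽-refl (qᴳ n) }
      by-move (n , 1≤n , inj₂ (k , d , e , e′ , 1≤d , a)) =
        let k′ , m′ , fits = fitting
            S , sd , v = Simplest.simplest (H h) k′ m′ fits
            d′ , e″ , b = classNum-B-move h c
        in record
        { S = S ; isDy = sd ; value = v
        -- Right's move to the heap 1 bounds the number above, Left's move to F(2n+4) - 2 bounds it
        -- below by q(n).
        ; 1⊳S = ⊳-≽-trans (subst (_⊳ H h) H-1 (right-⊳ (right-H⁺ e″ b))) (proj₁ v)
        ; n = n ; 1≤n = 1≤n
        ; size = ℕ.≤-trans (ℕ.≤-reflexive (sym e′)) (ℕ.+-monoʳ-≤ 2 (ℕ.≤-trans (ℕ.m≤m+n k d) (ℕ.≤-reflexive (sym e))))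
        ; S≽q = dyadic-⊳⇒≽ sd (isDyadic-q n) (≽-⊳-trans (proj₂ v) (⊳-≽-trans (⊳-left (left-H⁺ e 1≤d a)) (proj₁ (que (rec′ e 1≤d) n e′)))) }

  values-step : Values h
  values-step = record { one = step-one ; bee = step-bee ; num = step-num ; gee = step-gee ; ess = step-ess ; que = step-que }

values : ∀ h → Values h
values = <-rec Values Step.values-step

-- Among Right's options, hot heaps allow a reply near 1, heaps of class B² + 1 exceed every s(m),
-- and a heap F(2m′+3) - 2 has m ≤ m′ by `γ-B-move`.
γ-⊵ : ∀ {h} i m → 1 ℕ.≤ m → 1 ℕ.≤ i → 2 ℕ.+ h ≡ γ i m →
  ∀ {R} → R ∈ right (H h) → (∃[ M ] (M ∈ left R × M ⊵ 1ᴳ)) ⊎ R ⊵ sᴳ m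
γ-⊵ {h} i m 1≤m 1≤i e R∈ = rights (right-H⁻ R∈)
  where
  rights : ∀ {R} → (∃₂ λ k d → h ≡ k ℕ.+ d × (1 ℕ.≤ d × FracB d) × R ≡ H k) → (∃[ M ] (M ∈ left R × M ⊵ 1ᴳ)) ⊎ R ⊵ sᴳ m
  rights (k , d , e′ , (1≤d , b) , refl) = by-view (view (values k))
    where
    by-view : View k → HasOne k ⊎ H k ⊵ sᴳ m
    by-view (is-hot _ o)           = inj₁ o
    by-view (is-one _ o)           = inj₂ λ u p → o u (≽-⊳-trans (dyadic-⊳⇒≽ isDyadic-1 (isDyadic-s m) (1⊳s m)) p)
    by-view (is-number _ v)        = inj₂ (≽⇒⊵ (isDyadic-s m) (≽-trans (proj₁ (NumberValue.value v)) (≽-trans (NumberValue.S≽q v)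
      (dyadic-⊳⇒≽ (isDyadic-q (NumberValue.n v)) (isDyadic-s m) (q⊳s (NumberValue.n v) m)))))
    by-view (is-gee _ _ _ _ _ o _) = inj₁ o
    by-view (is-ess m′ e″ v)       = inj₂ (≽⇒⊵ (isDyadic-s m) (≽-trans (proj₁ v) (s-mono m m′ (γ-B-move i m m′ (trans (cong (2 ℕ.+_) (sym e′)) e) e″ b))))

γ-nearSwitch : ∀ {h} i m → 1 ℕ.≤ m → 1 ℕ.≤ i → 2 ℕ.+ h ≡ γ i m → NearSwitch (H h) (sᴳ m)
γ-nearSwitch {h} i m 1≤m 1≤i e = record
  { lower = λ u p → second (λ R∈ → right-⊳U u p (γ-⊵ i m 1≤m 1≤i e R∈))
      (λ L∈ → byLeft (proj₁ (proj₂ (proj₁ switches))) (proj₂ (proj₂ (proj₁ switches)) (dyadic-left u L∈)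
        (⊳-≽-trans (1⊳U u p) (isDyadic-≽-left u L∈))))
  ; upper = H-⊴1 h
  ; rights = γ-⊵ i m 1≤m 1≤i e
  ; lefts = λ L∈ → left-⊴1 (left-H⁻ L∈)
  ; toOne = proj₁ switches
  ; toRight = let R , R∈ , v = proj₂ switches in R , R∈ , proj₂ v
  }
  where
  switches : HasOne h × HasRight h (sᴳ m)
  switches = gee (values h) i m 1≤m 1≤i e
  1⊳U : ∀ {U} → IsDyadic U → sᴳ m ⊳ U → 1ᴳ ⊳ U
  1⊳U u p = ≽-⊳-trans (dyadic-⊳⇒≽ isDyadic-1 (isDyadic-s m) (1⊳s m)) p
  right-⊳U : ∀ {U R} → IsDyadic U → sᴳ m ⊳ U → (∃[ M ] (M ∈ left R × M ⊵ 1ᴳ)) ⊎ R ⊵ sᴳ m → R ⊳ U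
  right-⊳U u p (inj₁ (M , M∈ , o)) = byLeft M∈ (o u (1⊳U u p))
  right-⊳U u p (inj₂ o)            = ⊵⇒⊳ (isDyadic-s m) u o p
  left-⊴1 : ∀ {L} → (∃₂ λ k d → h ≡ k ℕ.+ d × (1 ℕ.≤ d × FracA d) × L ≡ H k) → L ⊴ 1ᴳ
  left-⊴1 (k , _ , _ , _ , refl) = H-⊴1 k

B-nearSwitch : ∀ {h} → FracB h → NearSwitch (H h) 0ᴳ
B-nearSwitch {h} p = record
  { lower = H-⊵0 h
  ; upper = H-⊴1 h
  ; rights = λ R∈ → inj₂ (right-⊵0 (right-H⁻ R∈))
  ; lefts = λ L∈ → left-⊴1 (left-H⁻ L∈)
  ; toOne = bee (values h) p
  ; toRight = let R , R∈ , v = H0-right p in R , R∈ , proj₂ v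
  }
  where
  left-⊴1 : ∀ {L} → (∃₂ λ k d → h ≡ k ℕ.+ d × (1 ℕ.≤ d × FracA d) × L ≡ H k) → L ⊴ 1ᴳ
  left-⊴1 (k , _ , _ , _ , refl) = H-⊴1 k
  right-⊵0 : ∀ {R} → (∃₂ λ k d → h ≡ k ℕ.+ d × (1 ℕ.≤ d × FracB d) × R ≡ H k) → R ⊵ 0ᴳ
  right-⊵0 (k , _ , _ , _ , refl) = H-⊵0 k

-- Rational values

/-mono-≤ : ∀ {i j a b} .{{_ : ℕ.NonZero a}} .{{_ : ℕ.NonZero b}} → i ℤ.* + b ℤ.≤ j ℤ.* + a → i ℚ./ a ℚ.≤ j ℚ./ b
/-mono-≤ {i} {j} {suc a} {suc b} p = ℚ.toℚᵘ-cancel-≤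
  (ℚᵘ.≤-respˡ-≃ (ℚᵘ.≃-sym (ℚ.toℚᵘ-fromℚᵘ (ℚᵘ.mkℚᵘ i a))) (ℚᵘ.≤-respʳ-≃ (ℚᵘ.≃-sym (ℚ.toℚᵘ-fromℚᵘ (ℚᵘ.mkℚᵘ j b))) (ℚᵘ.*≤* p)))

/-mono-< : ∀ {i j a b} .{{_ : ℕ.NonZero a}} .{{_ : ℕ.NonZero b}} → i ℤ.* + b ℤ.< j ℤ.* + a → i ℚ./ a ℚ.< j ℚ./ b
/-mono-< {i} {j} {suc a} {suc b} p = ℚ.toℚᵘ-cancel-<
  (ℚᵘ.<-respˡ-≃ (ℚᵘ.≃-sym (ℚ.toℚᵘ-fromℚᵘ (ℚᵘ.mkℚᵘ i a))) (ℚᵘ.<-respʳ-≃ (ℚᵘ.≃-sym (ℚ.toℚᵘ-fromℚᵘ (ℚᵘ.mkℚᵘ j b))) (ℚᵘ.*<* p)))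

fromℚᵘ-* : ∀ p r → ℚ.fromℚᵘ p ℚ.* ℚ.fromℚᵘ r ≡ ℚ.fromℚᵘ (p ℚᵘ.* r)
fromℚᵘ-* p r = ℚ.toℚᵘ-injective (ℚᵘ.≃-trans (ℚ.toℚᵘ-homo-* (ℚ.fromℚᵘ p) (ℚ.fromℚᵘ r))
  (ℚᵘ.≃-trans (ℚᵘ.*-cong (ℚ.toℚᵘ-fromℚᵘ p) (ℚ.toℚᵘ-fromℚᵘ r)) (ℚᵘ.≃-sym (ℚ.toℚᵘ-fromℚᵘ (p ℚᵘ.* r)))))

fromℚᵘ-+ : ∀ p r → ℚ.fromℚᵘ p ℚ.+ ℚ.fromℚᵘ r ≡ ℚ.fromℚᵘ (p ℚᵘ.+ r)
fromℚᵘ-+ p r = ℚ.toℚᵘ-injective (ℚᵘ.≃-trans (ℚ.toℚᵘ-homo-+ (ℚ.fromℚᵘ p) (ℚ.fromℚᵘ r))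
  (ℚᵘ.≃-trans (ℚᵘ.+-cong (ℚ.toℚᵘ-fromℚᵘ p) (ℚ.toℚᵘ-fromℚᵘ r)) (ℚᵘ.≃-sym (ℚ.toℚᵘ-fromℚᵘ (p ℚᵘ.+ r)))))

-- Carries the whole expression to unnormalised fractions, where equality is cross multiplication
-- and no gcd gets in the way.
scaled-sum : ∀ i d c e N →
  (+ 2 ℚ./ 3) ℚ.* ((ℚ.fromℚᵘ (ℚᵘ.mkℚᵘ i d) ℚ.+ ℚ.fromℚᵘ (ℚᵘ.mkℚᵘ c e)) ℚ.* ℚ.fromℚᵘ (ℚᵘ.mkℚᵘ (+ 1) N)) ≡
  ℚ.fromℚᵘ (ℚᵘ.mkℚᵘ (+ 2) 2 ℚᵘ.* ((ℚᵘ.mkℚᵘ i d ℚᵘ.+ ℚᵘ.mkℚᵘ c e) ℚᵘ.* ℚᵘ.mkℚᵘ (+ 1) N))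
scaled-sum i d c e N = trans
  (cong ((+ 2 ℚ./ 3) ℚ.*_) (trans (cong (ℚ._* ℚ.fromℚᵘ (ℚᵘ.mkℚᵘ (+ 1) N)) (fromℚᵘ-+ (ℚᵘ.mkℚᵘ i d) (ℚᵘ.mkℚᵘ c e)))
    (fromℚᵘ-* (ℚᵘ.mkℚᵘ i d ℚᵘ.+ ℚᵘ.mkℚᵘ c e) (ℚᵘ.mkℚᵘ (+ 1) N))))
  (fromℚᵘ-* (ℚᵘ.mkℚᵘ (+ 2) 2) ((ℚᵘ.mkℚᵘ i d ℚᵘ.+ ℚᵘ.mkℚᵘ c e) ℚᵘ.* ℚᵘ.mkℚᵘ (+ 1) N))

triple : ℤ → ℤ
triple j = j ℤ.+ j ℤ.+ j

4^≡1+3third : ∀ n → + (4 ℕ.^ n) ≡ + 1 ℤ.+ triple (third n)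
4^≡1+3third zero    = refl
4^≡1+3third (suc n) = trans (ℤ.pos-* 4 (4 ℕ.^ n)) (trans (cong (+ 4 ℤ.*_) (4^≡1+3third n)) (lemma (third n)))
  where
  lemma : ∀ j → + 4 ℤ.* (+ 1 ℤ.+ (j ℤ.+ j ℤ.+ j)) ≡ + 1 ℤ.+ ((+ 1 ℤ.+ (j ℤ.+ j ℤ.+ (j ℤ.+ j))) ℤ.+ (+ 1 ℤ.+ (j ℤ.+ j ℤ.+ (j ℤ.+ j))) ℤ.+ (+ 1 ℤ.+ (j ℤ.+ j ℤ.+ (j ℤ.+ j))))
  lemma = solve-∀

/-congʳ : ∀ i {a b} .{{_ : ℕ.NonZero a}} .{{_ : ℕ.NonZero b}} → a ≡ b → i ℚ./ a ≡ i ℚ./ b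
/-congʳ i refl = refl

4^≡2^ : ∀ n → 4 ℕ.^ n ≡ 2 ℕ.^ (n ℕ.* 2)
4^≡2^ n = trans (ℕ.^-*-assoc 2 2 n) (cong (2 ℕ.^_) (ℕ.*-comm 2 n))

-- With 4ⁿ = 1 + 3j the factor (2/3)(4ⁿ - 1) is the integer 2j.
s-dyadic : ∀ n → s n ≡ double (third n) /2^ (n ℕ.* 2)
s-dyadic n = trans (fraction (4 ℕ.^ n) {{ℕ.m^n≢0 4 n}} (third n) (4^≡1+3third n))
  (/-congʳ (double (third n)) {{ℕ.m^n≢0 4 n}} {{ℕ.m^n≢0 2 (n ℕ.* 2)}} (4^≡2^ n))
  where
  fraction : ∀ N .{{_ : ℕ.NonZero N}} j → + N ≡ + 1 ℤ.+ triple j →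
    (+ 2 ℚ./ 3) ℚ.* ((+ N ℚ./ 1 ℚ.- 1ℚ) ℚ.* (+ 1 ℚ./ N)) ≡ double j ℚ./ N
  fraction (suc N) j e = trans (scaled-sum (+ suc N) 0 -[1+ 0 ] 0 N) (ℚ.fromℚᵘ-cong
    {ℚᵘ.mkℚᵘ (+ 2) 2 ℚᵘ.* ((ℚᵘ.mkℚᵘ (+ suc N) 0 ℚᵘ.+ ℚᵘ.mkℚᵘ -[1+ 0 ] 0) ℚᵘ.* ℚᵘ.mkℚᵘ (+ 1) N)} {ℚᵘ.mkℚᵘ (double j) N} (ℚᵘ.*≡* (trans
    (subst (λ M → + 2 ℤ.* ((M ℤ.* + 1 ℤ.+ -[1+ 0 ] ℤ.* + 1) ℤ.* + 1) ℤ.* M ≡ double j ℤ.* (+ 3 ℤ.* M)) (sym e) (lemma j))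
    (cong (λ z → double j ℤ.* + z) (denominator N)))))
    where
    lemma : ∀ j → + 2 ℤ.* (((+ 1 ℤ.+ (j ℤ.+ j ℤ.+ j)) ℤ.* + 1 ℤ.+ -[1+ 0 ] ℤ.* + 1) ℤ.* + 1) ℤ.* (+ 1 ℤ.+ (j ℤ.+ j ℤ.+ j))
      ≡ (j ℤ.+ j) ℤ.* (+ 3 ℤ.* (+ 1 ℤ.+ (j ℤ.+ j ℤ.+ j)))
    lemma = solve-∀
    denominator : ∀ N → 3 ℕ.* suc N ≡ 3 ℕ.* (1 ℕ.* 1 ℕ.* suc N)
    denominator = ℕ-Ring.solve-∀

-- With 4ⁿ = 1 + 3j the factor (2/3)(4ⁿ + 1/2) is the integer 2j + 1.
q-dyadic : ∀ n → q n ≡ ℤ.suc (double (third n)) /2^ (n ℕ.* 2)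
q-dyadic n = trans (fraction (4 ℕ.^ n) {{ℕ.m^n≢0 4 n}} (third n) (4^≡1+3third n))
  (/-congʳ (ℤ.suc (double (third n))) {{ℕ.m^n≢0 4 n}} {{ℕ.m^n≢0 2 (n ℕ.* 2)}} (4^≡2^ n))
  where
  fraction : ∀ N .{{_ : ℕ.NonZero N}} j → + N ≡ + 1 ℤ.+ triple j →
    (+ 2 ℚ./ 3) ℚ.* ((+ N ℚ./ 1 ℚ.+ ½) ℚ.* (+ 1 ℚ./ N)) ≡ ℤ.suc (double j) ℚ./ N
  fraction (suc N) j e = trans (scaled-sum (+ suc N) 0 (+ 1) 1 N) (ℚ.fromℚᵘ-cong
    {ℚᵘ.mkℚᵘ (+ 2) 2 ℚᵘ.* ((ℚᵘ.mkℚᵘ (+ suc N) 0 ℚᵘ.+ ℚᵘ.mkℚᵘ (+ 1) 1) ℚᵘ.* ℚᵘ.mkℚᵘ (+ 1) N)} {ℚᵘ.mkℚᵘ (ℤ.suc (double j)) N} (ℚᵘ.*≡* (trans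
    (subst (λ M → + 2 ℤ.* ((M ℤ.* + 2 ℤ.+ + 1 ℤ.* + 1) ℤ.* + 1) ℤ.* M ≡ ℤ.suc (double j) ℤ.* (+ 6 ℤ.* M)) (sym e) (lemma j))
    (cong (λ z → ℤ.suc (double j) ℤ.* + z) (denominator N)))))
    where
    lemma : ∀ j → + 2 ℤ.* (((+ 1 ℤ.+ (j ℤ.+ j ℤ.+ j)) ℤ.* + 2 ℤ.+ + 1 ℤ.* + 1) ℤ.* + 1) ℤ.* (+ 1 ℤ.+ (j ℤ.+ j ℤ.+ j))
      ≡ (+ 1 ℤ.+ (j ℤ.+ j)) ℤ.* (+ 6 ℤ.* (+ 1 ℤ.+ (j ℤ.+ j ℤ.+ j)))
    lemma = solve-∀
    denominator : ∀ N → 6 ℕ.* suc N ≡ 3 ℕ.* (1 ℕ.* 2 ℕ.* suc N)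
    denominator = ℕ-Ring.solve-∀

·2^-* : ∀ m i → m ·2^ i ≡ m ℤ.* + (2 ℕ.^ i)
·2^-* m zero    = sym (ℤ.*-identityʳ m)
·2^-* m (suc i) = trans (cong double (·2^-* m i)) (trans (lemma m (+ (2 ℕ.^ i))) (cong (m ℤ.*_) (sym (ℤ.pos-* 2 (2 ℕ.^ i)))))
  where
  lemma : ∀ m z → m ℤ.* z ℤ.+ m ℤ.* z ≡ m ℤ.* (+ 2 ℤ.* z)
  lemma = solve-∀

dyadic-level : ∀ m k l → dyadic m k ≡ dyadic (m ℤ.* + (2 ℕ.^ l)) (k ℕ.+ l)
dyadic-level m k l = trans (sym (dyadic-lift l m k)) (cong₂ dyadic (·2^-* m l) (ℕ.+-comm l k))

≽⇒≤ : ∀ m k n l → dyadic m k ≽ dyadic n l → n /2^ l ℚ.≤ m /2^ k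
≽⇒≤ m k n l p = /-mono-≤ {n} {m} {2 ℕ.^ l} {2 ℕ.^ k} {{ℕ.m^n≢0 2 l}} {{ℕ.m^n≢0 2 k}} (dyadic-cancel-≽ (k ℕ.+ l)
  (subst₂ _≽_ (dyadic-level m k l) (trans (dyadic-level n l k) (cong (dyadic (n ℤ.* + (2 ℕ.^ k))) (ℕ.+-comm l k))) p))

⊳⇒< : ∀ m k n l → dyadic m k ⊳ dyadic n l → n /2^ l ℚ.< m /2^ k
⊳⇒< m k n l p = /-mono-< {n} {m} {2 ℕ.^ l} {2 ℕ.^ k} {{ℕ.m^n≢0 2 l}} {{ℕ.m^n≢0 2 k}} (dyadic-cancel-⊳ (k ℕ.+ l)
  (subst₂ _⊳_ (dyadic-level m k l) (trans (dyadic-level n l k) (cong (dyadic (n ℤ.* + (2 ℕ.^ k))) (ℕ.+-comm l k))) p))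

sᴳ-denotes : ∀ n → sᴳ n Denotes s n
sᴳ-denotes n = double (third n) , n ℕ.* 2 , s-dyadic n , sᴳ-dyadic n

qᴳ-denotes : ∀ n → qᴳ n Denotes q n
qᴳ-denotes n = ℤ.suc (double (third n)) , n ℕ.* 2 , q-dyadic n , qᴳ-dyadic n

denotes⇒equals : ∀ {S x} → S Denotes x → S Equals x
denotes⇒equals {S} d = S , d , ≈⇒=ᴳ (≈-refl S)

isVal : ∀ {h S} → IsDyadic S → H h ≈ S → S IsVal h
isVal {h} {S} d (p , q) = ≈⇒=ᴳ (subst (S ≈_) (H≡heap h) (q , p)) , canonical-dyadic d

rcf-switch : ∀ {h T x} → T Denotes x → ¾ ≽ T → NearSwitch (H h) T → switch T IsRcfOf heap h
rcf-switch {h} {T} {x} d@(m , k , e , refl) ¾≽T near =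
  subst (_=ᴵ switch T) (H≡heap h) (nearSwitch⇒=ᴵ (m , k , refl) 1⊳T near) ,
  reduced-switch d (subst (ℚ._< 1ℚ) (sym e) (⊳⇒< (+ 1) 0 m k 1⊳T)) ¾≽T
  where
  1⊳T : 1ᴳ ⊳ T
  1⊳T = ⊳-≽-trans (1⊳q 1 ℕ.≤-refl) ¾≽T

¾≽s : ∀ n → ¾ ≽ sᴳ n
¾≽s n = dyadic-⊳⇒≽ (+ 3 , 2 , refl) (isDyadic-s n) (q⊳s 1 n)

InUnit : ℕ → Set
InUnit h = ∃[ K ] (K IsVal h × (∃[ x ] (K Equals x × ½ ℚ.≤ x × x ℚ.< 1ℚ)))

inUnit : ∀ {h S} → IsDyadic S → H h ≈ S → S ≽ sᴳ 1 → 1ᴳ ⊳ S → InUnit h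
inUnit {h} {S} (m , k , refl) v lower upper = S , isVal (m , k , refl) v , m /2^ k , dyadic⇒number m k ,
  ≽⇒≤ m k (+ 1) 1 lower , ⊳⇒< (+ 1) 0 m k upper

classNum-inUnit : ∀ {h} → ClassNum h → InUnit h
classNum-inUnit {h} c = inUnit isDy value (≽-trans S≽q (dyadic-⊳⇒≽ (isDyadic-q n) (isDyadic-s 1) (q⊳s n 1))) 1⊳S
  where open NumberValue (num (values h) c)

∸2 : ∀ {t h} → 2 ℕ.≤ t → t ℕ.∸ 2 ≡ h → 2 ℕ.+ h ≡ t
∸2 2≤t e = trans (cong (2 ℕ.+_) (sym e)) (ℕ.m+[n∸m]≡n 2≤t)

fo-heap : ∀ n {h} → F (2 ℕ.* n ℕ.+ 3) ℕ.∸ 2 ≡ h → 2 ℕ.+ h ≡ fo (suc n)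
fo-heap n e = ∸2 (fo-suc-≥2 n) (trans (cong (ℕ._∸ 2) (sym (F-2n+3 n))) e)

fe-heap : ∀ n {h} → F (2 ℕ.* n ℕ.+ 4) ℕ.∸ 2 ≡ h → 2 ℕ.+ h ≡ fe (suc n)
fe-heap n e = ∸2 (fe-suc-≥2 n) (trans (cong (ℕ._∸ 2) (sym (F-2n+4 n))) e)

G-heap : ∀ i n {h} → G⟨ i ⟩ n ≡ h → 2 ℕ.+ h ≡ γ i n
G-heap i n e = ∸2 (ℕ.≤-trans (fo-suc-≥2 n) (fo≤γ i n)) (trans (cong (ℕ._∸ 2) (sym expand)) e)
  where
  lemma : ∀ a i o e → suc i ℕ.* o ℕ.+ suc a ℕ.* e ≡ a ℕ.* e ℕ.+ i ℕ.* o ℕ.+ (o ℕ.+ e)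
  lemma = ℕ-Ring.solve-∀
  expand : A i ℕ.* F (2 ℕ.* n ℕ.+ 2) ℕ.+ i ℕ.* F (2 ℕ.* n ℕ.+ 1) ℕ.+ F (2 ℕ.* n ℕ.+ 3) ≡ γ i n
  expand = trans (cong₂ ℕ._+_ (cong₂ ℕ._+_ (cong₂ ℕ._*_ (A≡⌊φ⌋ i) (F-2n+2 n)) (cong (i ℕ.*_) (F-2n+1 n))) (F-2n+3 n))
    (sym (lemma ⌊φ i ⌋ i (fo n) (fe n)))

A∘B : ∀ n → A (B n) ≡ ⌊φ ⌊φ² n ⌋ ⌋
A∘B n = trans (A≡⌊φ⌋ (B n)) (cong ⌊φ_⌋ (B≡⌊φ²⌋ n))

B∘B : ∀ n → B (B n) ≡ ⌊φ² ⌊φ² n ⌋ ⌋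
B∘B n = trans (B≡⌊φ²⌋ (B n)) (cong ⌊φ²_⌋ (B≡⌊φ²⌋ n))

rcf-B : ∀ h → InB h → ⟨ 1ᴳ ∷ [] ∣ 0ᴳ ∷ [] ⟩ IsRcfOf heap h
rcf-B h b = rcf-switch (+ 0 , 0 , refl , refl) (¾≽s 0) (B-nearSwitch (proj₂ (B⇒fracB b)))

rcf-AB₀^ : ∀ h → InAB₀^ h → 1ᴳ IsRcfOf heap h
rcf-AB₀^ h (n , e) = subst (_=ᴵ 1ᴳ) (H≡heap h) (+ε-≽⇒=ᴵ
    (⊵⇒+ε≽ isDyadic-1 (one (values h) (inAB₀^⇒ (n , trans (cong (ℕ._+ 1) (sym (A∘B n))) e))))
    (⊴⇒+ε≽ isDyadic-1 (H-⊴1 h))) ,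
  reduced-dyadic isDyadic-1

val-Q : ∀ h → InQ h → h ≢ 0 → InUnit h
val-Q h (inj₁ b) _ = classNum-inUnit (inB²^⇒ (range⁺-cong (λ n → cong (ℕ._+ 1) (B∘B n)) b))
val-Q h (inj₂ (zero , e)) h≢0 = ⊥-elim (h≢0 (sym e))
val-Q h (inj₂ (suc n , e)) _ = inUnit (isDyadic-s (suc n)) (ess (values h) (suc n) (fo-heap (suc n) e))
  (s-mono 1 (suc n) (ℕ.s≤s ℕ.z≤n)) (1⊳s (suc n))

val-s : ∀ n → ∃[ K ] (K IsVal (F (2 ℕ.* n ℕ.+ 3) ℕ.∸ 2) × K Equals s n)
val-s n = sᴳ n , isVal (isDyadic-s n) (ess (values (F (2 ℕ.* n ℕ.+ 3) ℕ.∸ 2)) n (fo-heap n refl)) , denotes⇒equals (sᴳ-denotes n)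

val-q : ∀ n → ∃[ K ] (K IsVal (F (2 ℕ.* n ℕ.+ 4) ℕ.∸ 2) × K Equals q n)
val-q n = qᴳ n , isVal (isDyadic-q n) (que (values (F (2 ℕ.* n ℕ.+ 4) ℕ.∸ 2)) n (fe-heap n refl)) , denotes⇒equals (qᴳ-denotes n)

rcf-G : ∀ n → 1 ℕ.≤ n → ∀ h → InG n h → InAB₀ h × (∃[ S ] (S Denotes s n × ⟨ 1ᴳ ∷ [] ∣ S ∷ [] ⟩ IsRcfOf heap h))
rcf-G n 1≤n h (i , 1≤i , e) =
  (let m , p = ⇒inAB₀ (γ-classAB₀ i n 1≤n 1≤i (G-heap i n e)) in m , trans (A∘B m) p) ,
  sᴳ n , sᴳ-denotes n , rcf-switch (sᴳ-denotes n) (¾≽s n) (γ-nearSwitch i n 1≤n 1≤i (G-heap i n e))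

theorem2p2 : (∀ h → InB h → ⟨ 1ᴳ ∷ [] ∣ 0ᴳ ∷ [] ⟩ IsRcfOf heap h)
    × (∀ h → InAB₀^ h → 1ᴳ IsRcfOf heap h)
    × (∀ h → InQ h → h ≢ 0 → ∃[ K ] (K IsVal h × (∃[ x ] (K Equals x × ½ ℚ.≤ x × x ℚ.< 1ℚ))))
    × (∀ n → ∃[ K ] (K IsVal (F (2 ℕ.* n ℕ.+ 3) ℕ.∸ 2) × K Equals s n))
    × (∀ n → ∃[ K ] (K IsVal (F (2 ℕ.* n ℕ.+ 4) ℕ.∸ 2) × K Equals q n))
    × (∀ n → 1 ℕ.≤ n → ∀ h → InG n h → InAB₀ h × (∃[ S ] (S Denotes s n × ⟨ 1ᴳ ∷ [] ∣ S ∷ [] ⟩ IsRcfOf heap h)))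
theorem2p2 = rcf-B , rcf-AB₀^ , val-Q , val-s , val-q , rcf-G
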